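{- There is no algorithm that, for every first-order sentence $\varphi$ of vocabulary $\{E\}$ which is equivalent on finite graphs to some universal sentence, computes a universal sentence $\mu$ with $\mathrm{Graph}_{\mathrm{fin}}(\varphi)=\mathrm{Graph}_{\mathrm{fin}}(\mu)$. Equivalently, there is no algorithm that, for every first-order sentence $\varphi$ such that $\mathrm{Graph}_{\mathrm{fin}}(\varphi)=\mathrm{Forb}_{\mathrm{fin}}(\mathcal F)$ for some finite set $\mathcal F$ of finite graphs, computes such a set $\mathcal F$.
   Context: Graphs are $\{E\}$-structures with $E$ binary, irreflexive and symmetric. $\mathrm{Graph}_{\mathrm{fin}}(\varphi)$ is the class of finite graphs that are models of $\varphi$. For a finite set $\mathcal F$ of finite graphs, $\mathrm{Forb}_{\mathrm{fin}}(\mathcal F)$ is the class of finite graphs with no induced subgraph isomorphic to a graph in $\mathcal F$. A first-order formula is universal if it is built from atomic and negated atomic formulas using $\wedge$, $\vee$ and $\forall$. -}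

module Defs where

open import Data.Nat using (ℕ; zero; suc; _+_; _*_; _^_; _<_)
open import Data.Fin using (Fin; toℕ)
open import Data.Fin.Properties using ()
open import Data.Vec using (Vec; []; _∷_; lookup)
open import Data.List using (List; []; _∷_; map; concatMap; allFin)
open import Data.List.Membership.Propositional using (_∈_)
open import Data.Bool using (Bool; true; false)
open import Data.Product using (Σ; _×_; _,_)
open import Data.Sum using (_⊎_)
open import Relation.Nullary using (¬_)
open import Relation.Binary.PropositionalEquality using (_≡_)

record Graph : Set where
  field
    size   : ℕ
    adj    : Fin size → Fin size → Bool
    irrefl : ∀ i → adj i i ≡ false
    sym    : ∀ i j → adj i j ≡ adj j i
open Graph public

-- First-order formulas of vocabulary {E} (with equality), de Bruijn
-- variables: Formula n has free variables among Fin n.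

data Formula : ℕ → Set where
  rel  : ∀ {n} → Fin n → Fin n → Formula n
  equ  : ∀ {n} → Fin n → Fin n → Formula n
  neg  : ∀ {n} → Formula n → Formula n
  and  : ∀ {n} → Formula n → Formula n → Formula n
  or   : ∀ {n} → Formula n → Formula n → Formula n
  all  : ∀ {n} → Formula (suc n) → Formula n
  ex   : ∀ {n} → Formula (suc n) → Formula n

Sentence : Set
Sentence = Formula 0

data Universal : ∀ {n} → Formula n → Set where
  u-rel    : ∀ {n} (i j : Fin n) → Universal (rel i j)
  u-equ    : ∀ {n} (i j : Fin n) → Universal (equ i j)
  u-negrel : ∀ {n} (i j : Fin n) → Universal (neg (rel i j))
  u-negequ : ∀ {n} (i j : Fin n) → Universal (neg (equ i j))
  u-and    : ∀ {n} {φ ψ : Formula n} → Universal φ → Universal ψ → Universal (and φ ψ)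
  u-or     : ∀ {n} {φ ψ : Formula n} → Universal φ → Universal ψ → Universal (or φ ψ)
  u-all    : ∀ {n} {φ : Formula (suc n)} → Universal φ → Universal (all φ)

extend : ∀ {n m} → Fin m → (Fin n → Fin m) → Fin (suc n) → Fin m
extend v ρ Fin.zero    = v
extend v ρ (Fin.suc i) = ρ i

Sat : (G : Graph) → ∀ {n} → Formula n → (Fin n → Fin (size G)) → Set
Sat G (rel i j) ρ = adj G (ρ i) (ρ j) ≡ true
Sat G (equ i j) ρ = ρ i ≡ ρ j
Sat G (neg φ)   ρ = ¬ Sat G φ ρ
Sat G (and φ ψ) ρ = Sat G φ ρ × Sat G ψ ρ
Sat G (or φ ψ)  ρ = Sat G φ ρ ⊎ Sat G ψ ρ
Sat G (all φ)   ρ = ∀ v → Sat G φ (extend v ρ)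
Sat G (ex φ)    ρ = Σ (Fin (size G)) λ v → Sat G φ (extend v ρ)

noVar : ∀ {m} → Fin 0 → Fin m
noVar ()

_⊨_ : Graph → Sentence → Set
G ⊨ φ = Sat G φ noVar

_⇔_ : Set → Set → Set
A ⇔ B = (A → B) × (B → A)

SameFinGraphs : Sentence → Sentence → Set
SameFinGraphs φ ψ = ∀ (G : Graph) → (G ⊨ φ) ⇔ (G ⊨ ψ)

InducedEmb : Graph → Graph → Set
InducedEmb H G =
  Σ (Fin (size H) → Fin (size G)) λ f →
    (∀ i j → f i ≡ f j → i ≡ j) ×
    (∀ i j → adj G (f i) (f j) ≡ adj H i j)

Forb : List Graph → Graph → Set
Forb F G = ∀ H → H ∈ F → ¬ InducedEmb H G

DefinesForb : Sentence → List Graph → Set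
DefinesForb φ F = ∀ (G : Graph) → (G ⊨ φ) ⇔ Forb F G

pair : ℕ → ℕ → ℕ
pair a b = 2 ^ a * (2 * b + 1)

codeList : List ℕ → ℕ
codeList []       = 0
codeList (x ∷ xs) = suc (pair x (codeList xs))

codeF : ∀ {n} → Formula n → ℕ
codeF (rel i j) = pair 0 (pair (toℕ i) (toℕ j))
codeF (equ i j) = pair 1 (pair (toℕ i) (toℕ j))
codeF (neg φ)   = pair 2 (codeF φ)
codeF (and φ ψ) = pair 3 (pair (codeF φ) (codeF ψ))
codeF (or φ ψ)  = pair 4 (pair (codeF φ) (codeF ψ))
codeF (all φ)   = pair 5 (codeF φ)
codeF (ex φ)    = pair 6 (codeF φ)

bit : Bool → ℕ
bit false = 0
bit true  = 1

codeG : Graph → ℕ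
codeG G = pair (size G)
  (codeList (concatMap (λ i → map (λ j → bit (adj G i j)) (allFin (size G))) (allFin (size G))))

codeGs : List Graph → ℕ
codeGs F = codeList (map codeG F)

-- Algorithms: μ-recursive (partial recursive) functions on ℕ.

data Rec : ℕ → Set where
  Z : ∀ {k} → Rec k
  S : Rec 1
  P : ∀ {k} → Fin k → Rec k
  C : ∀ {k m} → Rec m → Vec (Rec k) m → Rec k
  R : ∀ {k} → Rec k → Rec (suc (suc k)) → Rec (suc k)
  M : ∀ {k} → Rec (suc k) → Rec k

mutual
  data _[_]⇓_ : ∀ {k} → Rec k → Vec ℕ k → ℕ → Set where
    ev-Z   : ∀ {k} {xs : Vec ℕ k} → Z [ xs ]⇓ 0
    ev-S   : ∀ {x} → S [ x ∷ [] ]⇓ suc x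
    ev-P   : ∀ {k} {i : Fin k} {xs} → P i [ xs ]⇓ lookup xs i
    ev-C   : ∀ {k m} {f : Rec m} {gs : Vec (Rec k) m} {xs ys r} →
             gs [ xs ]⇓* ys → f [ ys ]⇓ r → C f gs [ xs ]⇓ r
    ev-R0  : ∀ {k} {f : Rec k} {g} {xs r} →
             f [ xs ]⇓ r → R f g [ 0 ∷ xs ]⇓ r
    ev-RS  : ∀ {k} {f : Rec k} {g} {n xs r r′} →
             R f g [ n ∷ xs ]⇓ r → g [ n ∷ r ∷ xs ]⇓ r′ → R f g [ suc n ∷ xs ]⇓ r′
    ev-M   : ∀ {k} {f : Rec (suc k)} {xs y} →
             f [ y ∷ xs ]⇓ 0 →
             (∀ z → z < y → Σ ℕ λ r → f [ z ∷ xs ]⇓ suc r) →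
             M f [ xs ]⇓ y

  data _[_]⇓*_ : ∀ {k m} → Vec (Rec k) m → Vec ℕ k → Vec ℕ m → Set where
    ev-[] : ∀ {k} {xs : Vec ℕ k} → [] [ xs ]⇓* []
    ev-∷  : ∀ {k m} {g : Rec k} {gs : Vec (Rec k) m} {xs y ys} →
            g [ xs ]⇓ y → gs [ xs ]⇓* ys → (g ∷ gs) [ xs ]⇓* (y ∷ ys)

{-# OPTIONS --safe #-}
module Submission where

-- From an alleged algorithm c we construct a sentence φ that refers to the run of c on the code
-- of φ itself. If c returns m, then there is a graph ℋ N with more than m vertices such that φ
-- says, up to a fixed universal sentence, that ℋ N is not an induced subgraph. Hence φ is
-- equivalent to a universal sentence, but no universal sentence with code m, and no list of
-- forbidden graphs with code m, can exclude ℋ N without excluding a smaller graph.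
--
-- The graph ℋ N represents the numbers 0 … N with their order, their successor relation and the
-- relation "the i-th binary digit of j is 1". Each number is a triangle of vertices of three
-- types, and the types are marked by an asymmetric graph of parameters. Since order and
-- successor are quantifier-free, a universal sentence guarantees that no graph can insert
-- further elements into such a copy, so that arbitrary first-order properties of it may be
-- expressed in φ without losing closure under induced subgraphs. The digit relation is membership
-- of hereditarily finite sets, which codes pairs and finite sequences, and so the graph of every
-- recursive function is first-order definable once N is large enough.

open import Defs
open import Data.Nat
open import Data.Nat.Induction using (<-rec)
open import Data.Nat.Properties
open import Data.Fin using (Fin; zero; suc; toℕ; fromℕ; fromℕ<; cast; _↑ˡ_; _↑ʳ_; splitAt; join; combine; remQuot)
open import Data.Fin.Properties using (any?; all?; ¬∀⟶∃¬; toℕ-fromℕ; toℕ-fromℕ<; toℕ<n; toℕ-injective; toℕ-↑ˡ; toℕ-cast; cast-is-id; ↑ˡ-injective; splitAt-↑ˡ; splitAt-↑ʳ; join-splitAt; combine-remQuot; remQuot-combine; pigeonhole; injective⇒≤) renaming (_≟_ to _≟ᶠ_)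
open import Data.Bool using (Bool; true; false; not; _∧_; _∨_)
open import Data.Bool.Properties using (∧-comm; ∧-idem) renaming (_≟_ to _≟ᵇ_)
open import Data.Vec using (Vec; []; _∷_; lookup; tabulate)
open import Data.Vec.Properties using (lookup∘tabulate)
open import Data.List using (List; []; _∷_; _++_; length; map; concatMap; allFin; filter; cartesianProductWith)
open import Data.List.Properties using (length-++)
open import Data.List.Relation.Unary.Any using (here; there)
open import Data.List.Membership.Propositional using (_∈_)
open import Data.List.Membership.Propositional.Properties using (∈-++⁺ˡ; ∈-++⁺ʳ; ∈-map⁺; ∈-filter⁺; ∈-filter⁻; ∈-cartesianProductWith⁺)
open import Data.Product using (Σ; _×_; _,_; proj₁; proj₂; map₂; uncurry)
open import Data.Sum using (_⊎_; inj₁; inj₂; [_,_]′)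
open import Data.Empty using (⊥; ⊥-elim)
open import Function using (_∘_; id)
open import Relation.Nullary using (¬_; Dec; yes; no; ¬?; _×-dec_; _⊎-dec_; _→-dec_)
open import Relation.Nullary.Decidable using (decidable-stable; isYes; from-yes)
open import Relation.Binary using (tri<; tri≈; tri>)
open import Relation.Binary.PropositionalEquality using (_≡_; _≢_; refl; cong; cong₂; trans; subst; subst₂; module ≡-Reasoning) renaming (sym to ≡-sym)

-- An alleged algorithm is held to its promise only on sentences that satisfy the premise, so φ must
-- be equivalent to a universal sentence whether or not `c` halts on the code of φ. Hence φ contains
-- no bound on the computation. It excludes copies of `ℋ N` for all N in which a value is visible,
-- and these exclusions reduce to the one for the least such N, or to none at all. Which case holds
-- is not decided; both claims are negations, so doubly negated existence is enough. No recursion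
-- theorem for `Rec` is invoked. The program inside φ needs an argument from which it can compute
-- the code of φ, and that argument cannot be written into the innermost formula, being the code of
-- that formula. It is therefore supplied from outside, as the number of quantifier blocks around
-- it: each block moves a counter one step along the order, so after κ blocks the counter stands for
-- κ.

private variable
  j k m n : ℕ
  A B : Set

-- Determinism of evaluation, and programs that compute codes of formulas

mutual
  ⇓-deterministic : ∀ {k} {f : Rec k} {xs y z} → f [ xs ]⇓ y → f [ xs ]⇓ z → y ≡ z
  ⇓-deterministic ev-Z ev-Z = refl
  ⇓-deterministic ev-S ev-S = refl
  ⇓-deterministic ev-P ev-P = refl
  ⇓-deterministic (ev-C gs f) (ev-C gs′ f′) with ⇓*-deterministic gs gs′
  ... | refl = ⇓-deterministic f f′
  ⇓-deterministic (ev-R0 f) (ev-R0 f′) = ⇓-deterministic f f′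
  ⇓-deterministic (ev-RS d e) (ev-RS d′ e′) with ⇓-deterministic d d′
  ... | refl = ⇓-deterministic e e′
  ⇓-deterministic {y = y} {z} (ev-M d below) (ev-M d′ below′) with <-cmp y z
  ... | tri≈ _ y≡z _ = y≡z
  ... | tri< y<z _ _ with ⇓-deterministic d (proj₂ (below′ y y<z))
  ...   | ()
  ⇓-deterministic {y = y} {z} (ev-M d below) (ev-M d′ below′) | tri> _ _ z<y
    with ⇓-deterministic (proj₂ (below z z<y)) d′
  ...   | ()

  ⇓*-deterministic : ∀ {k m} {gs : Vec (Rec k) m} {xs ys zs} →
                     gs [ xs ]⇓* ys → gs [ xs ]⇓* zs → ys ≡ zs
  ⇓*-deterministic ev-[] ev-[] = refl
  ⇓*-deterministic (ev-∷ d ds) (ev-∷ e es) = cong₂ _∷_ (⇓-deterministic d e) (⇓*-deterministic ds es)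

ev-C₁ : ∀ {k} {f : Rec 1} {g : Rec k} {xs y r} →
        g [ xs ]⇓ y → f [ y ∷ [] ]⇓ r → C f (g ∷ []) [ xs ]⇓ r
ev-C₁ dg df = ev-C (ev-∷ dg ev-[]) df

ev-C₂ : ∀ {k} {f : Rec 2} {g h : Rec k} {xs y z r} →
        g [ xs ]⇓ y → h [ xs ]⇓ z → f [ y ∷ z ∷ [] ]⇓ r → C f (g ∷ h ∷ []) [ xs ]⇓ r
ev-C₂ dg dh df = ev-C (ev-∷ dg (ev-∷ dh ev-[])) df

constᴿ : ∀ {k} → ℕ → Rec k
constᴿ zero    = Z
constᴿ (suc n) = C S (constᴿ n ∷ [])

constᴿ-⇓ : ∀ {k} n {xs : Vec ℕ k} → constᴿ n [ xs ]⇓ n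
constᴿ-⇓ zero    = ev-Z
constᴿ-⇓ (suc n) = ev-C₁ (constᴿ-⇓ n) ev-S

addᴿ : Rec 2
addᴿ = R (P zero) (C S (P (suc zero) ∷ []))

addᴿ-⇓ : ∀ m n → addᴿ [ m ∷ n ∷ [] ]⇓ (m + n)
addᴿ-⇓ zero    n = ev-R0 ev-P
addᴿ-⇓ (suc m) n = ev-RS (addᴿ-⇓ m n) (ev-C₁ ev-P ev-S)

mulᴿ : Rec 2
mulᴿ = R Z (C addᴿ (P (suc (suc zero)) ∷ P (suc zero) ∷ []))

mulᴿ-⇓ : ∀ m n → mulᴿ [ m ∷ n ∷ [] ]⇓ (m * n)
mulᴿ-⇓ zero    n = ev-R0 ev-Z
mulᴿ-⇓ (suc m) n = ev-RS (mulᴿ-⇓ m n) (ev-C₂ ev-P ev-P (addᴿ-⇓ n (m * n)))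

powᴿ : Rec 1
powᴿ = R (constᴿ 1) (C mulᴿ (constᴿ 2 ∷ P (suc zero) ∷ []))

powᴿ-⇓ : ∀ n → powᴿ [ n ∷ [] ]⇓ (2 ^ n)
powᴿ-⇓ zero    = ev-R0 (constᴿ-⇓ 1)
powᴿ-⇓ (suc n) = ev-RS (powᴿ-⇓ n) (ev-C₂ (constᴿ-⇓ 2) ev-P (mulᴿ-⇓ 2 (2 ^ n)))

pairᴿ : ∀ {k} → Rec k → Rec k → Rec k
pairᴿ f g = C mulᴿ (C powᴿ (f ∷ []) ∷ C addᴿ (C mulᴿ (constᴿ 2 ∷ g ∷ []) ∷ constᴿ 1 ∷ []) ∷ [])

pairᴿ-⇓ : ∀ {k} {f g : Rec k} {xs a b} → f [ xs ]⇓ a → g [ xs ]⇓ b → pairᴿ f g [ xs ]⇓ pair a b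
pairᴿ-⇓ {a = a} {b} df dg =
  ev-C₂ (ev-C₁ df (powᴿ-⇓ a))
        (ev-C₂ (ev-C₂ (constᴿ-⇓ 2) dg (mulᴿ-⇓ 2 b)) (constᴿ-⇓ 1) (addᴿ-⇓ (2 * b) 1))
        (mulᴿ-⇓ (2 ^ a) (2 * b + 1))

codeAlls : ℕ → ℕ → ℕ
codeAlls zero    x = x
codeAlls (suc j) x = codeAlls j (pair 5 x)

allsᴿ : ∀ {k} → ℕ → Rec k → Rec k
allsᴿ zero    f = f
allsᴿ (suc j) f = allsᴿ j (pairᴿ (constᴿ 5) f)

allsᴿ-⇓ : ∀ {k} j {f : Rec k} {xs x} → f [ xs ]⇓ x → allsᴿ j f [ xs ]⇓ codeAlls j x
allsᴿ-⇓ zero    d = d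
allsᴿ-⇓ (suc j) d = allsᴿ-⇓ j (pairᴿ-⇓ (constᴿ-⇓ 5) d)

-- The code of ∀ … ∀ (ψ ∨ χ), with j quantifiers, from the codes a of ψ and x of χ.
codeAllOr : ℕ → ℕ → ℕ → ℕ
codeAllOr j a x = codeAlls j (pair 4 (pair a x))

allOrᴿ : ∀ {k} → ℕ → ℕ → Rec k → Rec k
allOrᴿ j a f = allsᴿ j (pairᴿ (constᴿ 4) (pairᴿ (constᴿ a) f))

allOrᴿ-⇓ : ∀ {k} j a {f : Rec k} {xs x} → f [ xs ]⇓ x → allOrᴿ j a f [ xs ]⇓ codeAllOr j a x
allOrᴿ-⇓ j a d = allsᴿ-⇓ j (pairᴿ-⇓ (constᴿ-⇓ 4) (pairᴿ-⇓ (constᴿ-⇓ a) d))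

-- Here `a` will be the code of the negated transition formula. It is the same at every depth
-- (`codeF-iterate`), so a single primitive recursion on k computes the code of the whole nest.
codeSteps : ℕ → ℕ → ℕ → ℕ → ℕ
codeSteps j a zero    x = x
codeSteps j a (suc k) x = codeAllOr j a (codeSteps j a k x)

stepsᴿ : ℕ → ℕ → Rec 2
stepsᴿ j a = R (P zero) (allOrᴿ j a (P (suc zero)))

stepsᴿ-⇓ : ∀ j a k x → stepsᴿ j a [ k ∷ x ∷ [] ]⇓ codeSteps j a k x
stepsᴿ-⇓ j a zero    x = ev-R0 ev-P
stepsᴿ-⇓ j a (suc k) x = ev-RS (stepsᴿ-⇓ j a k x) (allOrᴿ-⇓ j a ev-P)

-- k is both the number of steps and the code of the innermost formula.
diagonal : ℕ → ℕ → ℕ → ℕ → ℕ → ℕ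
diagonal j u i a k = pair 3 (pair u (codeAllOr j i (codeSteps j a k k)))

diagonalᴿ : ℕ → ℕ → ℕ → ℕ → Rec 1
diagonalᴿ j u i a =
  pairᴿ (constᴿ 3) (pairᴿ (constᴿ u) (allOrᴿ j i (C (stepsᴿ j a) (P zero ∷ P zero ∷ []))))

diagonalᴿ-⇓ : ∀ j u i a k → diagonalᴿ j u i a [ k ∷ [] ]⇓ diagonal j u i a k
diagonalᴿ-⇓ j u i a k =
  pairᴿ-⇓ (constᴿ-⇓ 3) (pairᴿ-⇓ (constᴿ-⇓ u)
    (allOrᴿ-⇓ j i (ev-C₂ ev-P ev-P (stepsᴿ-⇓ j a k k))))

-- Growth of the pairing function

n<2^n : ∀ n → n < 2 ^ n
n<2^n zero    = s≤s z≤n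
n<2^n (suc n) = +-mono-≤ (m^n>0 2 n) (≤-trans (n<2^n n) (m≤m+n (2 ^ n) 0))

a<pair : ∀ a b → a < pair a b
a<pair a b = <-≤-trans (n<2^n a) (≤-trans (≤-reflexive (≡-sym (*-identityʳ (2 ^ a))))
  (*-monoʳ-≤ (2 ^ a) (m≤n+m 1 (2 * b))))

b<pair : ∀ a b → b < pair a b
b<pair a b = ≤-trans (≤-trans (s≤s (m≤m+n b (b + 0))) (≤-reflexive (+-comm 1 (2 * b))))
  (≤-trans (≤-reflexive (≡-sym (*-identityˡ (2 * b + 1)))) (*-monoˡ-≤ (2 * b + 1) (m^n>0 2 a)))

-- Bounds for the two components alone would not do: the quantifiers of the two halves of a
-- conjunction add up in `#∀≤codeF`.
a+b≤pair : ∀ a b → a + b ≤ pair a b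
a+b≤pair zero    b = <⇒≤ (b<pair 0 b)
a+b≤pair (suc a) b = begin
  suc a + b               ≤⟨ s≤s (m≤m+n (a + b) (a * b)) ⟩
  suc (a + b + a * b)     ≡⟨ cong suc (cong (_+ a * b) (+-comm a b)) ⟩
  suc (b + a + a * b)     ≡⟨ cong suc (+-assoc b a (a * b)) ⟩
  suc (b + (a + a * b))   ≡⟨ cong (λ c → suc (b + c)) (*-suc a b) ⟨
  suc a * suc b           ≤⟨ *-mono-≤ (<⇒≤ (n<2^n (suc a))) (s≤s (m≤m+n b (b + 0))) ⟩
  2 ^ suc a * suc (2 * b) ≡⟨ cong (2 ^ suc a *_) (+-comm 1 (2 * b)) ⟩
  pair (suc a) b          ∎
  where open ≤-Reasoning

-- Satisfaction, renaming and blocks of quantifiers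

⇔-refl : A ⇔ A
⇔-refl = id , id

⇔-sym : A ⇔ B → B ⇔ A
⇔-sym (f , g) = g , f

⇔-trans : {A B E : Set} → A ⇔ B → B ⇔ E → A ⇔ E
⇔-trans (f , g) (f′ , g′) = f′ ∘ f , g ∘ g′

Vertex : Graph → Set
Vertex G = Fin (size G)

-- All quantifiers range over a finite set. Decidability makes `or (neg φ) ψ` an implication and
-- gives counterexamples to failing universal quantifiers without classical axioms.
Sat? : ∀ G (φ : Formula n) ρ → Dec (Sat G φ ρ)
Sat? G (rel i j) ρ = adj G (ρ i) (ρ j) ≟ᵇ true
Sat? G (equ i j) ρ = ρ i ≟ᶠ ρ j
Sat? G (neg φ)   ρ = ¬? (Sat? G φ ρ)
Sat? G (and φ ψ) ρ = Sat? G φ ρ ×-dec Sat? G ψ ρ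
Sat? G (or φ ψ)  ρ = Sat? G φ ρ ⊎-dec Sat? G ψ ρ
Sat? G (all φ)   ρ = all? λ v → Sat? G φ (extend v ρ)
Sat? G (ex φ)    ρ = any? λ v → Sat? G φ (extend v ρ)

¬⊎⇔→ : Dec A → (¬ A ⊎ B) ⇔ (A → B)
¬⊎⇔→ A? = (λ { (inj₁ ¬a) a → ⊥-elim (¬a a) ; (inj₂ b) _ → b }) , back A?
  where
  back : Dec A → (A → B) → ¬ A ⊎ B
  back (yes a) f = inj₂ (f a)
  back (no ¬a) f = inj₁ ¬a

lift : (Fin m → Fin n) → Fin (suc m) → Fin (suc n)
lift f zero    = zero
lift f (suc i) = suc (f i)

ren : (Fin m → Fin n) → Formula m → Formula n
ren f (rel i j) = rel (f i) (f j)
ren f (equ i j) = equ (f i) (f j)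
ren f (neg φ)   = neg (ren f φ)
ren f (and φ ψ) = and (ren f φ) (ren f ψ)
ren f (or φ ψ)  = or (ren f φ) (ren f ψ)
ren f (all φ)   = all (ren (lift f) φ)
ren f (ex φ)    = ex (ren (lift f) φ)

extend-lift : ∀ {f : Fin m → Fin n} {ρ : Fin n → Fin k} {ρ′} → (∀ i → ρ (f i) ≡ ρ′ i) →
              ∀ v i → extend v ρ (lift f i) ≡ extend v ρ′ i
extend-lift eq v zero    = refl
extend-lift eq v (suc i) = eq i

Sat-ren : ∀ G (φ : Formula m) {f : Fin m → Fin n} {ρ ρ′} → (∀ i → ρ (f i) ≡ ρ′ i) →
          Sat G (ren f φ) ρ ⇔ Sat G φ ρ′
Sat-ren G (rel i j) eq rewrite eq i | eq j = ⇔-refl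
Sat-ren G (equ i j) eq rewrite eq i | eq j = ⇔-refl
Sat-ren G (neg φ)   eq = let f , g = Sat-ren G φ eq in _∘ g , _∘ f
Sat-ren G (and φ ψ) eq =
  let f , g = Sat-ren G φ eq ; f′ , g′ = Sat-ren G ψ eq
  in (λ (a , b) → f a , f′ b) , λ (a , b) → g a , g′ b
Sat-ren G (or φ ψ) eq =
  let f , g = Sat-ren G φ eq ; f′ , g′ = Sat-ren G ψ eq
  in [ inj₁ ∘ f , inj₂ ∘ f′ ]′ , [ inj₁ ∘ g , inj₂ ∘ g′ ]′
Sat-ren G (all φ) eq =
  (λ h v → proj₁ (Sat-ren G φ (extend-lift eq v)) (h v)) ,
  (λ h v → proj₂ (Sat-ren G φ (extend-lift eq v)) (h v))
Sat-ren G (ex φ) eq =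
  map₂ (λ {v} → proj₁ (Sat-ren G φ (extend-lift eq v))) ,
  map₂ (λ {v} → proj₂ (Sat-ren G φ (extend-lift eq v)))

toℕ-lift : ∀ {f : Fin m → Fin n} → (∀ i → toℕ (f i) ≡ toℕ i) → ∀ i → toℕ (lift f i) ≡ toℕ i
toℕ-lift eq zero    = refl
toℕ-lift eq (suc i) = cong suc (eq i)

-- Codes record variables only by their numerical value, so a formula that ignores the outer
-- variables has the same code at every depth.
codeF-ren : ∀ (φ : Formula m) {f : Fin m → Fin n} → (∀ i → toℕ (f i) ≡ toℕ i) →
            codeF (ren f φ) ≡ codeF φ
codeF-ren (rel i j) eq = cong (pair 0) (cong₂ pair (eq i) (eq j))
codeF-ren (equ i j) eq = cong (pair 1) (cong₂ pair (eq i) (eq j))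
codeF-ren (neg φ)   eq = cong (pair 2) (codeF-ren φ eq)
codeF-ren (and φ ψ) eq = cong (pair 3) (cong₂ pair (codeF-ren φ eq) (codeF-ren ψ eq))
codeF-ren (or φ ψ)  eq = cong (pair 4) (cong₂ pair (codeF-ren φ eq) (codeF-ren ψ eq))
codeF-ren (all φ)   eq = cong (pair 5) (codeF-ren φ (toℕ-lift eq))
codeF-ren (ex φ)    eq = cong (pair 6) (codeF-ren φ (toℕ-lift eq))

alls : ∀ j → Formula (j + n) → Formula n
alls zero    φ = φ
alls (suc j) φ = alls j (all φ)

exs : ∀ j → Formula (j + n) → Formula n
exs zero    φ = φ
exs (suc j) φ = exs j (ex φ)

extends : Vec (Fin m) j → (Fin n → Fin m) → Fin (j + n) → Fin m
extends []       ρ = ρ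
extends (v ∷ vs) ρ = extend v (extends vs ρ)

Sat-alls : ∀ G j (φ : Formula (j + n)) {ρ} →
           Sat G (alls j φ) ρ ⇔ (∀ vs → Sat G φ (extends vs ρ))
Sat-alls G zero    φ = (λ { h [] → h }) , λ h → h []
Sat-alls G (suc j) φ = let f , g = Sat-alls G j (all φ) in
  (λ { h (v ∷ vs) → f h vs v }) , λ h → g λ vs v → h (v ∷ vs)

Sat-exs : ∀ G j (φ : Formula (j + n)) {ρ} →
          Sat G (exs j φ) ρ ⇔ Σ (Vec (Vertex G) j) λ vs → Sat G φ (extends vs ρ)
Sat-exs G zero    φ = (λ h → [] , h) , λ { ([] , h) → h }
Sat-exs G (suc j) φ = let f , g = Sat-exs G j (ex φ) in
  (λ h → let vs , v , h′ = f h in v ∷ vs , h′) , λ { (v ∷ vs , h) → g (vs , v , h) }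

extends-↑ˡ : ∀ (vs : Vec (Fin m) j) {ρ : Fin n → Fin m} i → extends vs ρ (i ↑ˡ n) ≡ lookup vs i
extends-↑ˡ (v ∷ vs) zero    = refl
extends-↑ˡ (v ∷ vs) (suc i) = extends-↑ˡ vs i

extends-↑ʳ : ∀ (vs : Vec (Fin m) j) {ρ : Fin n → Fin m} i → extends vs ρ (j ↑ʳ i) ≡ ρ i
extends-↑ʳ []       i = refl
extends-↑ʳ (v ∷ vs) i = extends-↑ʳ vs i

codeF-alls : ∀ j (φ : Formula (j + n)) → codeF (alls j φ) ≡ codeAlls j (codeF φ)
codeF-alls zero    φ = refl
codeF-alls (suc j) φ = codeF-alls j (all φ)

Universal-alls : ∀ j {φ : Formula (j + n)} → Universal φ → Universal (alls j φ)
Universal-alls zero    u = u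
Universal-alls (suc j) u = Universal-alls j (u-all u)

-- Quantifier-free formulas

infixr 6 _∧ᵠ_
infixr 5 _∨ᵠ_
infixr 4 _⇒ᵠ_

-- Variables come from an arbitrary type, so that formulas can address vertices by `Name`. An edge
-- atom carries the wanted truth value, which turns an adjacency matrix into a conjunction of atoms.
-- Large conjunctions are nonempty because `Formula` has no truth constant.
data QF (A : Set) : Set where
  edgeᵠ         : Bool → A → A → QF A
  eqᵠ           : A → A → QF A
  ¬ᵠ_           : QF A → QF A
  _∧ᵠ_ _∨ᵠ_ _⇒ᵠ_ : QF A → QF A → QF A
  ⋀ᵠ            : (Fin (suc m) → QF A) → QF A

Holds : ∀ G → QF A → (A → Vertex G) → Set
Holds G (edgeᵠ b i j) ρ = adj G (ρ i) (ρ j) ≡ b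
Holds G (eqᵠ i j)     ρ = ρ i ≡ ρ j
Holds G (¬ᵠ q)        ρ = ¬ Holds G q ρ
Holds G (q ∧ᵠ r)      ρ = Holds G q ρ × Holds G r ρ
Holds G (q ∨ᵠ r)      ρ = Holds G q ρ ⊎ Holds G r ρ
Holds G (q ⇒ᵠ r)      ρ = Holds G q ρ → Holds G r ρ
Holds G (⋀ᵠ q)        ρ = ∀ i → Holds G (q i) ρ

Holds? : ∀ G (q : QF A) ρ → Dec (Holds G q ρ)
Holds? G (edgeᵠ b i j) ρ = adj G (ρ i) (ρ j) ≟ᵇ b
Holds? G (eqᵠ i j)     ρ = ρ i ≟ᶠ ρ j
Holds? G (¬ᵠ q)        ρ = ¬? (Holds? G q ρ)
Holds? G (q ∧ᵠ r)      ρ = Holds? G q ρ ×-dec Holds? G r ρ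
Holds? G (q ∨ᵠ r)      ρ = Holds? G q ρ ⊎-dec Holds? G r ρ
Holds? G (q ⇒ᵠ r)      ρ = Holds? G q ρ →-dec Holds? G r ρ
Holds? G (⋀ᵠ q)        ρ = all? λ i → Holds? G (q i) ρ

ands ors : (Fin (suc m) → Formula n) → Formula n
ands {zero}  φ = φ zero
ands {suc m} φ = and (φ zero) (ands (φ ∘ suc))
ors {zero}  φ = φ zero
ors {suc m} φ = or (φ zero) (ors (φ ∘ suc))

Sat-ands : ∀ G (φ : Fin (suc m) → Formula n) {ρ} → Sat G (ands φ) ρ ⇔ (∀ i → Sat G (φ i) ρ)
Sat-ands {zero}  G φ = (λ { h zero → h }) , λ h → h zero
Sat-ands {suc m} G φ = let f , g = Sat-ands G (φ ∘ suc) in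
  (λ { (h , _) zero → h ; (_ , h) (suc i) → f h i }) , λ h → h zero , g (h ∘ suc)

Sat-ors : ∀ G (φ : Fin (suc m) → Formula n) {ρ} → Sat G (ors φ) ρ ⇔ Σ (Fin (suc m)) λ i → Sat G (φ i) ρ
Sat-ors {zero}  G φ = (λ h → zero , h) , λ { (zero , h) → h }
Sat-ors {suc m} G φ = let f , g = Sat-ors G (φ ∘ suc) in
  [ (λ h → zero , h) , (λ h → let i , h′ = f h in suc i , h′) ]′ ,
  λ { (zero , h) → inj₁ h ; (suc i , h) → inj₂ (g (i , h)) }

Universal-ands : {φ : Fin (suc m) → Formula n} → (∀ i → Universal (φ i)) → Universal (ands φ)
Universal-ands {zero}  u = u zero
Universal-ands {suc m} u = u-and (u zero) (Universal-ands (u ∘ suc))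

Universal-ors : {φ : Fin (suc m) → Formula n} → (∀ i → Universal (φ i)) → Universal (ors φ)
Universal-ors {zero}  u = u zero
Universal-ors {suc m} u = u-or (u zero) (Universal-ors (u ∘ suc))

≢true⇒≡false : ∀ {b} → b ≢ true → b ≡ false
≢true⇒≡false {false} _ = refl
≢true⇒≡false {true}  h = ⊥-elim (h refl)

≢false⇒≡true : ∀ {b} → b ≢ false → b ≡ true
≢false⇒≡true {true}  _ = refl
≢false⇒≡true {false} h = ⊥-elim (h refl)

≡false⇒≢true : ∀ {b} → b ≡ false → b ≢ true
≡false⇒≢true refl ()

module _ {A : Set} {n : ℕ} (var : A → Fin n) where

  -- The Boolean is the polarity: `false` produces the negated formula. `Universal` admits negation
  -- only at atoms.
  nnf : Bool → QF A → Formula n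
  nnf true  (edgeᵠ true i j)  = rel (var i) (var j)
  nnf true  (edgeᵠ false i j) = neg (rel (var i) (var j))
  nnf false (edgeᵠ true i j)  = neg (rel (var i) (var j))
  nnf false (edgeᵠ false i j) = rel (var i) (var j)
  nnf true  (eqᵠ i j)         = equ (var i) (var j)
  nnf false (eqᵠ i j)         = neg (equ (var i) (var j))
  nnf b     (¬ᵠ q)            = nnf (not b) q
  nnf true  (q ∧ᵠ r)          = and (nnf true q) (nnf true r)
  nnf false (q ∧ᵠ r)          = or (nnf false q) (nnf false r)
  nnf true  (q ∨ᵠ r)          = or (nnf true q) (nnf true r)
  nnf false (q ∨ᵠ r)          = and (nnf false q) (nnf false r)
  nnf true  (q ⇒ᵠ r)          = or (nnf false q) (nnf true r)
  nnf false (q ⇒ᵠ r)          = and (nnf true q) (nnf false r)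
  nnf true  (⋀ᵠ q)            = ands λ i → nnf true (q i)
  nnf false (⋀ᵠ q)            = ors λ i → nnf false (q i)

  Universal-nnf : ∀ b (q : QF A) → Universal (nnf b q)
  Universal-nnf true  (edgeᵠ true i j)  = u-rel (var i) (var j)
  Universal-nnf true  (edgeᵠ false i j) = u-negrel (var i) (var j)
  Universal-nnf false (edgeᵠ true i j)  = u-negrel (var i) (var j)
  Universal-nnf false (edgeᵠ false i j) = u-rel (var i) (var j)
  Universal-nnf true  (eqᵠ i j)         = u-equ (var i) (var j)
  Universal-nnf false (eqᵠ i j)         = u-negequ (var i) (var j)
  Universal-nnf true  (¬ᵠ q)            = Universal-nnf false q
  Universal-nnf false (¬ᵠ q)            = Universal-nnf true q
  Universal-nnf true  (q ∧ᵠ r)          = u-and (Universal-nnf true q) (Universal-nnf true r)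
  Universal-nnf false (q ∧ᵠ r)          = u-or (Universal-nnf false q) (Universal-nnf false r)
  Universal-nnf true  (q ∨ᵠ r)          = u-or (Universal-nnf true q) (Universal-nnf true r)
  Universal-nnf false (q ∨ᵠ r)          = u-and (Universal-nnf false q) (Universal-nnf false r)
  Universal-nnf true  (q ⇒ᵠ r)          = u-or (Universal-nnf false q) (Universal-nnf true r)
  Universal-nnf false (q ⇒ᵠ r)          = u-and (Universal-nnf true q) (Universal-nnf false r)
  Universal-nnf true  (⋀ᵠ q)            = Universal-ands λ i → Universal-nnf true (q i)
  Universal-nnf false (⋀ᵠ q)            = Universal-ors λ i → Universal-nnf false (q i)

  mutual
    Sat-nnf : ∀ G (q : QF A) ρ → Sat G (nnf true q) ρ ⇔ Holds G q (ρ ∘ var)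
    Sat-nnf G (edgeᵠ true i j) ρ  = ⇔-refl
    Sat-nnf G (edgeᵠ false i j) ρ = ≢true⇒≡false , ≡false⇒≢true
    Sat-nnf G (eqᵠ i j) ρ         = ⇔-refl
    Sat-nnf G (¬ᵠ q) ρ            = Sat-nnf-false G q ρ
    Sat-nnf G (q ∧ᵠ r) ρ          = let f , g = Sat-nnf G q ρ ; f′ , g′ = Sat-nnf G r ρ in
      (λ (a , b) → f a , f′ b) , λ (a , b) → g a , g′ b
    Sat-nnf G (q ∨ᵠ r) ρ          = let f , g = Sat-nnf G q ρ ; f′ , g′ = Sat-nnf G r ρ in
      [ inj₁ ∘ f , inj₂ ∘ f′ ]′ , [ inj₁ ∘ g , inj₂ ∘ g′ ]′
    Sat-nnf G (q ⇒ᵠ r) ρ      =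
      let f , g = Sat-nnf-false G q ρ ; f′ , g′ = Sat-nnf G r ρ ; h , h′ = ¬⊎⇔→ (Holds? G q (ρ ∘ var)) in
      h ∘ [ inj₁ ∘ f , inj₂ ∘ f′ ]′ , [ inj₁ ∘ g , inj₂ ∘ g′ ]′ ∘ h′
    Sat-nnf G (⋀ᵠ q) ρ            = let f , g = Sat-ands G (λ i → nnf true (q i)) in
      (λ h i → proj₁ (Sat-nnf G (q i) ρ) (f h i)) , λ h → g λ i → proj₂ (Sat-nnf G (q i) ρ) (h i)

    Sat-nnf-false : ∀ G (q : QF A) ρ → Sat G (nnf false q) ρ ⇔ (¬ Holds G q (ρ ∘ var))
    Sat-nnf-false G (edgeᵠ true i j) ρ  = ⇔-refl
    Sat-nnf-false G (edgeᵠ false i j) ρ = (λ { h h′ → ≡false⇒≢true h′ h }) , ≢false⇒≡true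
    Sat-nnf-false G (eqᵠ i j) ρ         = ⇔-refl
    Sat-nnf-false G (¬ᵠ q) ρ        = let f , g = Sat-nnf G q ρ in
      (λ h ¬h → ¬h (f h)) , λ ¬¬h → g (decidable-stable (Holds? G q (ρ ∘ var)) ¬¬h)
    Sat-nnf-false G (q ∧ᵠ r) ρ      = let f , g = Sat-nnf-false G q ρ ; f′ , g′ = Sat-nnf-false G r ρ in
      [ (λ a h → f a (proj₁ h)) , (λ b h → f′ b (proj₂ h)) ]′ ,
      λ h → [ inj₁ ∘ g , inj₂ ∘ g′ ]′ (proj₂ (¬⊎⇔→ (Holds? G q (ρ ∘ var))) λ a b → h (a , b))
    Sat-nnf-false G (q ∨ᵠ r) ρ          = let f , g = Sat-nnf-false G q ρ ; f′ , g′ = Sat-nnf-false G r ρ in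
      (λ (a , b) → [ f a , f′ b ]′) , λ h → g (h ∘ inj₁) , g′ (h ∘ inj₂)
    Sat-nnf-false G (q ⇒ᵠ r) ρ      = let f , g = Sat-nnf G q ρ ; f′ , g′ = Sat-nnf-false G r ρ in
      (λ (a , b) h → f′ b (h (f a))) ,
      λ h → g (decidable-stable (Holds? G q (ρ ∘ var)) λ ¬a → h λ a → ⊥-elim (¬a a)) , g′ λ b → h λ _ → b
    Sat-nnf-false G (⋀ᵠ q) ρ        = let f , g = Sat-ors G (λ i → nnf false (q i)) in
      (λ h all → let i , h′ = f h in proj₁ (Sat-nnf-false G (q i) ρ) h′ (all i)) ,
      λ h → let i , h′ = ¬∀⟶∃¬ _ _ (λ i → Holds? G (q i) (ρ ∘ var)) h in g (i , proj₂ (Sat-nnf-false G (q i) ρ) h′)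

Holds-cong : ∀ G (q : QF A) ρ σ → (∀ a → ρ a ≡ σ a) → Holds G q ρ → Holds G q σ
Holds-cong {A} G q ρ σ eq = proj₁ (Holds-⇔ q)
  where
  Holds-⇔ : ∀ q → Holds G q ρ ⇔ Holds G q σ
  Holds-⇔ (edgeᵠ b i j) = subst (_≡ b) e , subst (_≡ b) (≡-sym e)
    where e = cong₂ (adj G) (eq i) (eq j)
  Holds-⇔ (eqᵠ i j) = (λ h → trans (≡-sym (eq i)) (trans h (eq j))) , λ h → trans (eq i) (trans h (≡-sym (eq j)))
  Holds-⇔ (¬ᵠ q)   = let f , g = Holds-⇔ q in _∘ g , _∘ f
  Holds-⇔ (q ∧ᵠ r) = let f , g = Holds-⇔ q ; f′ , g′ = Holds-⇔ r in
    (λ (a , b) → f a , f′ b) , λ (a , b) → g a , g′ b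
  Holds-⇔ (q ∨ᵠ r) = let f , g = Holds-⇔ q ; f′ , g′ = Holds-⇔ r in
    [ inj₁ ∘ f , inj₂ ∘ f′ ]′ , [ inj₁ ∘ g , inj₂ ∘ g′ ]′
  Holds-⇔ (q ⇒ᵠ r) = let f , g = Holds-⇔ q ; f′ , g′ = Holds-⇔ r in
    (λ h → f′ ∘ h ∘ g) , λ h → g′ ∘ h ∘ f
  Holds-⇔ (⋀ᵠ q)   = (λ h i → proj₁ (Holds-⇔ (q i)) (h i)) , λ h i → proj₂ (Holds-⇔ (q i)) (h i)

-- Full homomorphisms and induced subgraphs

-- Injectivity is left out because copies of `ℋ n` get it for free (`FullHom-injective`), and the
-- diagram that forbids a copy then needs no inequalities.
FullHom : Graph → Graph → Set
FullHom H G = Σ (Vertex H → Vertex G) λ f → ∀ i j → adj G (f i) (f j) ≡ adj H i j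

FullHom-trans : ∀ {F G H} → FullHom F G → FullHom G H → FullHom F H
FullHom-trans (f , p) (g , q) = g ∘ f , λ i j → trans (q (f i) (f j)) (p i j)

InducedEmb-trans : ∀ {F G H} → InducedEmb F G → InducedEmb G H → InducedEmb F H
InducedEmb-trans (f , i , p) (g , j , q) =
  g ∘ f , (λ x y → i x y ∘ j (f x) (f y)) , λ x y → trans (q (f x) (f y)) (p x y)

extend-∘ : ∀ {B G : ℕ} (f : Fin B → Fin G) {ρ : Fin n → Fin B} {σ : Fin n → Fin G} → (∀ i → f (ρ i) ≡ σ i) →
           ∀ v i → f (extend v ρ i) ≡ extend (f v) σ i
extend-∘ f eq v zero    = refl
extend-∘ f eq v (suc i) = eq i

Universal-hereditary : ∀ {B G} ((f , _) : InducedEmb B G) {φ : Formula n} → Universal φ →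
                       ∀ {ρ σ} → (∀ i → f (ρ i) ≡ σ i) → Sat G φ σ → Sat B φ ρ
Universal-hereditary (f , inj , p) (u-rel i j) eq h rewrite ≡-sym (eq i) | ≡-sym (eq j) = trans (≡-sym (p _ _)) h
Universal-hereditary (f , inj , p) (u-equ i j) eq h = inj _ _ (trans (eq i) (trans h (≡-sym (eq j))))
Universal-hereditary (f , inj , p) (u-negrel i j) eq h rewrite ≡-sym (eq i) | ≡-sym (eq j) = h ∘ trans (p _ _)
Universal-hereditary (f , inj , p) (u-negequ i j) eq h h′ = h (trans (≡-sym (eq i)) (trans (cong f h′) (eq j)))
Universal-hereditary e (u-and u v) eq (h , h′) = Universal-hereditary e u eq h , Universal-hereditary e v eq h′
Universal-hereditary e (u-or u v) eq =
  [ inj₁ ∘ Universal-hereditary e u eq , inj₂ ∘ Universal-hereditary e v eq ]′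
Universal-hereditary e (u-all u) eq h v = Universal-hereditary e u (extend-∘ (proj₁ e) eq v) (h _)

⊨-hereditary : ∀ {B G μ} → Universal μ → InducedEmb B G → G ⊨ μ → B ⊨ μ
⊨-hereditary u e = Universal-hereditary e u λ ()

-- Small refutations of universal sentences

#∀ : ∀ {φ : Formula n} → Universal φ → ℕ
#∀ (u-and u v) = #∀ u + #∀ v
#∀ (u-or u v)  = #∀ u + #∀ v
#∀ (u-all u)   = suc (#∀ u)
#∀ _           = 0

-- Every quantifier increases the code, so the output of an algorithm bounds the size of the
-- smallest counterexamples to the sentence that it returns.
#∀≤codeF : ∀ {φ : Formula n} (u : Universal φ) → #∀ u ≤ codeF φ
#∀≤codeF (u-rel i j)    = z≤n
#∀≤codeF (u-equ i j)    = z≤n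
#∀≤codeF (u-negrel i j) = z≤n
#∀≤codeF (u-negequ i j) = z≤n
#∀≤codeF (u-and {φ = φ} {ψ} u v) =
  ≤-trans (+-mono-≤ (#∀≤codeF u) (#∀≤codeF v)) (≤-trans (a+b≤pair (codeF φ) (codeF ψ)) (<⇒≤ (b<pair 3 (pair (codeF φ) (codeF ψ)))))
#∀≤codeF (u-or {φ = φ} {ψ} u v) =
  ≤-trans (+-mono-≤ (#∀≤codeF u) (#∀≤codeF v)) (≤-trans (a+b≤pair (codeF φ) (codeF ψ)) (<⇒≤ (b<pair 4 (pair (codeF φ) (codeF ψ)))))
#∀≤codeF (u-all u)      = ≤-trans (s≤s (#∀≤codeF u)) (b<pair 5 _)

Image : ∀ {B G} → InducedEmb B G → Vertex G → Set
Image {B} (f , _) v = Σ (Vertex B) λ w → f w ≡ v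

-- Any induced subgraph that contains the listed vertices counts, and not only the one induced by
-- them. This makes the notion stable under lengthening the list, as the case of `or` requires.
Refuted : ∀ G → Formula n → (Fin n → Vertex G) → List (Vertex G) → Set
Refuted G φ σ vs = ∀ {B} (e : InducedEmb B G) {ρ} → (∀ i → proj₁ e (ρ i) ≡ σ i) →
                   (∀ {v} → v ∈ vs → Image {B} {G} e v) → ¬ Sat B φ ρ

-- One vertex is spent for each failing quantifier. A failing disjunction needs the vertices of both
-- halves, a failing conjunction those of one half only.
refuting : ∀ G {φ : Formula n} (u : Universal φ) {σ} → ¬ Sat G φ σ →
           Σ (List (Vertex G)) λ vs → length vs ≤ #∀ u × Refuted G φ σ vs
refuting G (u-rel i j) {σ} h = [] , z≤n , λ (f , _ , p) eq _ h′ → h (trans (≡-sym (cong₂ (adj G) (eq i) (eq j))) (trans (p _ _) h′))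
refuting G (u-equ i j) h = [] , z≤n , λ (f , _ , p) eq _ h′ → h (trans (≡-sym (eq i)) (trans (cong f h′) (eq j)))
refuting G (u-negrel i j) h = [] , z≤n , λ (f , _ , p) eq _ h′ → h λ h″ → h′ (trans (≡-sym (p _ _)) (trans (cong₂ (adj G) (eq i) (eq j)) h″))
refuting G (u-negequ i j) h = [] , z≤n , λ (f , inj , p) eq _ h′ → h λ h″ → h′ (inj _ _ (trans (eq i) (trans h″ (≡-sym (eq j)))))
refuting G {and φ ψ} (u-and u v) {σ} h with Sat? G φ σ
... | no ¬φ = let vs , l , r = refuting G u ¬φ in
  vs , ≤-trans l (m≤m+n _ _) , λ e eq im h′ → r e eq im (proj₁ h′)
... | yes φ′ = let vs , l , r = refuting G v (λ ψ′ → h (φ′ , ψ′)) in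
  vs , ≤-trans l (m≤n+m _ _) , λ e eq im h′ → r e eq im (proj₂ h′)
refuting G (u-or u v) h =
  let vs , l , r = refuting G u (h ∘ inj₁)
      ws , l′ , r′ = refuting G v (h ∘ inj₂)
  in vs ++ ws , ≤-trans (≤-reflexive (length-++ vs)) (+-mono-≤ l l′) ,
     λ e eq im → [ r e eq (im ∘ ∈-++⁺ˡ) , r′ e eq (im ∘ ∈-++⁺ʳ vs) ]′
refuting G {all φ} (u-all u) {σ} h =
  let v , ¬h = ¬∀⟶∃¬ _ _ (λ v → Sat? G φ (extend v σ)) h
      vs , l , r = refuting G u ¬h
  in v ∷ vs , s≤s l , λ {B} e {ρ} eq im h′ → let w , w≡v = im (here refl) in
     r {B} e (λ { zero → w≡v ; (suc i) → eq i }) (im ∘ there) (h′ w)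

induced : ∀ G {k} → (Fin k → Vertex G) → Graph
induced G {k} f = record
  { size = k ; adj = λ i j → adj G (f i) (f j)
  ; irrefl = irrefl G ∘ f ; sym = λ i j → Graph.sym G (f i) (f j) }

-- Repetitions in the list are dropped, since an induced embedding has to be injective.
covering : ∀ {n} (vs : List (Fin n)) → Σ ℕ λ k → Σ (Fin k → Fin n) λ f → k ≤ length vs ×
           (∀ i j → f i ≡ f j → i ≡ j) × (∀ {v} → v ∈ vs → Σ (Fin k) λ i → f i ≡ v)
covering [] = 0 , (λ ()) , z≤n , (λ ()) , λ ()
covering (v ∷ vs) with covering vs
... | k , f , l , inj , cov with any? (λ i → f i ≟ᶠ v)
...   | yes (i , fi≡v) = k , f , m≤n⇒m≤1+n l , inj , λ { (here refl) → i , fi≡v ; (there v∈) → cov v∈ }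
...   | no ∄ = suc k , g , s≤s l , g-inj , λ { (here refl) → zero , refl ; (there v∈) → map₂′ (cov v∈) }
  where
  g : Fin (suc k) → Fin _
  g zero    = v
  g (suc i) = f i
  g-inj : ∀ i j → g i ≡ g j → i ≡ j
  g-inj zero    zero    _ = refl
  g-inj zero    (suc j) e = ⊥-elim (∄ (j , ≡-sym e))
  g-inj (suc i) zero    e = ⊥-elim (∄ (i , e))
  g-inj (suc i) (suc j) e = cong suc (inj i j e)
  map₂′ : ∀ {w} → Σ (Fin k) (λ i → f i ≡ w) → Σ (Fin (suc k)) λ i → g i ≡ w
  map₂′ (i , e) = suc i , e

smallRefutation : ∀ G {μ} (u : Universal μ) → ¬ G ⊨ μ →
                  Σ Graph λ B → size B ≤ #∀ u × InducedEmb B G × ¬ B ⊨ μ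
smallRefutation G u h with refuting G u h
... | vs , l , r with covering vs
...   | k , f , l′ , inj , cov =
  induced G f , ≤-trans l′ l , e , r {B = induced G f} e (λ ()) cov
  where
  e : InducedEmb (induced G f) G
  e = f , inj , λ i j → refl

-- Graphs of bounded size

functions : List A → ∀ k → List (Fin k → A)
functions xs zero    = (λ ()) ∷ []
functions xs (suc k) = cartesianProductWith (λ x f → λ { zero → x ; (suc i) → f i }) xs (functions xs k)

-- Without function extensionality a listed function agrees with g only pointwise. The general
-- relation allows the lemma to be applied to its own conclusion, as matrices require.
functions-complete : (_≈_ : A → B → Set) {xs : List A} → (∀ y → Σ A λ x → x ∈ xs × x ≈ y) →
                     ∀ {k} (g : Fin k → B) → Σ (Fin k → A) λ f → f ∈ functions xs k × (∀ i → f i ≈ g i)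
functions-complete _≈_ c {zero}  g = (λ ()) , here refl , λ ()
functions-complete _≈_ c {suc k} g =
  let x , x∈ , x≈ = c (g zero)
      f , f∈ , f≈ = functions-complete _≈_ c (g ∘ suc)
  in _ , ∈-cartesianProductWith⁺ _ x∈ f∈ , λ { zero → x≈ ; (suc i) → f≈ i }

∧-not-self : ∀ {n} (i : Fin n) b → not (isYes (i ≟ᶠ i)) ∧ b ≡ false
∧-not-self i b with i ≟ᶠ i
... | yes _  = refl
... | no i≢i = ⊥-elim (i≢i refl)

isYes-sym : ∀ {n} (i j : Fin n) → isYes (i ≟ᶠ j) ≡ isYes (j ≟ᶠ i)
isYes-sym i j with i ≟ᶠ j | j ≟ᶠ i
... | yes _ | yes _ = refl
... | no _  | no _  = refl
... | yes e | no ¬e = ⊥-elim (¬e (≡-sym e))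
... | no ¬e | yes e = ⊥-elim (¬e (≡-sym e))

-- Clearing the diagonal and symmetrising turns every matrix into a graph and leaves adjacency
-- matrices unchanged, so all matrices may be listed unchecked.
matrixGraph : (Fin k → Fin k → Bool) → Graph
matrixGraph {k} a = record
  { size = k
  ; adj = λ i j → not (isYes (i ≟ᶠ j)) ∧ (a i j ∧ a j i)
  ; irrefl = λ i → ∧-not-self i _
  ; sym = λ i j → cong₂ (λ b c → not b ∧ c) (isYes-sym i j) (∧-comm (a i j) (a j i)) }

matrixGraph-adj : ∀ G {a : Vertex G → Vertex G → Bool} → (∀ i j → a i j ≡ adj G i j) →
                  ∀ i j → adj (matrixGraph a) i j ≡ adj G i j
matrixGraph-adj G eq i j with i ≟ᶠ j
... | yes refl = ≡-sym (irrefl G i)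
... | no _ rewrite eq i j | eq j i | Graph.sym G j i = ∧-idem _

graphsUpTo : ℕ → List Graph
graphsOfSize : ℕ → List Graph
graphsOfSize k = map matrixGraph (functions (functions (true ∷ false ∷ []) k) k)
graphsUpTo zero    = graphsOfSize zero
graphsUpTo (suc k) = graphsOfSize (suc k) ++ graphsUpTo k

graphsOfSize-complete : ∀ G → Σ Graph λ H → H ∈ graphsOfSize (size G) × InducedEmb H G × InducedEmb G H
graphsOfSize-complete G =
  let f , f∈ , f≈ = functions-complete (λ f g → ∀ i → f i ≡ g i) (functions-complete _≡_ bools) (adj G)
      eq = matrixGraph-adj G f≈
  in matrixGraph f , ∈-map⁺ matrixGraph f∈ , (id , (λ _ _ → id) , λ i j → ≡-sym (eq i j)) , (id , (λ _ _ → id) , eq)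
  where
  bools : ∀ b → Σ Bool λ x → x ∈ (true ∷ false ∷ []) × x ≡ b
  bools true  = true , here refl , refl
  bools false = false , there (here refl) , refl

graphsOfSize⊆graphsUpTo : ∀ {H j k} → j ≤′ k → H ∈ graphsOfSize j → H ∈ graphsUpTo k
graphsOfSize⊆graphsUpTo {j = zero}  (≤′-reflexive refl) H∈ = H∈
graphsOfSize⊆graphsUpTo {j = suc j} (≤′-reflexive refl) H∈ = ∈-++⁺ˡ H∈
graphsOfSize⊆graphsUpTo {k = suc k} (≤′-step l)         H∈ = ∈-++⁺ʳ (graphsOfSize (suc k)) (graphsOfSize⊆graphsUpTo l H∈)

obstructions : ∀ {μ} → Universal μ → List Graph
obstructions {μ} u = filter (λ G → ¬? (Sat? G μ noVar)) (graphsUpTo (#∀ u))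

-- Models are closed under induced subgraphs, and a graph that is not a model has a refuting induced
-- subgraph with at most `#∀ u` vertices. This carries the premise of the first claim over to the
-- second.
obstructions-define : ∀ {μ} (u : Universal μ) → DefinesForb μ (obstructions u)
obstructions-define {μ} u G = to , from
  where
  refuted? = λ H → ¬? (Sat? H μ noVar)
  to : G ⊨ μ → Forb (obstructions u) G
  to h H H∈ e = proj₂ (∈-filter⁻ refuted? {xs = graphsUpTo (#∀ u)} H∈) (⊨-hereditary u e h)
  from : Forb (obstructions u) G → G ⊨ μ
  from h = decidable-stable (Sat? G μ noVar) λ ¬h →
    let B , l , e , ¬B = smallRefutation G u ¬h
        H , H∈ , H↪B , B↪H = graphsOfSize-complete B
    in h H (∈-filter⁺ refuted? (graphsOfSize⊆graphsUpTo (≤⇒≤′ l) H∈) (¬B ∘ ⊨-hereditary u B↪H))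
         (InducedEmb-trans {H} {B} {G} H↪B e)

size<codeGs : ∀ {H F} → H ∈ F → size H < codeGs F
size<codeGs {F = G ∷ F} (here refl) = <-trans (a<pair (size G) (codeList (concatMap (λ i → map (λ j → bit (adj G i j)) (allFin (size G))) (allFin (size G)))))
  (<-trans (a<pair (codeG G) (codeGs F)) (n<1+n _))
size<codeGs {F = G ∷ F} (there H∈)  = <-trans (size<codeGs H∈) (<-trans (b<pair (codeG G) (codeGs F)) (n<1+n _))

-- Excluding one graph by a universal sentence

diagram : (a : Fin (suc m) → Fin (suc m) → Bool) → QF (Fin (suc m))
diagram a = ⋀ᵠ λ i → ⋀ᵠ λ j → edgeᵠ (a i j) i j

noMatrix : (a : Fin (suc m) → Fin (suc m) → Bool) → Sentence
noMatrix {m} a = alls (suc m) (nnf (_↑ˡ 0) true (¬ᵠ diagram a))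

Universal-noMatrix : (a : Fin (suc m) → Fin (suc m) → Bool) → Universal (noMatrix a)
Universal-noMatrix {m} a = Universal-alls (suc m) (Universal-nnf (_↑ˡ 0) true (¬ᵠ diagram a))

⊨-noMatrix : ∀ G (a : Fin (suc m) → Fin (suc m) → Bool) →
             (G ⊨ noMatrix a) ⇔ (¬ Σ (Fin (suc m) → Vertex G) λ f → ∀ i j → adj G (f i) (f j) ≡ a i j)
⊨-noMatrix {m} G a = to , from
  where
  φ = nnf (_↑ˡ 0) true (¬ᵠ diagram a)
  to : G ⊨ noMatrix a → ¬ _
  to h (f , p) = proj₁ (Sat-nnf (_↑ˡ 0) G (¬ᵠ diagram a) (extends (tabulate f) noVar))
    (proj₁ (Sat-alls G (suc m) φ) h (tabulate f))
    (Holds-cong G (diagram a) f _ (λ i → ≡-sym (trans (extends-↑ˡ (tabulate f) i) (lookup∘tabulate f i))) p)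
  from : ¬ _ → G ⊨ noMatrix a
  from h = proj₂ (Sat-alls G (suc m) φ) λ vs → proj₂ (Sat-nnf (_↑ˡ 0) G (¬ᵠ diagram a) (extends vs noVar)) λ d → h (_ , d)

-- Binary digits, least significant first

increment : List Bool → List Bool
increment []          = true ∷ []
increment (false ∷ l) = true ∷ l
increment (true ∷ l)  = false ∷ increment l

digits : ℕ → List Bool
digits zero    = []
digits (suc k) = increment (digits k)

nth : List Bool → ℕ → Bool
nth []      j       = false
nth (b ∷ l) zero    = b
nth (b ∷ l) (suc j) = nth l j

digit : ℕ → ℕ → Bool
digit k = nth (digits k)

_∈ᵇ_ : ℕ → ℕ → Set
j ∈ᵇ k = digit k j ≡ true

-- Adding one in binary, where i is the position at which the carry stops. The clauses use only
-- order and membership, so they can be stated as the first-order axiom `incrementsᵗ`.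
record Inc (f g : ℕ → Bool) (i : ℕ) : Set where
  field
    old   : f i ≡ false
    ones  : ∀ {j} → j < i → f j ≡ true
    new   : g i ≡ true
    zeros : ∀ {j} → j < i → g j ≡ false
    same  : ∀ {j} → i < j → g j ≡ f j
open Inc

Inc-increment : ∀ l → Σ ℕ (Inc (nth l) (nth (increment l)))
Inc-increment [] = 0 , record
  { old = refl ; ones = λ () ; new = refl ; zeros = λ () ; same = λ { (s≤s _) → refl } }
Inc-increment (false ∷ l) = 0 , record
  { old = refl ; ones = λ () ; new = refl ; zeros = λ () ; same = λ { (s≤s _) → refl } }
Inc-increment (true ∷ l) with Inc-increment l
... | i , I = suc i , record
  { old = old I
  ; ones = λ { {zero} _ → refl ; {suc j} (s≤s p) → ones I p }
  ; new = new I
  ; zeros = λ { {zero} _ → refl ; {suc j} (s≤s p) → zeros I p }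
  ; same = λ { {suc j} (s≤s p) → same I p } }

Inc-digit : ∀ k → Σ ℕ (Inc (digit k) (digit (suc k)))
Inc-digit k = Inc-increment (digits k)

true≢false : ∀ {b} → b ≡ true → b ≡ false → ⊥
true≢false refl ()

-- A digit at position j can be new in `suc k` only if k has all digits below j, and the one at
-- position j - 1 already forces j ≤ k.
∈ᵇ⇒< : ∀ {j} k → j ∈ᵇ k → j < k
∈ᵇ⇒< {j} (suc k) j∈ with Inc-digit k
... | i , I with <-cmp j i
...   | tri< j<i _ _ = ⊥-elim (true≢false j∈ (zeros I j<i))
...   | tri> _ _ i<j = m<n⇒m<1+n (∈ᵇ⇒< k (trans (≡-sym (same I i<j)) j∈))
...   | tri≈ _ refl _ = s≤s (bound j (ones I))
  where
  bound : ∀ i → (∀ {j} → j < i → j ∈ᵇ k) → i ≤ k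
  bound zero    _ = z≤n
  bound (suc i) h = ∈ᵇ⇒< k (h ≤-refl)

-- Counting up from x, the lowest k digits run through all patterns before the others change.
realise : ∀ k x (t : ℕ → Bool) → (∀ {j} → j < k → digit x j ≡ false) →
          Σ ℕ λ y → (∀ {j} → j < k → digit y j ≡ t j) × (∀ {j} → k ≤ j → digit y j ≡ digit x j)
realise zero    x t _  = x , (λ ()) , λ _ → refl
realise (suc k) x t x≡ with t k in tk
... | false = let y , low , high = realise k x t (x≡ ∘ m<n⇒m<1+n) in
  y , (λ { (s≤s j≤k) → [ low , (λ { refl → trans (high ≤-refl) (trans (x≡ ≤-refl) (≡-sym tk)) }) ]′ (m≤n⇒m<n∨m≡n j≤k) }) ,
  high ∘ <⇒≤
-- With the lowest k digits all one, the next increment carries exactly into position k and clears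
-- them; then they are set to t.
... | true with realise k x (λ _ → true) (x≡ ∘ m<n⇒m<1+n)
...   | x′ , low′ , high′ with Inc-digit x′
...     | i , I with i≡k
  where
  i≡k : i ≡ k
  i≡k with <-cmp i k
  ... | tri≈ _ e _ = e
  ... | tri< i<k _ _ = ⊥-elim (true≢false (low′ i<k) (old I))
  ... | tri> _ _ k<i = ⊥-elim (true≢false (ones I k<i) (trans (high′ ≤-refl) (x≡ ≤-refl)))
...       | refl = let y , low , high = realise k (suc x′) t (zeros I) in
  y , (λ { (s≤s j≤k) → [ low , (λ { refl → trans (high ≤-refl) (trans (new I) (≡-sym tk)) }) ]′ (m≤n⇒m<n∨m≡n j≤k) }) ,
  λ k<j → trans (high (<⇒≤ k<j)) (trans (same I k<j) (high′ (<⇒≤ k<j)))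

adjoin : ∀ w s → Σ ℕ λ s′ → ∀ j → (j ∈ᵇ s′) ⇔ (j ≡ w ⊎ j ∈ᵇ s)
-- Elements of s are smaller than s, so all elements of the new set lie below `suc (w + s)`.
adjoin w s with realise (suc (w + s)) 0 t (λ _ → refl)
  where
  t : ℕ → Bool
  t j with j ≟ w
  ... | yes _ = true
  ... | no _  = digit s j
... | s′ , low , high = s′ , λ j → to j (j <? suc (w + s)) , from j
  where
  to : ∀ j → Dec (j < suc (w + s)) → j ∈ᵇ s′ → j ≡ w ⊎ j ∈ᵇ s
  to j (yes j<) j∈ with j ≟ w | low j<
  ... | yes e | _ = inj₁ e
  ... | no _  | e = inj₂ (trans (≡-sym e) j∈)
  to j (no j≮) j∈ = ⊥-elim (true≢false j∈ (high (≮⇒≥ j≮)))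
  from : ∀ j → j ≡ w ⊎ j ∈ᵇ s → j ∈ᵇ s′
  from j (inj₁ refl) with j ≟ j | low (s≤s (m≤m+n j s))
  ... | yes _ | e = e
  ... | no ¬e | _ = ⊥-elim (¬e refl)
  from j (inj₂ j∈) with j ≟ w | low (s≤s (≤-trans (<⇒≤ (∈ᵇ⇒< s j∈)) (m≤n+m s w)))
  ... | yes _ | e = e
  ... | no _  | e = trans e j∈

-- Ordered pairs of hereditarily finite sets

Doubleton : ℕ → ℕ → ℕ → Set
Doubleton p u v = ∀ w → (w ∈ᵇ p) ⇔ (w ≡ u ⊎ w ≡ v)

-- Kuratowski's pair, with u = {a} and v = {a, b}.
KPair : ℕ → ℕ → ℕ → Set
KPair p a b = Σ ℕ λ u → Σ ℕ λ v → Doubleton u a a × Doubleton v a b × Doubleton p u v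

doubleton : ∀ u v → Σ ℕ λ p → Doubleton p u v
doubleton u v with adjoin v 0
... | s , s≡ with adjoin u s
...   | p , p≡ = p , λ w →
  (λ w∈ → [ inj₁ , (λ w∈s → [ inj₂ , (λ ()) ]′ (proj₁ (s≡ w) w∈s)) ]′ (proj₁ (p≡ w) w∈)) ,
  [ (λ e → proj₂ (p≡ w) (inj₁ e)) , (λ e → proj₂ (p≡ w) (inj₂ (proj₂ (s≡ w) (inj₁ e)))) ]′

kpair : ∀ a b → Σ ℕ λ p → KPair p a b
kpair a b = let u , du = doubleton a a ; v , dv = doubleton a b ; p , dp = doubleton u v
            in p , u , v , du , dv , dp

KPair-injective : ∀ {p a b c d} → KPair p a b → KPair p c d → a ≡ c × b ≡ d
KPair-injective {p} {a} {b} {c} {d} (u , v , du , dv , dp) (u′ , v′ , du′ , dv′ , dp′) = a≡c , b≡d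
  where
  -- c is the only number that belongs to all elements of p.
  a≡c : a ≡ c
  a≡c with proj₁ (dp u′) (proj₂ (dp′ u′) (inj₁ refl))
  ... | inj₁ refl = [ id , id ]′ (proj₁ (du′ a) (proj₂ (du a) (inj₁ refl)))
  ... | inj₂ refl = [ id , id ]′ (proj₁ (du′ a) (proj₂ (dv a) (inj₁ refl)))
  b∈ : b ≡ c ⊎ b ≡ d
  b∈ with proj₁ (dp′ v) (proj₂ (dp v) (inj₂ refl))
  ... | inj₁ refl = inj₁ ([ id , id ]′ (proj₁ (du′ b) (proj₂ (dv b) (inj₂ refl))))
  ... | inj₂ refl = proj₁ (dv′ b) (proj₂ (dv b) (inj₂ refl))
  d∈ : d ≡ a ⊎ d ≡ b
  d∈ with proj₁ (dp v′) (proj₂ (dp′ v′) (inj₂ refl))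
  ... | inj₁ refl = inj₁ ([ id , id ]′ (proj₁ (du d) (proj₂ (dv′ d) (inj₂ refl))))
  ... | inj₂ refl = proj₁ (dv d) (proj₂ (dv′ d) (inj₂ refl))
  b≡d : b ≡ d
  b≡d with b∈ | d∈
  ... | inj₂ e    | _         = e
  ... | inj₁ _    | inj₂ e    = ≡-sym e
  ... | inj₁ refl | inj₁ refl = ≡-sym a≡c

-- First-order logic over an order, a successor relation and a membership relation

record Structure : Set₁ where
  field
    Carrier  : Set
    Le Sc Bt : Carrier → Carrier → Set
open Structure

infixr 6 _∧ᵗ_
infixr 5 _∨ᵗ_
infixr 4 _⇒ᵗ_
infixr 7 _▹_

-- Equality is not an atom: an element of a graph will be a triple of vertices together with a
-- proof, for which only the order in both directions is available. For the same reason structures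
-- are compared by a relation, `Similarity`, and not by a bijection.
data TF (n : ℕ) : Set where
  leᵗ scᵗ btᵗ    : Fin n → Fin n → TF n
  ¬ᵗ_            : TF n → TF n
  _∧ᵗ_ _∨ᵗ_ _⇒ᵗ_ : TF n → TF n → TF n
  ∀ᵗ_ ∃ᵗ_        : TF (suc n) → TF n

_▹_ : A → (Fin n → A) → Fin (suc n) → A
(a ▹ ρ) zero    = a
(a ▹ ρ) (suc i) = ρ i

TSat : (𝔐 : Structure) → TF n → (Fin n → Carrier 𝔐) → Set
TSat 𝔐 (leᵗ x y) ρ = Le 𝔐 (ρ x) (ρ y)
TSat 𝔐 (scᵗ x y) ρ = Sc 𝔐 (ρ x) (ρ y)
TSat 𝔐 (btᵗ x y) ρ = Bt 𝔐 (ρ x) (ρ y)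
TSat 𝔐 (¬ᵗ θ)    ρ = ¬ TSat 𝔐 θ ρ
TSat 𝔐 (θ ∧ᵗ η)  ρ = TSat 𝔐 θ ρ × TSat 𝔐 η ρ
TSat 𝔐 (θ ∨ᵗ η)  ρ = TSat 𝔐 θ ρ ⊎ TSat 𝔐 η ρ
TSat 𝔐 (θ ⇒ᵗ η)  ρ = TSat 𝔐 θ ρ → TSat 𝔐 η ρ
TSat 𝔐 (∀ᵗ θ)    ρ = ∀ a → TSat 𝔐 θ (a ▹ ρ)
TSat 𝔐 (∃ᵗ θ)    ρ = Σ (Carrier 𝔐) λ a → TSat 𝔐 θ (a ▹ ρ)

record Similarity (𝔐 𝔎 : Structure) : Set₁ where
  field
    _~_   : Carrier 𝔐 → Carrier 𝔎 → Set
    forth : ∀ a → Σ (Carrier 𝔎) λ b → a ~ b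
    back  : ∀ b → Σ (Carrier 𝔐) λ a → a ~ b
    ~-Le  : ∀ {a a′ b b′} → a ~ b → a′ ~ b′ → Le 𝔐 a a′ ⇔ Le 𝔎 b b′
    ~-Sc  : ∀ {a a′ b b′} → a ~ b → a′ ~ b′ → Sc 𝔐 a a′ ⇔ Sc 𝔎 b b′
    ~-Bt  : ∀ {a a′ b b′} → a ~ b → a′ ~ b′ → Bt 𝔐 a a′ ⇔ Bt 𝔎 b b′

module _ {𝔐 𝔎 : Structure} (Σim : Similarity 𝔐 𝔎) where
  open Similarity Σim

  TSat-similar : ∀ (θ : TF n) {ρ σ} → (∀ i → ρ i ~ σ i) → TSat 𝔐 θ ρ ⇔ TSat 𝔎 θ σ
  TSat-similar (leᵗ x y) h = ~-Le (h x) (h y)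
  TSat-similar (scᵗ x y) h = ~-Sc (h x) (h y)
  TSat-similar (btᵗ x y) h = ~-Bt (h x) (h y)
  TSat-similar (¬ᵗ θ)    h = let f , g = TSat-similar θ h in _∘ g , _∘ f
  TSat-similar (θ ∧ᵗ η)  h = let f , g = TSat-similar θ h ; f′ , g′ = TSat-similar η h in
    (λ (a , b) → f a , f′ b) , λ (a , b) → g a , g′ b
  TSat-similar (θ ∨ᵗ η)  h = let f , g = TSat-similar θ h ; f′ , g′ = TSat-similar η h in
    [ inj₁ ∘ f , inj₂ ∘ f′ ]′ , [ inj₁ ∘ g , inj₂ ∘ g′ ]′
  TSat-similar (θ ⇒ᵗ η)  h = let f , g = TSat-similar θ h ; f′ , g′ = TSat-similar η h in
    (λ t → f′ ∘ t ∘ g) , λ t → g′ ∘ t ∘ f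
  TSat-similar (∀ᵗ θ)    h =
    (λ t b → let a , a~b = back b in proj₁ (TSat-similar θ λ { zero → a~b ; (suc i) → h i }) (t a)) ,
    (λ t a → let b , a~b = forth a in proj₂ (TSat-similar θ λ { zero → a~b ; (suc i) → h i }) (t b))
  TSat-similar (∃ᵗ θ)    h =
    (λ (a , t) → let b , a~b = forth a in b , proj₁ (TSat-similar θ λ { zero → a~b ; (suc i) → h i }) t) ,
    (λ (b , t) → let a , a~b = back b in a , proj₂ (TSat-similar θ λ { zero → a~b ; (suc i) → h i }) t)

exsᵗ : ∀ j → TF (j + n) → TF n
exsᵗ zero    θ = θ
exsᵗ (suc j) θ = exsᵗ j (∃ᵗ θ)

_▹▹_ : Vec A j → (Fin n → A) → Fin (j + n) → A
[]       ▹▹ ρ = ρ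
(a ∷ as) ▹▹ ρ = a ▹ (as ▹▹ ρ)

▹▹-↑ˡ : ∀ (as : Vec A j) {ρ : Fin n → A} i → (as ▹▹ ρ) (i ↑ˡ n) ≡ lookup as i
▹▹-↑ˡ (a ∷ as) zero    = refl
▹▹-↑ˡ (a ∷ as) (suc i) = ▹▹-↑ˡ as i

▹▹-↑ʳ : ∀ (as : Vec A j) {ρ : Fin n → A} i → (as ▹▹ ρ) (j ↑ʳ i) ≡ ρ i
▹▹-↑ʳ []       i = refl
▹▹-↑ʳ (a ∷ as) i = ▹▹-↑ʳ as i

TSat-exsᵗ : ∀ 𝔐 j (θ : TF (j + n)) {ρ} →
            TSat 𝔐 (exsᵗ j θ) ρ ⇔ Σ (Vec (Carrier 𝔐) j) λ as → TSat 𝔐 θ (as ▹▹ ρ)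
TSat-exsᵗ 𝔐 zero    θ = (λ t → [] , t) , λ { ([] , t) → t }
TSat-exsᵗ 𝔐 (suc j) θ = let f , g = TSat-exsᵗ 𝔐 j (∃ᵗ θ) in
  (λ t → let as , a , t′ = f t in a ∷ as , t′) , λ { (a ∷ as , t) → g (as , a , t) }

-- The standard structures. Sc and Bt are made reflexive so that, in graphs, they also
-- link the vertices of one element.

𝔑 : ℕ → Structure
𝔑 n = record
  { Carrier = Fin (suc n)
  ; Le = λ i j → toℕ i ≤ toℕ j
  ; Sc = λ i j → toℕ j ≡ toℕ i ⊎ toℕ j ≡ suc (toℕ i)
  ; Bt = λ i j → toℕ i ≡ toℕ j ⊎ toℕ i ∈ᵇ toℕ j }

-- In `succᵗ` and `memᵗ` the strict order takes back the reflexivity of the atoms.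
ltᵗ eqᵗ succᵗ memᵗ : Fin n → Fin n → TF n
ltᵗ x y   = ¬ᵗ leᵗ y x
eqᵗ x y   = leᵗ x y ∧ᵗ leᵗ y x
succᵗ x y = scᵗ x y ∧ᵗ ltᵗ x y
memᵗ x y  = btᵗ x y ∧ᵗ ltᵗ x y

zeroᵗ : Fin n → TF n
zeroᵗ x = ∀ᵗ leᵗ (suc x) zero

doubletonᵗ : Fin n → Fin n → Fin n → TF n
doubletonᵗ p u v = ∀ᵗ ((memᵗ zero (suc p) ⇒ᵗ eqᵗ zero (suc u) ∨ᵗ eqᵗ zero (suc v)) ∧ᵗ
                       (eqᵗ zero (suc u) ∨ᵗ eqᵗ zero (suc v) ⇒ᵗ memᵗ zero (suc p)))

kpairᵗ : Fin n → Fin n → Fin n → TF n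
kpairᵗ p a b = ∃ᵗ ∃ᵗ (doubletonᵗ (suc zero) (suc (suc a)) (suc (suc a)) ∧ᵗ
                      doubletonᵗ zero (suc (suc a)) (suc (suc b)) ∧ᵗ
                      doubletonᵗ (suc (suc p)) (suc zero) zero)

module _ {N : ℕ} where

  fin : ∀ {x} → x ≤ N → Fin (suc N)
  fin x≤N = fromℕ< (s≤s x≤N)

  toℕ-fin : ∀ {x} (x≤N : x ≤ N) → toℕ (fin x≤N) ≡ x
  toℕ-fin x≤N = toℕ-fromℕ< (s≤s x≤N)

  toℕ≤ : ∀ (i : Fin (suc N)) → toℕ i ≤ N
  toℕ≤ i = s≤s⁻¹ (toℕ<n i)

  module _ {ρ : Fin n → Fin (suc N)} where

    ⟦_⟧ : Fin n → ℕ
    ⟦ x ⟧ = toℕ (ρ x)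

    eqᵗ-≡ : ∀ x y → TSat (𝔑 N) (eqᵗ x y) ρ ⇔ (⟦ x ⟧ ≡ ⟦ y ⟧)
    eqᵗ-≡ x y = (λ (l , l′) → ≤-antisym l l′) , λ e → ≤-reflexive e , ≤-reflexive (≡-sym e)

    succᵗ-suc : ∀ x y → TSat (𝔑 N) (succᵗ x y) ρ ⇔ (⟦ y ⟧ ≡ suc ⟦ x ⟧)
    succᵗ-suc x y =
      (λ { (inj₂ e , _) → e ; (inj₁ e , ≰) → ⊥-elim (≰ (≤-reflexive e)) }) ,
      λ e → inj₂ e , <⇒≱ (≤-reflexive (≡-sym e))

    memᵗ-∈ᵇ : ∀ x y → TSat (𝔑 N) (memᵗ x y) ρ ⇔ (⟦ x ⟧ ∈ᵇ ⟦ y ⟧)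
    memᵗ-∈ᵇ x y =
      (λ { (inj₂ e , _) → e ; (inj₁ e , ≰) → ⊥-elim (≰ (≤-reflexive (≡-sym e))) }) ,
      λ e → inj₂ e , <⇒≱ (∈ᵇ⇒< ⟦ y ⟧ e)

    zeroᵗ-0 : ∀ x → TSat (𝔑 N) (zeroᵗ x) ρ ⇔ (⟦ x ⟧ ≡ 0)
    zeroᵗ-0 x = (λ h → n≤0⇒n≡0 (h zero)) , λ e a → ≤-trans (≤-reflexive e) z≤n

  -- The formula quantifies up to N and `Doubleton` over all numbers; nothing is lost, because the
  -- elements of a set are smaller than the set.
  doubletonᵗ-Doubleton : ∀ {ρ : Fin n → Fin (suc N)} p u v →
    TSat (𝔑 N) (doubletonᵗ p u v) ρ ⇔ Doubleton (toℕ (ρ p)) (toℕ (ρ u)) (toℕ (ρ v))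
  doubletonᵗ-Doubleton {n} {ρ} p u v = to , from
    where
    module At (a : Fin (suc N)) where
      σ : Fin (suc n) → Fin (suc N)
      σ = a ▹ ρ
      ∈p = memᵗ-∈ᵇ {ρ = σ} zero (suc p)
      ≡u = eqᵗ-≡ {ρ = σ} zero (suc u)
      ≡v = eqᵗ-≡ {ρ = σ} zero (suc v)
      to-∈ = λ (t : TSat (𝔑 N) (memᵗ zero (suc p) ⇒ᵗ eqᵗ zero (suc u) ∨ᵗ eqᵗ zero (suc v)) σ) w∈ →
        [ inj₁ ∘ proj₁ ≡u , inj₂ ∘ proj₁ ≡v ]′ (t (proj₂ ∈p w∈))
      from-≡ = λ (t : TSat (𝔑 N) (eqᵗ zero (suc u) ∨ᵗ eqᵗ zero (suc v) ⇒ᵗ memᵗ zero (suc p)) σ) →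
        [ (λ e → proj₁ ∈p (t (inj₁ (proj₂ ≡u e)))) , (λ e → proj₁ ∈p (t (inj₂ (proj₂ ≡v e)))) ]′
    to : TSat (𝔑 N) (doubletonᵗ p u v) ρ → Doubleton (toℕ (ρ p)) (toℕ (ρ u)) (toℕ (ρ v))
    to t w = (λ w∈ → let w≤N = ≤-trans (<⇒≤ (∈ᵇ⇒< _ w∈)) (toℕ≤ (ρ p)) ; e = toℕ-fin w≤N in
                subst (λ w → w ≡ toℕ (ρ u) ⊎ w ≡ toℕ (ρ v)) e
                  (At.to-∈ (fin w≤N) (proj₁ (t (fin w≤N))) (subst (_∈ᵇ toℕ (ρ p)) (≡-sym e) w∈))) ,
             λ { (inj₁ refl) → At.from-≡ (ρ u) (proj₂ (t (ρ u))) (inj₁ refl)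
               ; (inj₂ refl) → At.from-≡ (ρ v) (proj₂ (t (ρ v))) (inj₂ refl) }
    from : Doubleton (toℕ (ρ p)) (toℕ (ρ u)) (toℕ (ρ v)) → TSat (𝔑 N) (doubletonᵗ p u v) ρ
    from d a = (λ t → [ inj₁ ∘ proj₂ ≡u , inj₂ ∘ proj₂ ≡v ]′ (proj₁ (d (toℕ a)) (proj₁ ∈p t))) ,
               λ t → proj₂ ∈p (proj₂ (d (toℕ a)) ([ inj₁ ∘ proj₁ ≡u , inj₂ ∘ proj₁ ≡v ]′ t))
      where open At a

  kpairᵗ-KPair : ∀ {ρ : Fin n → Fin (suc N)} p a b →
    TSat (𝔑 N) (kpairᵗ p a b) ρ ⇔ KPair (toℕ (ρ p)) (toℕ (ρ a)) (toℕ (ρ b))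
  kpairᵗ-KPair {n} {ρ} p a b = to , from
    where
    module At (u v : Fin (suc N)) where
      σ : Fin (suc (suc n)) → Fin (suc N)
      σ = v ▹ u ▹ ρ
      du = doubletonᵗ-Doubleton {ρ = σ} (suc zero) (suc (suc a)) (suc (suc a))
      dv = doubletonᵗ-Doubleton {ρ = σ} zero (suc (suc a)) (suc (suc b))
      dp = doubletonᵗ-Doubleton {ρ = σ} (suc (suc p)) (suc zero) zero
    to : TSat (𝔑 N) (kpairᵗ p a b) ρ → KPair (toℕ (ρ p)) (toℕ (ρ a)) (toℕ (ρ b))
    to (u , v , t , t′ , t″) = let open At u v in
      toℕ u , toℕ v , proj₁ du t , proj₁ dv t′ , proj₁ dp t″
    from : KPair (toℕ (ρ p)) (toℕ (ρ a)) (toℕ (ρ b)) → TSat (𝔑 N) (kpairᵗ p a b) ρ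
    from (u , v , d , d′ , d″) with inv (proj₂ (d″ u) (inj₁ refl)) | inv (proj₂ (d″ v) (inj₂ refl))
      where
      inv : ∀ {w} → w ∈ᵇ toℕ (ρ p) → Σ (Fin (suc N)) λ i → toℕ i ≡ w
      inv w∈ = let w≤N = ≤-trans (<⇒≤ (∈ᵇ⇒< _ w∈)) (toℕ≤ (ρ p)) in fin w≤N , toℕ-fin w≤N
    ... | i , refl | i′ , refl = let open At i i′ in i , i′ , proj₂ du d , proj₂ dv d′ , proj₂ dp d″

-- Recursive functions in bounded arithmetic

mutual
  χ : Rec k → (Fin k → Fin j) → Fin j → TF j
  χ Z xs y = zeroᵗ y
  χ S xs y = succᵗ (xs zero) y
  χ (P i) xs y = eqᵗ (xs i) y
  χ {j = j} (C {m = m} f gs) xs y =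
    exsᵗ m (χs gs (λ i → m ↑ʳ xs i) (_↑ˡ j) (χ f (_↑ˡ j) (m ↑ʳ y)))
  -- There is a set s of pairs (i , v) that contains (x , y) and is closed under the recursion.
  χ (R f g) xs y =
    ∃ᵗ ((∃ᵗ (memᵗ zero (suc zero) ∧ᵗ kpairᵗ zero (suc (suc (xs zero))) (suc (suc y)))) ∧ᵗ
        -- Closure runs downwards: for (i , v) in s, either i is 0 and v is the value of f, or the
        -- predecessor j of i has a pair (j , r) in s from which g yields v. The innermost variables
        -- 0 to 6 are the pair of j and r, then r, j, v, i, the pair of i and v, and s.
        (∀ᵗ ∀ᵗ ∀ᵗ (memᵗ (suc (suc zero)) (suc (suc (suc zero))) ∧ᵗ kpairᵗ (suc (suc zero)) (suc zero) zero ⇒ᵗ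
          (zeroᵗ (suc zero) ⇒ᵗ χ f (λ i → 4 ↑ʳ xs (suc i)) zero) ∧ᵗ
          (∀ᵗ (succᵗ zero (suc (suc zero)) ⇒ᵗ
            ∃ᵗ ∃ᵗ (memᵗ zero (suc (suc (suc (suc (suc (suc zero)))))) ∧ᵗ kpairᵗ zero (suc (suc zero)) (suc zero) ∧ᵗ
                   χ g (suc (suc zero) ▹ suc zero ▹ (λ i → 7 ↑ʳ xs (suc i))) (suc (suc (suc zero)))))))))
  χ (M f) xs y =
    (∃ᵗ (zeroᵗ zero ∧ᵗ χ f (suc y ▹ (λ i → suc (xs i))) zero)) ∧ᵗ
    (∀ᵗ (ltᵗ zero (suc y) ⇒ᵗ ∃ᵗ (¬ᵗ zeroᵗ zero ∧ᵗ χ f (suc zero ▹ (λ i → 2 ↑ʳ xs i)) zero)))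

  χs : Vec (Rec k) m → (Fin k → Fin j) → (Fin m → Fin j) → TF j → TF j
  χs []       xs ys θ = θ
  χs (g ∷ gs) xs ys θ = χ g xs (ys zero) ∧ᵗ χs gs xs (ys ∘ suc) θ

Values : ∀ {N} → (Fin j → Fin (suc N)) → (Fin k → Fin j) → Vec ℕ k → Set
Values ρ xs vs = ∀ i → toℕ (ρ (xs i)) ≡ lookup vs i

mutual
  -- This holds for every N, however small: witnesses in `𝔑 N` are genuine, and the universal
  -- quantifiers are needed only below numbers already at hand. For `R`, the set s need not be
  -- functional, since `go` only descends along justifications.
  χ-sound : ∀ {N} (f : Rec k) {xs : Fin k → Fin j} {y vs ρ} → Values {N = N} ρ xs vs →
            TSat (𝔑 N) (χ f xs y) ρ → f [ vs ]⇓ toℕ (ρ y)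
  χ-sound Z {y = y} {ρ = ρ} V t rewrite proj₁ (zeroᵗ-0 {ρ = ρ} y) t = ev-Z
  χ-sound S {xs} {y} {v ∷ []} {ρ} V t rewrite proj₁ (succᵗ-suc {ρ = ρ} (xs zero) y) t | V zero = ev-S
  χ-sound (P i) {xs} {y} {ρ = ρ} V t rewrite ≡-sym (proj₁ (eqᵗ-≡ {ρ = ρ} (xs i) y) t) | V i = ev-P
  χ-sound {j = j} {N} (C {m = m} f gs) {xs} {y} {ρ = ρ} V t with proj₁ (TSat-exsᵗ (𝔑 N) m _) t
  ... | as , t′ with χs-sound gs {θ = χ f (_↑ˡ j) (m ↑ʳ y)} (λ i → trans (cong toℕ (▹▹-↑ʳ as (xs i))) (V i)) t′
  ...   | ds , t″ = ev-C ds (subst (f [ _ ]⇓_) (cong toℕ (▹▹-↑ʳ as y))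
                      (χ-sound f (λ i → ≡-sym (lookup∘tabulate _ i)) t″))
  χ-sound {N = N} (R f g) {xs} {y} {v ∷ vs} {ρ} V (s , (p , p∈ , pk) , closed) =
    subst (λ w → R f g [ w ∷ vs ]⇓ _) (V zero)
      (go _ refl (proj₁ (memᵗ-∈ᵇ {ρ = p ▹ s ▹ ρ} zero (suc zero)) p∈)
          (proj₁ (kpairᵗ-KPair {ρ = p ▹ s ▹ ρ} zero (suc (suc (xs zero))) (suc (suc y))) pk))
    where
    go : ∀ {p i r : Fin (suc N)} w → toℕ i ≡ w → toℕ p ∈ᵇ toℕ s → KPair (toℕ p) (toℕ i) (toℕ r) →
         R f g [ w ∷ vs ]⇓ toℕ r
    go {p} {i} {r} w e p∈ pk with closed p i r (proj₂ (memᵗ-∈ᵇ {ρ = σ} (suc (suc zero)) (suc (suc (suc zero)))) p∈ ,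
                                               proj₂ (kpairᵗ-KPair {ρ = σ} (suc (suc zero)) (suc zero) zero) pk)
      where σ = r ▹ i ▹ p ▹ s ▹ ρ
    go {p} {i} {r} zero e p∈ pk | base , _ =
      ev-R0 (χ-sound f (V ∘ suc) (base (proj₂ (zeroᵗ-0 {ρ = r ▹ i ▹ p ▹ s ▹ ρ} (suc zero)) e)))
    go {p} {i} {r} (suc w) e p∈ pk | _ , step
      with step (fin w≤N) (proj₂ (succᵗ-suc {ρ = fin w≤N ▹ r ▹ i ▹ p ▹ s ▹ ρ} zero (suc (suc zero)))
                            (trans e (cong suc (≡-sym (toℕ-fin w≤N)))))
      where w≤N = ≤-trans (n≤1+n w) (≤-trans (≤-reflexive (≡-sym e)) (toℕ≤ i))
    ... | r′ , q , q∈ , qk , t =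
      ev-RS (go w w≡ (proj₁ (memᵗ-∈ᵇ {ρ = τ} zero (suc (suc (suc (suc (suc (suc zero))))))) q∈)
                     (proj₁ (kpairᵗ-KPair {ρ = τ} zero (suc (suc zero)) (suc zero)) qk))
            (χ-sound g (λ { zero → w≡ ; (suc zero) → refl ; (suc (suc l)) → V (suc l) }) t)
      where
      w≤N = ≤-trans (n≤1+n w) (≤-trans (≤-reflexive (≡-sym e)) (toℕ≤ i))
      w≡ = toℕ-fin w≤N
      τ = q ▹ r′ ▹ fin w≤N ▹ r ▹ i ▹ p ▹ s ▹ ρ
  χ-sound {N = N} (M f) {xs} {y} {vs} {ρ} V ((o , o≡0 , t) , below) =
    ev-M (subst (f [ toℕ (ρ y) ∷ vs ]⇓_) (proj₁ (zeroᵗ-0 {ρ = o ▹ ρ} zero) o≡0)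
           (χ-sound f (λ { zero → refl ; (suc i) → V i }) t))
         positive
    where
    positive : ∀ z → z < toℕ (ρ y) → Σ ℕ λ r → f [ z ∷ vs ]⇓ suc r
    positive z z<y with ≤-trans (<⇒≤ z<y) (toℕ≤ (ρ y))
    ... | z≤N with below (fin z≤N) (<⇒≱ (subst (_< toℕ (ρ y)) (≡-sym (toℕ-fin z≤N)) z<y))
    ...   | zero , r≢0 , _ = ⊥-elim (r≢0 (proj₂ (zeroᵗ-0 {ρ = zero ▹ fin z≤N ▹ ρ} zero) refl))
    ...   | suc r , _ , t = toℕ r , χ-sound f (λ { zero → toℕ-fin z≤N ; (suc i) → V i }) t

  χs-sound : ∀ {N} (gs : Vec (Rec k) m) {xs : Fin k → Fin j} {ys vs ρ θ} → Values {N = N} ρ xs vs →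
             TSat (𝔑 N) (χs gs xs ys θ) ρ → gs [ vs ]⇓* tabulate (toℕ ∘ ρ ∘ ys) × TSat (𝔑 N) θ ρ
  χs-sound []       V t = ev-[] , t
  χs-sound (g ∷ gs) V (t , t′) = let ds , t″ = χs-sound gs V t′ in ev-∷ (χ-sound g V t) ds , t″

-- N₀ is a size beyond which all witnesses fit. It is uniform in the context and the variables,
-- because `χ f` occurs under varying numbers of quantifiers.
record Valid (f : Rec k) (vs : Vec ℕ k) (r N₀ : ℕ) : Set where
  constructor valid
  field
    use : ∀ {N j} → N₀ ≤ N → ∀ {xs : Fin k → Fin j} {y ρ} → Values {N = N} ρ xs vs →
          toℕ (ρ y) ≡ r → TSat (𝔑 N) (χ f xs y) ρ
open Valid

record Valids (gs : Vec (Rec k) m) (vs : Vec ℕ k) (ws : Vec ℕ m) (N₀ : ℕ) : Set where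
  constructor valids
  field
    uses : ∀ {N j} → N₀ ≤ N → ∀ {xs : Fin k → Fin j} {ys : Fin m → Fin j} {θ ρ} → Values {N = N} ρ xs vs →
           Values ρ ys ws → TSat (𝔑 N) θ ρ → TSat (𝔑 N) (χs gs xs ys θ) ρ
open Valids

Valid-mono : ∀ {f : Rec k} {vs r N₀ N₁} → N₀ ≤ N₁ → Valid f vs r N₀ → Valid f vs r N₁
Valid-mono l val = valid λ l′ → use val (≤-trans l l′)

Justified : Rec k → Rec (suc (suc k)) → Vec ℕ k → ℕ → ℕ → ℕ → ℕ → Set
Justified f g vs N₀ s i v =
  (i ≡ 0 × Valid f vs v N₀) ⊎
  (Σ ℕ λ j → Σ ℕ λ r → i ≡ suc j × (Σ ℕ λ q → q ∈ᵇ s × KPair q j r) × Valid g (j ∷ r ∷ vs) v N₀)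

Justified-mono : ∀ {f : Rec k} {g vs N₀ N₁ s s′ i v} → N₀ ≤ N₁ → (∀ p → p ∈ᵇ s → p ∈ᵇ s′) →
                 Justified f g vs N₀ s i v → Justified f g vs N₁ s′ i v
Justified-mono l sub (inj₁ (e , val)) = inj₁ (e , Valid-mono l val)
Justified-mono l sub (inj₂ (j , r , e , (q , q∈ , k) , val)) =
  inj₂ (j , r , e , (q , sub q q∈ , k) , Valid-mono l val)

-- A witness for the set in `χ (R f g)`, with one threshold N₀ that serves all evaluations of f and
-- g recorded in it.
Trace : Rec k → Rec (suc (suc k)) → Vec ℕ k → ℕ → ℕ → Set
Trace f g vs n r = Σ ℕ λ s → Σ ℕ λ N₀ → (Σ ℕ λ p → p ∈ᵇ s × KPair p n r) ×
  (∀ p → p ∈ᵇ s → Σ ℕ λ i → Σ ℕ λ v → KPair p i v × Justified f g vs N₀ s i v)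

Valid-R : ∀ {f : Rec k} {g n vs r} → Trace f g vs n r → Σ ℕ (Valid (R f g) (n ∷ vs) r)
-- The set s must itself be a number of `𝔑 N`; its pairs and their components are smaller.
Valid-R {f = f} {g} {n} {vs} {r} (s , N₀ , (p₀ , p₀∈ , pk₀) , just) = N₀ + s , valid λ {N} {j} → holds {N} {j}
  where
  holds : ∀ {N j} → N₀ + s ≤ N → ∀ {xs : Fin (suc _) → Fin j} {y ρ} → Values {N = N} ρ xs (n ∷ vs) →
          toℕ (ρ y) ≡ r → TSat (𝔑 N) (χ (R f g) xs y) ρ
  holds {N} l {xs} {y} {ρ} V y≡r = sᶠ , (pᶠ ,
      proj₂ (memᵗ-∈ᵇ {ρ = pᶠ ▹ sᶠ ▹ ρ} zero (suc zero)) (subst₂ _∈ᵇ_ (≡-sym pᶠ≡) (≡-sym sᶠ≡) p₀∈) ,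
      proj₂ (kpairᵗ-KPair {ρ = pᶠ ▹ sᶠ ▹ ρ} zero (suc (suc (xs zero))) (suc (suc y)))
        (subst₂ (λ a b → KPair (toℕ pᶠ) a b) (≡-sym (V zero)) (≡-sym y≡r) (subst (λ a → KPair a n r) (≡-sym pᶠ≡) pk₀))) ,
    λ p i v (m , k) → closed p i v
      (subst (toℕ p ∈ᵇ_) sᶠ≡ (proj₁ (memᵗ-∈ᵇ {ρ = v ▹ i ▹ p ▹ sᶠ ▹ ρ} (suc (suc zero)) (suc (suc (suc zero)))) m))
      (proj₁ (kpairᵗ-KPair {ρ = v ▹ i ▹ p ▹ sᶠ ▹ ρ} (suc (suc zero)) (suc zero) zero) k)
    where
    s≤N : s ≤ N
    s≤N = ≤-trans (m≤n+m s N₀) l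
    N₀≤N : N₀ ≤ N
    N₀≤N = ≤-trans (m≤m+n N₀ s) l
    sᶠ : Fin (suc N)
    sᶠ = fin s≤N
    sᶠ≡ : toℕ sᶠ ≡ s
    sᶠ≡ = toℕ-fin s≤N
    p₀≤N : p₀ ≤ N
    p₀≤N = ≤-trans (<⇒≤ (∈ᵇ⇒< s p₀∈)) s≤N
    pᶠ : Fin (suc N)
    pᶠ = fin p₀≤N
    pᶠ≡ : toℕ pᶠ ≡ p₀
    pᶠ≡ = toℕ-fin p₀≤N
    closed : ∀ p i v → toℕ p ∈ᵇ s → KPair (toℕ p) (toℕ i) (toℕ v) →
      TSat (𝔑 N) ((zeroᵗ (suc zero) ⇒ᵗ χ f (λ l → 4 ↑ʳ xs (suc l)) zero) ∧ᵗ
          (∀ᵗ (succᵗ zero (suc (suc zero)) ⇒ᵗ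
            ∃ᵗ ∃ᵗ (memᵗ zero (suc (suc (suc (suc (suc (suc zero)))))) ∧ᵗ kpairᵗ zero (suc (suc zero)) (suc zero) ∧ᵗ
                   χ g (suc (suc zero) ▹ suc zero ▹ (λ i → 7 ↑ʳ xs (suc i))) (suc (suc (suc zero)))))))
        (v ▹ i ▹ p ▹ sᶠ ▹ ρ)
    closed p i v p∈ pk with just (toℕ p) p∈
    ... | i′ , v′ , pk′ , J with KPair-injective {toℕ p} pk′ pk
    closed p i v p∈ pk | _ , _ , _ , inj₁ (i≡0 , val) | refl , refl =
      (λ _ → use val N₀≤N (V ∘ suc) refl) ,
      λ j t → ⊥-elim (0≢1+n (trans (≡-sym i≡0) (proj₁ (succᵗ-suc {ρ = j ▹ v ▹ i ▹ p ▹ sᶠ ▹ ρ} zero (suc (suc zero))) t)))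
    closed p i v p∈ pk | _ , _ , _ , inj₂ (j , r , i≡ , (q , q∈ , qk) , val) | refl , refl =
      (λ t → ⊥-elim (0≢1+n (trans (≡-sym (proj₁ (zeroᵗ-0 {ρ = v ▹ i ▹ p ▹ sᶠ ▹ ρ} (suc zero)) t)) i≡))) ,
      λ j′ t → step j′ (suc-injective (trans (≡-sym i≡) (proj₁ (succᵗ-suc {ρ = j′ ▹ v ▹ i ▹ p ▹ sᶠ ▹ ρ} zero (suc (suc zero))) t)))
      where
      q≤N : q ≤ N
      q≤N = ≤-trans (<⇒≤ (∈ᵇ⇒< s q∈)) s≤N
      r≤N : r ≤ N
      r≤N = ≤-trans (<⇒≤ (KPair-< qk)) q≤N
        where
        KPair-< : ∀ {p a b} → KPair p a b → b < p
        KPair-< {p} {a} {b} (u , v , _ , dv , dp) =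
          <-trans (∈ᵇ⇒< v (proj₂ (dv b) (inj₂ refl))) (∈ᵇ⇒< p (proj₂ (dp v) (inj₂ refl)))
      step : ∀ j′ → j ≡ toℕ j′ → TSat (𝔑 N) (∃ᵗ ∃ᵗ (memᵗ zero (suc (suc (suc (suc (suc (suc zero)))))) ∧ᵗ
        kpairᵗ zero (suc (suc zero)) (suc zero) ∧ᵗ
        χ g (suc (suc zero) ▹ suc zero ▹ (λ i → 7 ↑ʳ xs (suc i))) (suc (suc (suc zero)))))
        (j′ ▹ v ▹ i ▹ p ▹ sᶠ ▹ ρ)
      step j′ refl = fin r≤N , fin q≤N ,
        proj₂ (memᵗ-∈ᵇ {ρ = τ} zero (suc (suc (suc (suc (suc (suc zero))))))) (subst₂ _∈ᵇ_ (≡-sym q≡) (≡-sym sᶠ≡) q∈) ,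
        proj₂ (kpairᵗ-KPair {ρ = τ} zero (suc (suc zero)) (suc zero))
          (subst₂ (λ a b → KPair a (toℕ j′) b) (≡-sym q≡) (≡-sym r≡) qk) ,
        use val N₀≤N (λ { zero → refl ; (suc zero) → r≡ ; (suc (suc l)) → V (suc l) }) refl
        where
        q≡ = toℕ-fin q≤N
        r≡ = toℕ-fin r≤N
        τ = fin q≤N ▹ fin r≤N ▹ j′ ▹ v ▹ i ▹ p ▹ sᶠ ▹ ρ

singletonTrace : ∀ {f : Rec k} {g vs r N₀} → Valid f vs r N₀ → Trace f g vs 0 r
singletonTrace {f = f} {g} {vs} {r} {N₀} val =
  let p , pk = kpair 0 r ; s , s≡ = adjoin p 0 in
  s , N₀ , (p , proj₂ (s≡ p) (inj₁ refl) , pk) , λ q → just p pk s q ∘ proj₁ (s≡ q)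
  where
  just : ∀ p → KPair p 0 r → ∀ s q → q ≡ p ⊎ q ∈ᵇ 0 →
         Σ ℕ λ i → Σ ℕ λ v → KPair q i v × Justified f g vs N₀ s i v
  just p pk s q (inj₁ refl) = 0 , r , pk , inj₁ (refl , val)
  just p pk s q (inj₂ ())

extendTrace : ∀ {f : Rec k} {g vs n r r′ N₀} → Trace f g vs n r → Valid g (n ∷ r ∷ vs) r′ N₀ → Trace f g vs (suc n) r′
extendTrace {f = f} {g} {vs} {n} {r} {r′} {N₁} (s , N₀ , (p , p∈ , pk) , old) val =
  let p′ , pk′ = kpair (suc n) r′ ; s′ , s≡ = adjoin p′ s in
  s′ , N₀ + N₁ , (p′ , proj₂ (s≡ p′) (inj₁ refl) , pk′) ,
  λ q → just p′ pk′ s′ (λ q → proj₂ (s≡ q) ∘ inj₂) q ∘ proj₁ (s≡ q)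
  where
  just : ∀ p′ → KPair p′ (suc n) r′ → ∀ s′ → (∀ q → q ∈ᵇ s → q ∈ᵇ s′) → ∀ q → q ≡ p′ ⊎ q ∈ᵇ s →
         Σ ℕ λ i → Σ ℕ λ v → KPair q i v × Justified f g vs (N₀ + N₁) s′ i v
  just p′ pk′ s′ sub q (inj₁ refl) = suc n , r′ , pk′ ,
    inj₂ (n , r , refl , (p , sub p p∈ , pk) , Valid-mono (m≤n+m N₁ N₀) val)
  just p′ pk′ s′ sub q (inj₂ q∈) = let i , v , qk , J = old q q∈ in
    i , v , qk , Justified-mono {f = f} {g} {vs} {s = s} {s′} (m≤m+n N₀ N₁) sub J

bounded : ∀ y {Q : ℕ → ℕ → Set} → (∀ {z a b} → a ≤ b → Q z a → Q z b) →
          (∀ z → z < y → Σ ℕ (Q z)) → Σ ℕ λ N → ∀ z → z < y → Q z N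
bounded zero    mono h = 0 , λ _ ()
bounded (suc y) mono h =
  let N , old = bounded y mono (λ z → h z ∘ m<n⇒m<1+n) ; N′ , new = h y ≤-refl in
  N + N′ , λ { z (s≤s z≤y) → [ (λ z<y → mono (m≤m+n N N′) (old z z<y)) , (λ { refl → mono (m≤n+m N′ N) new }) ]′ (m≤n⇒m<n∨m≡n z≤y) }

upperBound : (ws : Vec ℕ m) → Σ ℕ λ b → ∀ i → lookup ws i ≤ b
upperBound []       = 0 , λ ()
upperBound (w ∷ ws) = let b , h = upperBound ws in
  w + b , λ { zero → m≤m+n w b ; (suc i) → ≤-trans (h i) (m≤n+m b w) }

mutual
  -- An evaluation is a finite object and mentions finitely many numbers, so they all lie below some
  -- N₀.
  χ-complete : ∀ {f : Rec k} {vs r} → f [ vs ]⇓ r → Σ ℕ (Valid f vs r)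
  χ-complete ev-Z = 0 , valid λ _ {y = y} {ρ} _ e → proj₂ (zeroᵗ-0 {ρ = ρ} y) e
  χ-complete ev-S = 0 , valid λ _ {xs} {y} {ρ} V e →
    proj₂ (succᵗ-suc {ρ = ρ} (xs zero) y) (trans e (cong suc (≡-sym (V zero))))
  χ-complete (ev-P {i = i}) = 0 , valid λ _ {xs} {y} {ρ} V e → proj₂ (eqᵗ-≡ {ρ = ρ} (xs i) y) (trans (V i) (≡-sym e))
  χ-complete (ev-C {k = k} {m} {f = f} {gs} {vs} {ws} {r} ds d) with χs-complete ds | χ-complete d | upperBound ws
  ... | N₀ , vals | N₁ , val | b , ws≤b = N₀ + (N₁ + b) , valid λ {N} {j} → holds {N} {j}
    where
    holds : ∀ {N j} → N₀ + (N₁ + b) ≤ N → ∀ {xs : Fin k → Fin j} {y ρ} → Values {N = N} ρ xs vs →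
            toℕ (ρ y) ≡ r → TSat (𝔑 N) (χ (C f gs) xs y) ρ
    holds {N} {j} l {xs} {y} {ρ} V e = proj₂ (TSat-exsᵗ (𝔑 N) m (χs gs (λ i → m ↑ʳ xs i) (_↑ˡ j) (χ f (_↑ˡ j) (m ↑ʳ y))))
      (as , uses vals (≤-trans (m≤m+n N₀ _) l) (λ i → trans (cong toℕ (▹▹-↑ʳ as (xs i))) (V i)) asV
              (use val (≤-trans (≤-trans (m≤m+n N₁ b) (m≤n+m _ N₀)) l) asV (trans (cong toℕ (▹▹-↑ʳ as y)) e)))
      where
      ws≤N : ∀ i → lookup ws i ≤ N
      ws≤N i = ≤-trans (ws≤b i) (≤-trans (≤-trans (m≤n+m b N₁) (m≤n+m _ N₀)) l)
      as : Vec (Fin (suc N)) m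
      as = tabulate λ i → fin (ws≤N i)
      asV : Values (as ▹▹ ρ) (_↑ˡ j) ws
      asV i = trans (cong toℕ (trans (▹▹-↑ˡ as i) (lookup∘tabulate _ i))) (toℕ-fin (ws≤N i))
  χ-complete (ev-R0 d) = Valid-R (singletonTrace (proj₂ (χ-complete d)))
  χ-complete (ev-RS d e) = Valid-R (extendTrace (trace d) (proj₂ (χ-complete e)))
  χ-complete (ev-M {k = k} {f = f} {vs} {y} d below) with χ-complete d
    | bounded y {Q = λ z N → Σ ℕ λ r → Valid f (z ∷ vs) (suc r) N × suc r ≤ N}
        (λ l (r , val , b) → r , Valid-mono l val , ≤-trans b l)
        (λ z z<y → let N , val = χ-complete (proj₂ (below z z<y)) ; r = suc (proj₁ (below z z<y)) in
                   N + r , proj₁ (below z z<y) , Valid-mono (m≤m+n N r) val , m≤n+m r N)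
  ... | N₀ , val | N₁ , vals = N₀ + N₁ , valid λ {N} {j} → holds {N} {j}
    where
    holds : ∀ {N j} → N₀ + N₁ ≤ N → ∀ {xs : Fin k → Fin j} {w ρ} → Values {N = N} ρ xs vs →
            toℕ (ρ w) ≡ y → TSat (𝔑 N) (χ (M f) xs w) ρ
    holds {N} l {xs} {w} {ρ} V refl =
      (zero , proj₂ (zeroᵗ-0 {ρ = zero ▹ ρ} zero) refl ,
        use val (≤-trans (m≤m+n N₀ N₁) l) (λ { zero → refl ; (suc i) → V i }) refl) ,
      λ z z<y → let r , val′ , r<N₁ = vals (toℕ z) (≰⇒> z<y) ; N₁≤N = ≤-trans (m≤n+m N₁ N₀) l ; r<N = ≤-trans r<N₁ N₁≤N in
        fin r<N , (λ t → 0≢1+n (trans (≡-sym (proj₁ (zeroᵗ-0 {ρ = fin r<N ▹ z ▹ ρ} zero) t)) (toℕ-fin r<N))) ,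
        use val′ N₁≤N (λ { zero → refl ; (suc i) → V i }) (toℕ-fin r<N)

  trace : ∀ {f : Rec k} {g n vs r} → R f g [ n ∷ vs ]⇓ r → Trace f g vs n r
  trace (ev-R0 d)   = singletonTrace (proj₂ (χ-complete d))
  trace (ev-RS d e) = extendTrace (trace d) (proj₂ (χ-complete e))

  χs-complete : ∀ {gs : Vec (Rec k) m} {vs ws} → gs [ vs ]⇓* ws → Σ ℕ (Valids gs vs ws)
  χs-complete ev-[] = 0 , valids λ _ _ _ t → t
  χs-complete (ev-∷ d ds) = let N₀ , val = χ-complete d ; N₁ , vals = χs-complete ds in
    N₀ + N₁ , valids λ l V W t → use val (≤-trans (m≤m+n N₀ N₁) l) V (W zero) , uses vals (≤-trans (m≤n+m N₁ N₀) l) V (W ∘ suc) t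

isYes-⇔ : ∀ {P : Set} (P? : Dec P) → (isYes P? ≡ true) ⇔ P
isYes-⇔ (yes p) = (λ _ → p) , λ _ → refl
isYes-⇔ (no ¬p) = (λ ()) , λ p → ⊥-elim (¬p p)

≡-isYes : ∀ {P : Set} (P? : Dec P) {b} → (b ≡ true) ⇔ P → b ≡ isYes P?
≡-isYes (yes p) (_ , g) = g p
≡-isYes (no ¬p) (f , _) = ≢true⇒≡false (¬p ∘ f)

-- Seven parameter vertices and k elements of three vertices each

data Name (k : ℕ) : Set where
  par : Fin 7 → Name k
  el  : Fin k → Fin 3 → Name k

#Names : ℕ → ℕ
#Names k = 7 + k * 3

code : Name k → Fin (#Names k)
code {k} (par i)  = i ↑ˡ (k * 3)
code     (el j t) = 7 ↑ʳ combine j t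

unsplit : Fin 7 ⊎ Fin (k * 3) → Name k
unsplit (inj₁ i) = par i
unsplit (inj₂ y) = uncurry el (remQuot 3 y)

decode : ∀ k → Fin (#Names k) → Name k
decode k = unsplit ∘ splitAt 7

decode-code : ∀ (a : Name k) → decode k (code a) ≡ a
decode-code {k} (par i)  = cong unsplit (splitAt-↑ˡ 7 i (k * 3))
decode-code {k} (el j t) = trans (cong unsplit (splitAt-↑ʳ 7 (k * 3) (combine j t)))
                                 (cong (uncurry el) (remQuot-combine j t))

code-decode : ∀ k x → code (decode k x) ≡ x
code-decode k x = trans (code-unsplit (splitAt 7 x)) (join-splitAt 7 (k * 3) x)
  where
  code-unsplit : ∀ s → code (unsplit {k} s) ≡ join 7 (k * 3) s
  code-unsplit (inj₁ i) = refl
  code-unsplit (inj₂ y) = cong (7 ↑ʳ_) (combine-remQuot {n = k} 3 y)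

-- An asymmetric graph without twins or vertices of degree one, found by a search. Each vertex lies
-- in the clique 0, 1, 2, 3 or is adjacent to two previous ones. In ℋ n only parameters can do this:
-- an element vertex is adjacent to a single parameter, and the elements have no 4-clique.
paramMatrix : Vec (Vec Bool 7) 7
paramMatrix =
  (false ∷ true  ∷ true  ∷ true  ∷ true  ∷ false ∷ true  ∷ []) ∷
  (true  ∷ false ∷ true  ∷ true  ∷ true  ∷ false ∷ false ∷ []) ∷
  (true  ∷ true  ∷ false ∷ true  ∷ false ∷ true  ∷ false ∷ []) ∷
  (true  ∷ true  ∷ true  ∷ false ∷ false ∷ false ∷ false ∷ []) ∷
  (true  ∷ true  ∷ false ∷ false ∷ false ∷ true  ∷ false ∷ []) ∷
  (false ∷ false ∷ true  ∷ false ∷ true  ∷ false ∷ true  ∷ []) ∷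
  (true  ∷ false ∷ false ∷ false ∷ false ∷ true  ∷ false ∷ []) ∷ []

paramAdj : Fin 7 → Fin 7 → Bool
paramAdj i j = lookup (lookup paramMatrix i) j

role : Fin 3 → Fin 7 → Bool
role t i = isYes (t ↑ˡ 4 ≟ᶠ i)

Bt? : ∀ i j → Dec (i ≡ j ⊎ i ∈ᵇ j)
Bt? i j = (i ≟ j) ⊎-dec (digit j i ≟ᵇ true)

Sc? : ∀ i j → Dec (j ≡ i ⊎ j ≡ suc i)
Sc? i j = (j ≟ i) ⊎-dec (j ≟ suc i)

-- Three vertices of different types are pairwise adjacent only if they belong to the same number.
link : Fin 3 → Fin 3 → ℕ → ℕ → Bool
link zero             (suc zero)       i j = isYes (Bt? i j)
link (suc zero)       zero             i j = isYes (Bt? j i)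
link (suc zero)       (suc (suc zero)) i j = isYes (Sc? i j)
link (suc (suc zero)) (suc zero)       i j = isYes (Sc? j i)
link zero             (suc (suc zero)) i j = isYes (j ≤? i)
link (suc (suc zero)) zero             i j = isYes (i ≤? j)
link _                _                i j = false

link-sym : ∀ t t′ i j → link t t′ i j ≡ link t′ t j i
link-sym zero             zero             i j = refl
link-sym zero             (suc zero)       i j = refl
link-sym zero             (suc (suc zero)) i j = refl
link-sym (suc zero)       zero             i j = refl
link-sym (suc zero)       (suc zero)       i j = refl
link-sym (suc zero)       (suc (suc zero)) i j = refl
link-sym (suc (suc zero)) zero             i j = refl
link-sym (suc (suc zero)) (suc zero)       i j = refl
link-sym (suc (suc zero)) (suc (suc zero)) i j = refl

link-self : ∀ t i j → link t t i j ≡ false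
link-self zero             i j = refl
link-self (suc zero)       i j = refl
link-self (suc (suc zero)) i j = refl

nameAdj : Name k → Name k → Bool
nameAdj (par i)  (par j)    = paramAdj i j
nameAdj (par i)  (el _ t)   = role t i
nameAdj (el _ t) (par i)    = role t i
nameAdj (el i t) (el j t′)  = link t t′ (toℕ i) (toℕ j)

nameAdj-irrefl : ∀ (a : Name k) → nameAdj a a ≡ false
nameAdj-irrefl (par i)  = from-yes (all? λ i → paramAdj i i ≟ᵇ false) i
nameAdj-irrefl (el i t) = link-self t (toℕ i) (toℕ i)

nameAdj-sym : ∀ (a b : Name k) → nameAdj a b ≡ nameAdj b a
nameAdj-sym (par i)  (par j)   = from-yes (all? λ i → all? λ j → paramAdj i j ≟ᵇ paramAdj j i) i j
nameAdj-sym (par i)  (el _ t)  = refl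
nameAdj-sym (el _ t) (par i)   = refl
nameAdj-sym (el i t) (el j t′) = link-sym t t′ (toℕ i) (toℕ j)

ℋ : ℕ → Graph
ℋ n = record
  { size = #Names (suc n)
  ; adj = λ x y → nameAdj (decode (suc n) x) (decode (suc n) y)
  ; irrefl = nameAdj-irrefl ∘ decode (suc n)
  ; sym = λ x y → nameAdj-sym (decode (suc n) x) (decode (suc n) y) }

Copy : ∀ G → (Name k → Vertex G) → Set
Copy G h = ∀ a b → adj G (h a) (h b) ≡ nameAdj a b

Copy⇔FullHom : ∀ G n → Σ (Name (suc n) → Vertex G) (Copy G) ⇔ FullHom (ℋ n) G
Copy⇔FullHom G n =
  (λ (h , c) → h ∘ decode (suc n) , λ x y → c (decode (suc n) x) (decode (suc n) y)) ,
  (λ (f , p) → f ∘ code , λ a b → trans (p (code a) (code b)) (cong₂ nameAdj (decode-code a) (decode-code b)))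

embed≤ : m ≤ n → Name (suc m) → Name (suc n)
embed≤ m≤n (par i)  = par i
embed≤ m≤n (el j t) = el (fin (≤-trans (toℕ≤ j) m≤n)) t

-- `link` depends only on the two numbers. Excluding the least relevant `ℋ K` therefore excludes all
-- larger ones.
ℋ-mono : m ≤ n → FullHom (ℋ m) (ℋ n)
ℋ-mono {m} {n} m≤n = proj₁ (Copy⇔FullHom (ℋ n) m) (code ∘ embed≤ m≤n , λ a b →
  trans (cong₂ nameAdj (decode-code (embed≤ m≤n a)) (decode-code (embed≤ m≤n b))) (adj≡ a b))
  where
  adj≡ : ∀ a b → nameAdj (embed≤ m≤n a) (embed≤ m≤n b) ≡ nameAdj a b
  adj≡ (par i)  (par j)   = refl
  adj≡ (par i)  (el _ t)  = refl
  adj≡ (el _ t) (par i)   = refl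
  adj≡ (el i t) (el j t′) = cong₂ (link t t′) (toℕ-fin (≤-trans (toℕ≤ i) m≤n)) (toℕ-fin (≤-trans (toℕ≤ j) m≤n))

-- The parameters determine a vertex up to its number. Twins of one type are adjacent to the other
-- vertices of each other's triangles, and these edges give both inequalities between the numbers.
twin-free : ∀ (a b : Name k) → (∀ c → nameAdj a c ≡ nameAdj b c) → a ≡ b
twin-free (par i) (par j) h =
  cong par (from-yes (all? λ i → all? λ j → all? (λ l → paramAdj i l ≟ᵇ paramAdj j l) →-dec (i ≟ᶠ j)) i j (h ∘ par))
twin-free (par i) (el j t) h =
  ⊥-elim (from-yes (all? λ i → all? λ t → ¬? (all? λ l → paramAdj i l ≟ᵇ role t l)) i t (h ∘ par))
twin-free (el j t) (par i) h =
  ⊥-elim (from-yes (all? λ i → all? λ t → ¬? (all? λ l → role t l ≟ᵇ paramAdj i l)) i t (h ∘ par))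
twin-free (el i t) (el j t′) h
  with from-yes (all? λ t → all? λ t′ → all? (λ l → role t l ≟ᵇ role t′ l) →-dec (t ≟ᶠ t′)) t t′ (h ∘ par)
... | refl = cong (λ i → el i t) (toℕ-injective (≤-antisym (le t i j h) (le t j i (≡-sym ∘ h))))
  where
  le : ∀ t i j → (∀ c → nameAdj (el i t) c ≡ nameAdj (el j t) c) → toℕ i ≤ toℕ j
  le zero i j h = proj₁ (isYes-⇔ (_ ≤? _)) (trans (≡-sym (h (el i (suc (suc zero))))) (proj₂ (isYes-⇔ (_ ≤? _)) ≤-refl))
  le (suc zero) i j h =
    [ (λ e → ≤-reflexive e) , (λ i∈ → <⇒≤ (∈ᵇ⇒< (toℕ j) i∈)) ]′
      (proj₁ (isYes-⇔ (Bt? (toℕ i) (toℕ j))) (trans (≡-sym (h (el i zero))) (proj₂ (isYes-⇔ (Bt? (toℕ i) (toℕ i))) (inj₁ refl))))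
  le (suc (suc zero)) i j h =
    proj₁ (isYes-⇔ (_ ≤? _)) (trans (h (el j zero)) (proj₂ (isYes-⇔ (_ ≤? _)) ≤-refl))

-- Only twins can have the same image under a full homomorphism. Hence a graph that contains a copy
-- of `ℋ n` has at least as many vertices.
FullHom-injective : ∀ {n G} ((f , _) : FullHom (ℋ n) G) → ∀ x y → f x ≡ f y → x ≡ y
FullHom-injective {n} {G} (f , p) x y e =
  trans (≡-sym (code-decode (suc n) x)) (trans (cong code (twin-free (decode (suc n) x) (decode (suc n) y) rows)) (code-decode (suc n) y))
  where
  rows : ∀ c → nameAdj (decode (suc n) x) c ≡ nameAdj (decode (suc n) y) c
  rows c = begin
    nameAdj (decode (suc n) x) c                 ≡⟨ cong (nameAdj (decode (suc n) x)) (decode-code c) ⟨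
    nameAdj (decode (suc n) x) (decode (suc n) (code c)) ≡⟨ p x (code c) ⟨
    adj G (f x) (f (code c))             ≡⟨ cong (λ v → adj G v (f (code c))) e ⟩
    adj G (f y) (f (code c))             ≡⟨ p y (code c) ⟩
    nameAdj (decode (suc n) y) (decode (suc n) (code c)) ≡⟨ cong (nameAdj (decode (suc n) y)) (decode-code c) ⟩
    nameAdj (decode (suc n) y) c                 ∎
    where open ≡-Reasoning

-- Rigidity: the images of vertices of ℋ n are classified by parameter or type, and a backtracking
-- search over the classes finds only the identity.

Class : Set
Class = Fin 10

classify : Name k → Class
classify (par i)  = i ↑ˡ 3
classify (el _ t) = 7 ↑ʳ t

-- Classes forget the number of an element, so this is only a necessary condition: between element
-- vertices it rules out just the edges within one type.
fits : Fin 7 ⊎ Fin 3 → Fin 7 ⊎ Fin 3 → Bool → Bool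
fits (inj₁ i) (inj₁ j)  b = isYes (paramAdj i j ≟ᵇ b)
fits (inj₁ i) (inj₂ t)  b = isYes (role t i ≟ᵇ b)
fits (inj₂ t) (inj₁ i)  b = isYes (role t i ≟ᵇ b)
fits (inj₂ t) (inj₂ t′) b = not (isYes (t ≟ᶠ t′) ∧ b)

possible : Class → Class → Bool → Bool
possible x y = fits (splitAt 7 x) (splitAt 7 y)

possible-nameAdj : ∀ (a b : Name k) → possible (classify a) (classify b) (nameAdj a b) ≡ true
possible-nameAdj (par i) (par j) rewrite splitAt-↑ˡ 7 i 3 | splitAt-↑ˡ 7 j 3 = proj₂ (isYes-⇔ (_ ≟ᵇ _)) refl
possible-nameAdj (par i) (el _ t) rewrite splitAt-↑ˡ 7 i 3 = proj₂ (isYes-⇔ (_ ≟ᵇ _)) refl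
possible-nameAdj (el _ t) (par i) rewrite splitAt-↑ˡ 7 i 3 = proj₂ (isYes-⇔ (_ ≟ᵇ _)) refl
possible-nameAdj (el i t) (el j t′) with t ≟ᶠ t′
... | yes refl rewrite link-self t (toℕ i) (toℕ j) = refl
... | no _     = refl

every : (Fin m → Bool) → Bool
every {zero}  p = true
every {suc m} p = p zero ∧ every (p ∘ suc)

∧-true : ∀ {a b} → a ∧ b ≡ true → a ≡ true × b ≡ true
∧-true {true} {true} _ = refl , refl

every-true : ∀ (p : Fin m → Bool) → every p ≡ true → ∀ i → p i ≡ true
every-true p h zero    = proj₁ (∧-true h)
every-true p h (suc i) = every-true (p ∘ suc) (proj₂ (∧-true {p zero} h)) i

-- D i is the set of classes still available for the vertex i.
search : (Fin m → Fin m → Bool) → (D : Fin m → Class → Bool) → (Fin m → Class) → Bool → Bool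
search {zero}  a D e ok = ok
search {suc m} a D e ok = every λ x → not (D zero x) ∨
  search (λ i j → a (suc i) (suc j)) (λ i y → D (suc i) y ∧ possible x y (a zero (suc i))) (e ∘ suc)
         (ok ∧ isYes (x ≟ᶠ e zero))

-- A consistent assignment c follows a branch that is never pruned, and at the end of every such
-- branch the search demands `ok`, the agreement with e so far.
search-sound : ∀ (a : Fin m → Fin m → Bool) {D e ok} → search a D e ok ≡ true → (c : Fin m → Class) →
  (∀ i → D i (c i) ≡ true) → (∀ i j → possible (c i) (c j) (a i j) ≡ true) →
  ok ≡ true × (∀ i → c i ≡ e i)
search-sound {zero}  a h c D✓ p✓ = h , λ ()
search-sound {suc m} a {D} {e} {ok} h c D✓ p✓ =
  let ok′ , eq = search-sound _ {D′} (∨-resolve (D✓ zero) (every-true step h (c zero))) (c ∘ suc)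
                   (λ i → cong₂ _∧_ (D✓ (suc i)) (p✓ zero (suc i))) (λ i j → p✓ (suc i) (suc j))
      ok″ , eq₀ = ∧-true {ok} ok′
  in ok″ , λ { zero → proj₁ (isYes-⇔ (c zero ≟ᶠ e zero)) eq₀ ; (suc i) → eq i }
  where
  step : Class → Bool
  step x = not (D zero x) ∨
    search (λ i j → a (suc i) (suc j)) (λ i y → D (suc i) y ∧ possible x y (a zero (suc i))) (e ∘ suc)
           (ok ∧ isYes (x ≟ᶠ e zero))
  D′ : Fin m → Class → Bool
  D′ i y = D (suc i) y ∧ possible (c zero) y (a zero (suc i))
  ∨-resolve : ∀ {a b} → a ≡ true → not a ∨ b ≡ true → b ≡ true
  ∨-resolve refl h = h

classify-par : ∀ (a : Name k) i → classify a ≡ i ↑ˡ 3 → a ≡ par i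
classify-par (par j)  i e = cong par (↑ˡ-injective 3 j i e)
classify-par (el _ t) i e with trans (≡-sym (splitAt-↑ʳ 7 3 t)) (trans (cong (splitAt 7) e) (splitAt-↑ˡ 7 i 3))
... | ()

rigid : ∀ (g : Fin 7 → Name k) → (∀ i j → nameAdj (g i) (g j) ≡ paramAdj i j) → ∀ i → g i ≡ par i
-- The first `refl` is the search itself, evaluated during type checking, with all ten classes
-- available to each of the seven vertices.
rigid g h i = classify-par (g i) i (proj₂ (search-sound paramAdj {D = λ _ _ → true} {_↑ˡ 3} {true} refl (classify ∘ g)
  (λ _ → refl) (λ i j → subst (λ b → possible (classify (g i)) (classify (g j)) b ≡ true) (h i j) (possible-nameAdj (g i) (g j)))) i)

-- Elements of an arbitrary graph, and first-order logic over them

infixr 5 _◂_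

_◂_ : (Fin 3 → A) → (Name k → A) → Name (suc k) → A
(v ◂ g) (par i)        = g (par i)
(v ◂ g) (el zero t)    = v t
(v ◂ g) (el (suc j) t) = g (el j t)

◂-cong : ∀ {v v′ : Fin 3 → A} {g g′ : Name k → A} → (∀ t → v t ≡ v′ t) → (∀ a → g a ≡ g′ a) →
         ∀ a → (v ◂ g) a ≡ (v′ ◂ g′) a
◂-cong v≡ g≡ (par i)        = g≡ (par i)
◂-cong v≡ g≡ (el zero t)    = v≡ t
◂-cong v≡ g≡ (el (suc j) t) = g≡ (el j t)

paramsOnly : (Fin 7 → A) → Name 0 → A
paramsOnly p (par i) = p i

leᵠ scᵠ btᵠ : (x y : Fin 3 → A) → QF A
leᵠ x y = edgeᵠ true (y zero) (x (suc (suc zero)))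
scᵠ x y = edgeᵠ true (x (suc zero)) (y (suc (suc zero)))
btᵠ x y = edgeᵠ true (x zero) (y (suc zero))

paramsᵠ : QF (Name k)
paramsᵠ = ⋀ᵠ λ i → ⋀ᵠ λ j → edgeᵠ (paramAdj i j) (par i) (par j)

distinct : Fin 3 → Fin 3 → Bool
distinct t t′ = not (isYes (t ≟ᶠ t′))

elemᵠ : Fin k → QF (Name k)
elemᵠ j = (⋀ᵠ λ t → ⋀ᵠ λ i → edgeᵠ (role t i) (el j t) (par i)) ∧ᵠ
          (⋀ᵠ λ t → ⋀ᵠ λ t′ → edgeᵠ (distinct t t′) (el j t) (el j t′))

-- A linear order in which nothing lies strictly between x and y when `scᵠ x y`. Existence of
-- successors and the behaviour of digits are missing because they need existential quantifiers;
-- `arithmeticᵗ` states them inside the range only.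
axiomsᵠ : (x y w : Fin 3 → A) → QF A
axiomsᵠ x y w =
  (⋀ᵠ λ t → edgeᵠ false (x t) (y t)) ∧ᵠ
  (leᵠ x y ∨ᵠ leᵠ y x) ∧ᵠ
  (leᵠ x y ∧ᵠ leᵠ y x ⇒ᵠ ⋀ᵠ λ t → eqᵠ (x t) (y t)) ∧ᵠ
  (leᵠ x y ∧ᵠ leᵠ y w ⇒ᵠ leᵠ x w) ∧ᵠ
  (scᵠ x y ⇒ᵠ leᵠ x y) ∧ᵠ
  (scᵠ x y ∧ᵠ leᵠ x w ∧ᵠ leᵠ w y ⇒ᵠ leᵠ w x ∨ᵠ leᵠ y w) ∧ᵠ
  (btᵠ x y ⇒ᵠ leᵠ x y)

theoryᵠ : QF (Name 3)
theoryᵠ = paramsᵠ ∧ᵠ elemᵠ zero ∧ᵠ elemᵠ (suc zero) ∧ᵠ elemᵠ (suc (suc zero)) ⇒ᵠ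
          axiomsᵠ (el zero) (el (suc zero)) (el (suc (suc zero)))

-- el 0 is an element between el 1 and el 2.
rangeᵠ : QF (Name 3)
rangeᵠ = elemᵠ zero ∧ᵠ leᵠ (el (suc zero)) (el zero) ∧ᵠ leᵠ (el zero) (el (suc (suc zero)))

Theory : Graph → Set
Theory G = ∀ h → Holds G theoryᵠ h

assign : ∀ k → Vec A (#Names k) → Name k → A
assign k vs = lookup vs ∘ code

pack : ∀ k → (Name k → A) → Vec A (#Names k)
pack k h = tabulate (h ∘ decode k)

assign-pack : ∀ k (h : Name k → A) a → assign k (pack k h) a ≡ h a
assign-pack k h a = trans (lookup∘tabulate (h ∘ decode k) (code a)) (cong h (decode-code a))

localᵛ : ∀ n → Name k → Fin (#Names k + n)
localᵛ n a = code a ↑ˡ n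

extends-localᵛ : ∀ k {m} (vs : Vec (Fin m) (#Names k)) {ρ : Fin n → Fin m} a →
                 extends vs ρ (localᵛ n a) ≡ assign k vs a
extends-localᵛ k vs a = extends-↑ˡ vs (code a)

theory : Sentence
theory = alls (#Names 3) (nnf (localᵛ 0) true theoryᵠ)

Universal-theory : Universal theory
Universal-theory = Universal-alls (#Names 3) (Universal-nnf (localᵛ 0) true theoryᵠ)

⊨-theory : ∀ G → (G ⊨ theory) ⇔ Theory G
⊨-theory G = to , from
  where
  to : G ⊨ theory → Theory G
  to h f = Holds-cong G theoryᵠ (extends (pack 3 f) noVar ∘ localᵛ 0) f
             (λ a → trans (extends-localᵛ 3 (pack 3 f) a) (assign-pack 3 f a))
             (proj₁ (Sat-nnf (localᵛ 0) G theoryᵠ (extends {n = 0} (pack 3 f) noVar))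
               (proj₁ (Sat-alls G (#Names 3) (nnf (localᵛ 0) true theoryᵠ) {ρ = noVar}) h (pack 3 f)))
  from : Theory G → G ⊨ theory
  from h = proj₂ (Sat-alls G (#Names 3) (nnf (localᵛ 0) true theoryᵠ)) λ vs →
    proj₂ (Sat-nnf (localᵛ 0) G theoryᵠ (extends vs noVar)) (h (extends vs noVar ∘ localᵛ 0))

elements : ∀ G → (Name 2 → Vertex G) → Structure
elements G g = record
  { Carrier = Σ (Fin 3 → Vertex G) λ v → Holds G rangeᵠ (v ◂ g)
  ; Le = λ (x , _) (y , _) → Holds G (leᵠ x y) id
  ; Sc = λ (x , _) (y , _) → Holds G (scᵠ x y) id
  ; Bt = λ (x , _) (y , _) → Holds G (btᵠ x y) id }

inRange : (Name 2 → Fin n) → Formula (3 + n)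
inRange {n} base = nnf ((_↑ˡ n) ◂ (λ a → 3 ↑ʳ base a)) true rangeᵠ

-- A three-dimensional interpretation: each quantifier becomes three, relativised to the elements
-- between the two bounds.
tr : (Name 2 → Fin n) → (Fin j → Fin 3 → Fin n) → TF j → Formula n
tr base X (leᵗ x y) = nnf id true (leᵠ (X x) (X y))
tr base X (scᵗ x y) = nnf id true (scᵠ (X x) (X y))
tr base X (btᵗ x y) = nnf id true (btᵠ (X x) (X y))
tr base X (¬ᵗ θ)    = neg (tr base X θ)
tr base X (θ ∧ᵗ η)  = and (tr base X θ) (tr base X η)
tr base X (θ ∨ᵗ η)  = or (tr base X θ) (tr base X η)
tr base X (θ ⇒ᵗ η)  = or (neg (tr base X θ)) (tr base X η)
tr {n} base X (∀ᵗ θ) =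
  alls 3 (or (neg (inRange base)) (tr (λ a → 3 ↑ʳ base a) ((_↑ˡ n) ▹ (λ i t → 3 ↑ʳ X i t)) θ))
tr {n} base X (∃ᵗ θ) =
  exs 3 (and (inRange base) (tr (λ a → 3 ↑ʳ base a) ((_↑ˡ n) ▹ (λ i t → 3 ↑ʳ X i t)) θ))

module _ (G : Graph) (g : Name 2 → Vertex G) where

  extends-range : ∀ (vs : Vec (Vertex G) 3) {base : Name 2 → Fin n} {ρ : Fin n → Vertex G} → (∀ a → ρ (base a) ≡ g a) →
                  ∀ a → extends vs ρ (((_↑ˡ n) ◂ (λ a → 3 ↑ʳ base a)) a) ≡ (lookup vs ◂ g) a
  extends-range vs b≡ (par i)        = trans (extends-↑ʳ vs _) (b≡ (par i))
  extends-range vs b≡ (el zero t)    = extends-↑ˡ vs t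
  extends-range vs b≡ (el (suc j) t) = trans (extends-↑ʳ vs _) (b≡ (el j t))

  Sat-inRange : ∀ (vs : Vec (Vertex G) 3) (base : Name 2 → Fin n) (ρ : Fin n → Vertex G) → (∀ a → ρ (base a) ≡ g a) →
                Sat G (inRange base) (extends vs ρ) ⇔ Holds G rangeᵠ (lookup vs ◂ g)
  Sat-inRange {n} vs base ρ b≡ = ⇔-trans (Sat-nnf var G rangeᵠ (extends vs ρ))
    (Holds-cong G rangeᵠ (extends vs ρ ∘ var) (lookup vs ◂ g) (extends-range vs {base} {ρ} b≡) ,
     Holds-cong G rangeᵠ (lookup vs ◂ g) (extends vs ρ ∘ var) (≡-sym ∘ extends-range vs {base} {ρ} b≡))
    where
    var : Name 3 → Fin (3 + n)
    var = (_↑ˡ n) ◂ (λ a → 3 ↑ʳ base a)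

  range-tabulate : ∀ v → Holds G rangeᵠ (v ◂ g) → Holds G rangeᵠ (lookup (tabulate v) ◂ g)
  range-tabulate v = Holds-cong G rangeᵠ (v ◂ g) (lookup (tabulate v) ◂ g) (◂-cong (≡-sym ∘ lookup∘tabulate v) (λ _ → refl))

  Sat-tr : ∀ (θ : TF j) {base : Name 2 → Fin n} {X : Fin j → Fin 3 → Fin n} {ρ : Fin n → Vertex G} {σ} →
           (∀ a → ρ (base a) ≡ g a) → (∀ i t → ρ (X i t) ≡ proj₁ (σ i) t) →
           Sat G (tr base X θ) ρ ⇔ TSat (elements G g) θ σ
  Sat-tr (leᵗ x y) b≡ X≡ = subst (_≡ true) e , subst (_≡ true) (≡-sym e)
    where e = cong₂ (adj G) (X≡ y zero) (X≡ x (suc (suc zero)))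
  Sat-tr (scᵗ x y) b≡ X≡ = subst (_≡ true) e , subst (_≡ true) (≡-sym e)
    where e = cong₂ (adj G) (X≡ x (suc zero)) (X≡ y (suc (suc zero)))
  Sat-tr (btᵗ x y) b≡ X≡ = subst (_≡ true) e , subst (_≡ true) (≡-sym e)
    where e = cong₂ (adj G) (X≡ x zero) (X≡ y (suc zero))
  Sat-tr (¬ᵗ θ)   b≡ X≡ = let f , f⁻ = Sat-tr θ b≡ X≡ in _∘ f⁻ , _∘ f
  Sat-tr (θ ∧ᵗ η) b≡ X≡ = let f , f⁻ = Sat-tr θ b≡ X≡ ; h , h⁻ = Sat-tr η b≡ X≡ in
    (λ (a , b) → f a , h b) , λ (a , b) → f⁻ a , h⁻ b
  Sat-tr (θ ∨ᵗ η) b≡ X≡ = let f , f⁻ = Sat-tr θ b≡ X≡ ; h , h⁻ = Sat-tr η b≡ X≡ in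
    [ inj₁ ∘ f , inj₂ ∘ h ]′ , [ inj₁ ∘ f⁻ , inj₂ ∘ h⁻ ]′
  Sat-tr (θ ⇒ᵗ η) {base} {X} {ρ} b≡ X≡ =
    let f , f⁻ = Sat-tr θ b≡ X≡ ; h , h⁻ = Sat-tr η b≡ X≡ ; i , i⁻ = ¬⊎⇔→ (Sat? G (tr base X θ) ρ) in
    (λ s → h ∘ i s ∘ f⁻) , λ t → i⁻ (h⁻ ∘ t ∘ f)
  Sat-tr {j} {n} (∀ᵗ θ) {base} {X} {ρ} {σ} b≡ X≡ = to , from
    where
    X′ : Fin (suc j) → Fin 3 → Fin (3 + n)
    X′ = (_↑ˡ n) ▹ (λ i t → 3 ↑ʳ X i t)
    body = or (neg (inRange base)) (tr (λ a → 3 ↑ʳ base a) X′ θ)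
    module At (vs : Vec (Vertex G) 3) (v : Carrier (elements G g)) (v≡ : ∀ t → lookup vs t ≡ proj₁ v t) where
      IH : Sat G (tr (λ a → 3 ↑ʳ base a) X′ θ) (extends vs ρ) ⇔ TSat (elements G g) θ (v ▹ σ)
      IH = Sat-tr θ {ρ = extends vs ρ} (λ a → trans (extends-↑ʳ vs (base a)) (b≡ a))
        λ { zero t → trans (extends-↑ˡ vs t) (v≡ t) ; (suc i) t → trans (extends-↑ʳ vs (X i t)) (X≡ i t) }
    to : Sat G (tr base X (∀ᵗ θ)) ρ → TSat (elements G g) (∀ᵗ θ) σ
    to h (v , r) = [ (λ ¬r → ⊥-elim (¬r (proj₂ (Sat-inRange (tabulate v) base ρ b≡) (range-tabulate v r)))) ,
                     proj₁ (At.IH (tabulate v) (v , r) (lookup∘tabulate v)) ]′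
                   (proj₁ (Sat-alls G 3 body) h (tabulate v))
    from : TSat (elements G g) (∀ᵗ θ) σ → Sat G (tr base X (∀ᵗ θ)) ρ
    from t = proj₂ (Sat-alls G 3 body) λ vs → proj₂ (¬⊎⇔→ (Sat? G (inRange base) (extends vs ρ))) λ r →
      let v = lookup vs , proj₁ (Sat-inRange vs base ρ b≡) r in proj₂ (At.IH vs v (λ _ → refl)) (t v)
  Sat-tr {j} {n} (∃ᵗ θ) {base} {X} {ρ} {σ} b≡ X≡ = to , from
    where
    X′ : Fin (suc j) → Fin 3 → Fin (3 + n)
    X′ = (_↑ˡ n) ▹ (λ i t → 3 ↑ʳ X i t)
    body = and (inRange base) (tr (λ a → 3 ↑ʳ base a) X′ θ)
    module At (vs : Vec (Vertex G) 3) (v : Carrier (elements G g)) (v≡ : ∀ t → lookup vs t ≡ proj₁ v t) where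
      IH : Sat G (tr (λ a → 3 ↑ʳ base a) X′ θ) (extends vs ρ) ⇔ TSat (elements G g) θ (v ▹ σ)
      IH = Sat-tr θ {ρ = extends vs ρ} (λ a → trans (extends-↑ʳ vs (base a)) (b≡ a))
        λ { zero t → trans (extends-↑ˡ vs t) (v≡ t) ; (suc i) t → trans (extends-↑ʳ vs (X i t)) (X≡ i t) }
    to : Sat G (tr base X (∃ᵗ θ)) ρ → TSat (elements G g) (∃ᵗ θ) σ
    to h = let vs , r , h′ = proj₁ (Sat-exs G 3 body) h ; v = lookup vs , proj₁ (Sat-inRange vs base ρ b≡) r in
      v , proj₁ (At.IH vs v (λ _ → refl)) h′
    from : TSat (elements G g) (∃ᵗ θ) σ → Sat G (tr base X (∃ᵗ θ)) ρ
    from ((v , r) , t) = proj₂ (Sat-exs G 3 body) (tabulate v ,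
      proj₂ (Sat-inRange (tabulate v) base ρ b≡) (range-tabulate v r) ,
      proj₂ (At.IH (tabulate v) (v , r) (lookup∘tabulate v)) t)

-- Successor chains in graphs that satisfy the theory

LeV ScV BtV MemV : ∀ G → (x y : Fin 3 → Vertex G) → Set
LeV G x y = adj G (y zero) (x (suc (suc zero))) ≡ true
ScV G x y = adj G (x (suc zero)) (y (suc (suc zero))) ≡ true
BtV G x y = adj G (x zero) (y (suc zero)) ≡ true
MemV G x y = BtV G x y × ¬ LeV G y x

IsElem : ∀ G (p : Fin 7 → Vertex G) → (Fin 3 → Vertex G) → Set
IsElem G p x = Holds G (elemᵠ zero) (x ◂ paramsOnly p)

IsParams : ∀ G (p : Fin 7 → Vertex G) → Set
IsParams G p = ∀ i j → adj G (p i) (p j) ≡ paramAdj i j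

module Ordered (G : Graph) (th : Theory G) (p : Fin 7 → Vertex G) (α : IsParams G p) where

  private
    Elem = IsElem G p
    _≤ᵛ_ = LeV G

    axioms : ∀ {x y w} → Elem x → Elem y → Elem w → Holds G (axiomsᵠ x y w) id
    axioms {x} {y} {w} e₁ e₂ e₃ = th (x ◂ y ◂ w ◂ paramsOnly p) (α , e₁ , e₂ , e₃)

  independent : ∀ {x y} → Elem x → Elem y → ∀ t → adj G (x t) (y t) ≡ false
  independent e₁ e₂ = proj₁ (axioms e₁ e₂ e₂)

  total : ∀ {x y} → Elem x → Elem y → x ≤ᵛ y ⊎ y ≤ᵛ x
  total e₁ e₂ = proj₁ (proj₂ (axioms e₁ e₂ e₂))

  antisymmetric : ∀ {x y} → Elem x → Elem y → x ≤ᵛ y → y ≤ᵛ x → ∀ t → x t ≡ y t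
  antisymmetric e₁ e₂ l l′ = proj₁ (proj₂ (proj₂ (axioms e₁ e₂ e₂))) (l , l′)

  transitive : ∀ {x y w} → Elem x → Elem y → Elem w → x ≤ᵛ y → y ≤ᵛ w → x ≤ᵛ w
  transitive e₁ e₂ e₃ l l′ = proj₁ (proj₂ (proj₂ (proj₂ (axioms e₁ e₂ e₃)))) (l , l′)

  Sc⇒Le : ∀ {x y} → Elem x → Elem y → ScV G x y → x ≤ᵛ y
  Sc⇒Le e₁ e₂ = proj₁ (proj₂ (proj₂ (proj₂ (proj₂ (axioms e₁ e₂ e₂)))))

  between : ∀ {x y w} → Elem x → Elem y → Elem w → ScV G x y → x ≤ᵛ w → w ≤ᵛ y → w ≤ᵛ x ⊎ y ≤ᵛ w
  between e₁ e₂ e₃ s l l′ = proj₁ (proj₂ (proj₂ (proj₂ (proj₂ (proj₂ (axioms e₁ e₂ e₃)))))) (s , l , l′)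

  Bt⇒Le : ∀ {x y} → Elem x → Elem y → BtV G x y → x ≤ᵛ y
  Bt⇒Le e₁ e₂ = proj₂ (proj₂ (proj₂ (proj₂ (proj₂ (proj₂ (axioms e₁ e₂ e₂))))))

  reflexive : ∀ {x} → Elem x → x ≤ᵛ x
  reflexive (_ , d) = d zero (suc (suc zero))

  module Chain (e : ℕ → Fin 3 → Vertex G) (N : ℕ) (elem : ∀ {i} → i ≤ N → Elem (e i))
               (sc : ∀ {i} → i < N → ScV G (e i) (e (suc i))) where

    -- Climb the chain while it stays below v. If v falls between two consecutive members, `between`
    -- and antisymmetry identify it with one of them.
    covers : ∀ {v} → Elem v → e 0 ≤ᵛ v → v ≤ᵛ e N → Σ ℕ λ i → i ≤ N × (∀ t → v t ≡ e i t)
    covers {v} ev l₀ lN =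
      [ (λ l → N , ≤-refl , antisymmetric ev (elem ≤-refl) lN l) , id ]′ (go N ≤-refl)
      where
      go : ∀ m → m ≤ N → e m ≤ᵛ v ⊎ (Σ ℕ λ i → i ≤ N × (∀ t → v t ≡ e i t))
      go zero    _ = inj₁ l₀
      go (suc m) m<N with go m (<⇒≤ m<N)
      ... | inj₂ found = inj₂ found
      ... | inj₁ l with total (elem m<N) ev
      ...   | inj₁ l′ = inj₁ l′
      ...   | inj₂ l′ with between (elem (<⇒≤ m<N)) (elem m<N) ev (sc m<N) l l′
      ...     | inj₁ l″ = inj₂ (m , <⇒≤ m<N , antisymmetric ev (elem (<⇒≤ m<N)) l″ l)
      ...     | inj₂ l″ = inj₁ l″

    module Strict (lt : ∀ {i} → i < N → ¬ (e (suc i) ≤ᵛ e i)) where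

      monotone : ∀ {i j} → i ≤′ j → j ≤ N → e i ≤ᵛ e j
      monotone (≤′-reflexive refl) j≤N = reflexive (elem j≤N)
      monotone (≤′-step i≤j) j<N =
        transitive (elem (≤-trans (≤′⇒≤ i≤j) (<⇒≤ j<N))) (elem (<⇒≤ j<N)) (elem j<N)
                   (monotone i≤j (<⇒≤ j<N)) (Sc⇒Le (elem (<⇒≤ j<N)) (elem j<N) (sc j<N))

      strict : ∀ {i j} → i < j → j ≤ N → ¬ (e j ≤ᵛ e i)
      strict i<j j≤N l = lt (<-≤-trans i<j j≤N)
        (transitive (elem (≤-trans i<j j≤N)) (elem j≤N) (elem (≤-trans (<⇒≤ i<j) j≤N)) (monotone (≤⇒≤′ i<j) j≤N) l)

      Le-⇔ : ∀ {i j} → i ≤ N → j ≤ N → (e i ≤ᵛ e j) ⇔ (i ≤ j)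
      Le-⇔ i≤N j≤N = (λ l → ≮⇒≥ λ j<i → strict j<i i≤N l) , λ i≤j → monotone (≤⇒≤′ i≤j) j≤N

      Sc-⇔ : ∀ {i j} → i ≤ N → j ≤ N → ScV G (e i) (e j) ⇔ (j ≡ i ⊎ j ≡ suc i)
      Sc-⇔ {i} {j} i≤N j≤N = to , from
        where
        to : ScV G (e i) (e j) → j ≡ i ⊎ j ≡ suc i
        to s with proj₁ (Le-⇔ i≤N j≤N) (Sc⇒Le (elem i≤N) (elem j≤N) s)
        ... | i≤j with m≤n⇒m<n∨m≡n i≤j
        ...   | inj₂ i≡j = inj₁ (≡-sym i≡j)
        ...   | inj₁ i<j with m≤n⇒m<n∨m≡n i<j
        ...     | inj₂ e = inj₂ (≡-sym e)
        ...     | inj₁ si<j with between (elem i≤N) (elem j≤N) (elem (≤-trans i<j j≤N)) s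
                                   (monotone (≤′-step (≤′-reflexive refl)) (≤-trans i<j j≤N)) (monotone (≤⇒≤′ i<j) j≤N)
        ...       | inj₁ l = ⊥-elim (lt (<-≤-trans i<j j≤N) l)
        ...       | inj₂ l = ⊥-elim (strict si<j j≤N l)
        from : j ≡ i ⊎ j ≡ suc i → ScV G (e i) (e j)
        from (inj₁ refl) = proj₂ (elem i≤N) (suc zero) (suc (suc zero))
        from (inj₂ refl) = sc j≤N

      -- The counterpart of `Inc` in the graph: passing from e k to its successor carries into e i.
      record IncAt (k i : ℕ) : Set where
        field
          index≤ : i ≤ N
          oldAt   : ¬ MemV G (e i) (e k)
          belowAt : ∀ {j} → j ≤ N → ¬ (e i ≤ᵛ e j) → MemV G (e j) (e k) × ¬ MemV G (e j) (e (suc k))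
          newAt   : MemV G (e i) (e (suc k))
          aboveAt : ∀ {j} → j ≤ N → ¬ (e j ≤ᵛ e i) → MemV G (e j) (e k) ⇔ MemV G (e j) (e (suc k))
      open IncAt

      module Digits (inc : ∀ {k} → k < N → Σ ℕ (IncAt k)) where

        -- Nothing lies strictly below e 0, so it has no members. In the step, the carry position is
        -- the least nonmember of k, both in the graph and in ℕ, so the two positions coincide; the
        -- increment clauses then fix the members of `suc k`.
        mem-⇔ : ∀ k → k ≤ N → ∀ {j} → j ≤ N → MemV G (e j) (e k) ⇔ (j ∈ᵇ k)
        mem-⇔ zero    _ j≤N = (λ (_ , ≰) → ⊥-elim (≰ (monotone (≤⇒≤′ z≤n) j≤N))) , λ ()
        mem-⇔ (suc k) k<N {j} j≤N with inc k<N | Inc-digit k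
        ... | i′ , A | i , I = main (<-cmp j i)
          where
          IH : ∀ {j} → j ≤ N → MemV G (e j) (e k) ⇔ (j ∈ᵇ k)
          IH = mem-⇔ k (<⇒≤ k<N)
          i≤N : i ≤ N
          i≤N = ≤-trans (<⇒≤ (∈ᵇ⇒< (suc k) (new I))) k<N
          i≡i′ : i ≡ i′
          i≡i′ with <-cmp i i′
          ... | tri≈ _ eq _ = eq
          ... | tri< i<i′ _ _ = ⊥-elim (true≢false (proj₁ (IH i≤N) (proj₁ (belowAt A i≤N (strict i<i′ (index≤ A))))) (old I))
          ... | tri> _ _ i′<i = ⊥-elim (oldAt A (proj₂ (IH (index≤ A)) (ones I i′<i)))
          A′ : IncAt k i
          A′ = subst (IncAt k) (≡-sym i≡i′) A
          main : _ → MemV G (e j) (e (suc k)) ⇔ (j ∈ᵇ suc k)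
          main (tri< j<i _ _) =
            (λ mem → ⊥-elim (proj₂ (belowAt A′ j≤N (strict j<i i≤N)) mem)) ,
            λ j∈ → ⊥-elim (true≢false j∈ (zeros I j<i))
          main (tri≈ _ refl _) = (λ _ → new I) , λ _ → newAt A′
          main (tri> _ _ i<j) =
            let f , f⁻ = aboveAt A′ j≤N (strict i<j j≤N) ; h , h⁻ = IH j≤N in
            (λ mem → trans (same I i<j) (h (f⁻ mem))) , λ j∈ → f (h⁻ (trans (≡-sym (same I i<j)) j∈))

        Bt-⇔ : ∀ {i j} → i ≤ N → j ≤ N → BtV G (e i) (e j) ⇔ (i ≡ j ⊎ i ∈ᵇ j)
        Bt-⇔ {i} {j} i≤N j≤N = to , from
          where
          to : BtV G (e i) (e j) → i ≡ j ⊎ i ∈ᵇ j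
          to b with m≤n⇒m<n∨m≡n (proj₁ (Le-⇔ i≤N j≤N) (Bt⇒Le (elem i≤N) (elem j≤N) b))
          ... | inj₂ eq = inj₁ eq
          ... | inj₁ i<j = inj₂ (proj₁ (mem-⇔ j j≤N i≤N) (b , strict i<j j≤N))
          from : i ≡ j ⊎ i ∈ᵇ j → BtV G (e i) (e j)
          from (inj₁ refl) = proj₂ (elem i≤N) zero (suc zero)
          from (inj₂ i∈)   = proj₁ (proj₂ (mem-⇔ j j≤N i≤N) i∈)

        adj-link : ∀ {i j} → i ≤ N → j ≤ N → ∀ t t′ → adj G (e i t) (e j t′) ≡ link t t′ i j
        adj-link i≤N j≤N zero             zero             = independent (elem i≤N) (elem j≤N) zero
        adj-link i≤N j≤N zero             (suc zero)       = ≡-isYes (Bt? _ _) (Bt-⇔ i≤N j≤N)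
        adj-link i≤N j≤N zero             (suc (suc zero)) = ≡-isYes (_ ≤? _) (Le-⇔ j≤N i≤N)
        adj-link i≤N j≤N (suc zero)       zero             = trans (Graph.sym G _ _) (≡-isYes (Bt? _ _) (Bt-⇔ j≤N i≤N))
        adj-link i≤N j≤N (suc zero)       (suc zero)       = independent (elem i≤N) (elem j≤N) (suc zero)
        adj-link i≤N j≤N (suc zero)       (suc (suc zero)) = ≡-isYes (Sc? _ _) (Sc-⇔ i≤N j≤N)
        adj-link i≤N j≤N (suc (suc zero)) zero             = trans (Graph.sym G _ _) (≡-isYes (_ ≤? _) (Le-⇔ i≤N j≤N))
        adj-link i≤N j≤N (suc (suc zero)) (suc zero)       = trans (Graph.sym G _ _) (≡-isYes (Sc? _ _) (Sc-⇔ j≤N i≤N))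
        adj-link i≤N j≤N (suc (suc zero)) (suc (suc zero)) = independent (elem i≤N) (elem j≤N) (suc (suc zero))

-- Arithmetic axioms and standard copies

successorsᵗ incrementsᵗ : TF n
successorsᵗ = ∀ᵗ ((∀ᵗ leᵗ zero (suc zero)) ∨ᵗ (∃ᵗ succᵗ (suc zero) zero))
incrementsᵗ = ∀ᵗ ∀ᵗ (succᵗ (suc zero) zero ⇒ᵗ ∃ᵗ (
  ¬ᵗ memᵗ zero (suc (suc zero)) ∧ᵗ
  (∀ᵗ (ltᵗ zero (suc zero) ⇒ᵗ memᵗ zero (suc (suc (suc zero))) ∧ᵗ ¬ᵗ memᵗ zero (suc (suc zero)))) ∧ᵗ
  memᵗ zero (suc zero) ∧ᵗ
  (∀ᵗ (ltᵗ (suc zero) zero ⇒ᵗ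
    (memᵗ zero (suc (suc (suc zero))) ⇒ᵗ memᵗ zero (suc (suc zero))) ∧ᵗ
    (memᵗ zero (suc (suc zero)) ⇒ᵗ memᵗ zero (suc (suc (suc zero))))))))

arithmeticᵗ : TF n
arithmeticᵗ = successorsᵗ ∧ᵗ incrementsᵗ

𝔑-arithmetic : ∀ N {ρ : Fin n → Fin (suc N)} → TSat (𝔑 N) arithmeticᵗ ρ
𝔑-arithmetic {n} N {ρ} = successors , increments
  where
  successors : TSat (𝔑 N) successorsᵗ ρ
  successors x with m≤n⇒m<n∨m≡n (toℕ≤ x)
  ... | inj₂ x≡N = inj₁ λ y → subst (toℕ y ≤_) (≡-sym x≡N) (toℕ≤ y)
  ... | inj₁ x<N = inj₂ (fin x<N , proj₂ (succᵗ-suc {ρ = fin x<N ▹ x ▹ ρ} (suc zero) zero) (toℕ-fin x<N))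
  increments : TSat (𝔑 N) incrementsᵗ ρ
  increments x y xy with proj₁ (succᵗ-suc {ρ = y ▹ x ▹ ρ} (suc zero) zero) xy | Inc-digit (toℕ x)
  ... | y≡ | i , I = I′ , (λ m → true≢false (∈x I′ m) (subst (λ i → digit (toℕ x) i ≡ false) (≡-sym i≡) (old I))) ,
      (λ j j<i → let j<i′ = subst (toℕ j <_) i≡ (≰⇒> j<i) in
         x∋ j (ones I j<i′) , λ m → true≢false (∈y j m) (zeros I j<i′)) ,
      y∋ I′ (subst (_∈ᵇ suc (toℕ x)) (≡-sym i≡) (new I)) ,
      λ j i<j → let i<j′ = subst (_< toℕ j) i≡ (≰⇒> i<j) in
         (λ m → y∋ j (trans (same I i<j′) (∈x j m))) , λ m → x∋ j (trans (≡-sym (same I i<j′)) (∈y j m))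
    where
    i≤N : i ≤ N
    i≤N = ≤-trans (s≤s⁻¹ (∈ᵇ⇒< (suc (toℕ x)) (new I))) (toℕ≤ x)
    I′ : Fin (suc N)
    I′ = fin i≤N
    i≡ : toℕ I′ ≡ i
    i≡ = toℕ-fin i≤N
    mem : ∀ (a b : Fin (suc N)) → TSat (𝔑 N) (memᵗ zero (suc zero)) (a ▹ b ▹ ρ) ⇔ (toℕ a ∈ᵇ toℕ b)
    mem a b = memᵗ-∈ᵇ {ρ = a ▹ b ▹ ρ} zero (suc zero)
    ∈x = λ j → proj₁ (mem j x)
    x∋ = λ j → proj₂ (mem j x)
    ∈y = λ j m → subst (toℕ j ∈ᵇ_) y≡ (proj₁ (mem j y) m)
    y∋ = λ j m → proj₂ (mem j y) (subst (toℕ j ∈ᵇ_) (≡-sym y≡) m)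

-- The elements of G between those named by g form a copy of a standard structure.
record Standard (G : Graph) (g : Name 2 → Vertex G) (N : ℕ) : Set where
  field
    names : Name (suc N) → Vertex G
    copy  : Copy G names
    par≡  : ∀ i → names (par i) ≡ g (par i)
    first : ∀ t → names (el zero t) ≡ g (el zero t)
    last  : ∀ t → names (el (fromℕ N) t) ≡ g (el (suc zero) t)
open Standard

module _ (G : Graph) (th : Theory G) (g : Name 2 → Vertex G) (α : IsParams G (g ∘ par)) where

  open Ordered G th (g ∘ par) α

  private
    𝔐 = elements G g
    low high : Fin 3 → Vertex G
    low = λ t → g (el zero t)
    high = λ t → g (el (suc zero) t)

  module _ (low∈ : Holds G rangeᵠ (low ◂ g)) (high∈ : Holds G rangeᵠ (high ◂ g))
           {σ : Fin n → Carrier 𝔐} (ax : TSat 𝔐 arithmeticᵗ σ) where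

    private
      Top : Carrier 𝔐 → Set
      Top x = ∀ y → Le 𝔐 y x

      Succ : Carrier 𝔐 → Carrier 𝔐 → Set
      Succ x y = Sc 𝔐 x y × ¬ Le 𝔐 y x

      successor : ∀ x → Top x ⊎ Σ (Carrier 𝔐) (Succ x)
      successor = proj₁ ax

      next : Carrier 𝔐 → Carrier 𝔐
      -- At a greatest element the value x is a default; the chain is used only up to the first
      -- greatest element.
      next x = [ (λ _ → x) , proj₁ ]′ (successor x)

      next-Succ : ∀ x → Top x ⊎ Succ x (next x)
      next-Succ x with successor x
      ... | inj₁ top     = inj₁ top
      ... | inj₂ (_ , s) = inj₂ s

      eᶜ : ℕ → Carrier 𝔐
      eᶜ zero    = low , low∈
      eᶜ (suc i) = next (eᶜ i)

      e : ℕ → Fin 3 → Vertex G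
      e i = proj₁ (eᶜ i)

      elem : ∀ i → IsElem G (g ∘ par) (e i)
      elem i = proj₁ (proj₂ (eᶜ i))

      Steps : ℕ → Set
      Steps N = ∀ {i} → i < N → Succ (eᶜ i) (eᶜ (suc i))

      scan : ∀ m → (Σ ℕ λ N → Top (eᶜ N) × Steps N) ⊎ Steps m
      scan zero = inj₂ λ ()
      scan (suc m) with scan m
      ... | inj₁ found = inj₁ found
      ... | inj₂ steps with next-Succ (eᶜ m)
      ...   | inj₁ top = inj₁ (m , top , steps)
      ...   | inj₂ s   = inj₂ λ { (s≤s i≤m) → [ steps , (λ { refl → s }) ]′ (m≤n⇒m<n∨m≡n i≤m) }

      -- A strictly increasing chain longer than the number of vertices is impossible.
      stops : Σ ℕ λ N → Top (eᶜ N) × Steps N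
      stops with scan (size G)
      ... | inj₁ found = found
      ... | inj₂ steps with pigeonhole (n<1+n (size G)) (λ i → e (toℕ i) zero)
      ...   | i , i′ , i<i′ , same-vertex =
        ⊥-elim (strict i<i′ (s≤s⁻¹ (toℕ<n i′)) (subst (λ v → adj G v (e (toℕ i′) (suc (suc zero))) ≡ true)
                                           (≡-sym same-vertex) (reflexive (elem (toℕ i′)))))
        where
        open Chain e (size G) (λ {i} _ → elem i) (proj₁ ∘ steps)
        open Strict (proj₂ ∘ steps)

    -- The successors of `low` end at a greatest element because G is finite, and this is `high` by
    -- antisymmetry. Along the chain the axioms leave no freedom for any adjacency.
    standard : Σ ℕ (Standard G g)
    standard with stops
    ... | N , top , steps = N , record
      { names = names′ ; copy = copy′ ; par≡ = λ _ → refl ; first = λ _ → refl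
      ; last = λ t → trans (cong (λ i → e i t) (toℕ-fromℕ N)) (last′ t) }
      where
      open Chain e N (λ {i} _ → elem i) (proj₁ ∘ steps)
      open Strict (proj₂ ∘ steps)

      index : ∀ x → Σ ℕ λ i → i ≤ N × (∀ t → proj₁ x t ≡ e i t)
      index x@(_ , el∈ , low≤ , _) = covers el∈ low≤ (top x)

      inc : ∀ {k} → k < N → Σ ℕ (IncAt k)
      inc {k} k<N with proj₂ ax (eᶜ k) (eᶜ (suc k)) (steps k<N)
      ... | i , old′ , below , new′ , above with index i
      ...   | i′ , i′≤N , i≡ = i′ , record
        { index≤ = i′≤N
        ; oldAt = λ m → old′ (mem⁻ {e k} m)
        ; belowAt = λ {j} _ j<i → below (eᶜ j) λ l → j<i (subst (λ v → adj G (e j zero) v ≡ true) (i≡ (suc (suc zero))) l)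
        ; newAt = mem⁺ {e (suc k)} new′
        ; aboveAt = λ {j} _ i<j → above (eᶜ j) λ l → i<j (subst (λ v → adj G v (e j (suc (suc zero))) ≡ true) (i≡ zero) l) }
        where
        mem⁺ : ∀ {y} → MemV G (proj₁ i) y → MemV G (e i′) y
        mem⁺ {y} (b , ≰) = subst (λ v → adj G v (y (suc zero)) ≡ true) (i≡ zero) b ,
                           λ l → ≰ (subst (λ v → adj G v (y (suc (suc zero))) ≡ true) (≡-sym (i≡ zero)) l)
        mem⁻ : ∀ {y} → MemV G (e i′) y → MemV G (proj₁ i) y
        mem⁻ {y} (b , ≰) = subst (λ v → adj G v (y (suc zero)) ≡ true) (≡-sym (i≡ zero)) b ,
                           λ l → ≰ (subst (λ v → adj G v (y (suc (suc zero))) ≡ true) (i≡ zero) l)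

      open Digits inc

      names′ : Name (suc N) → Vertex G
      names′ (par i)  = g (par i)
      names′ (el i t) = e (toℕ i) t

      copy′ : Copy G names′
      copy′ (par i)  (par j)   = α i j
      copy′ (par i)  (el j t)  = trans (Graph.sym G _ _) (proj₁ (elem (toℕ j)) t i)
      copy′ (el j t) (par i)   = proj₁ (elem (toℕ j)) t i
      copy′ (el i t) (el j t′) = adj-link (toℕ≤ i) (toℕ≤ j) t t′

      last′ : ∀ t → e N t ≡ high t
      last′ = antisymmetric (elem N) (proj₁ high∈) (proj₂ (proj₂ (proj₂ (eᶜ N)))) (top (high , high∈))

  module _ {N} (st : Standard G g N) where

    private
      c : Fin (suc N) → Fin 3 → Vertex G
      c i t = names st (el i t)

    link-refl : ∀ t t′ i → link t t′ i i ≡ distinct t t′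
    link-refl zero             zero             i = refl
    link-refl zero             (suc zero)       i = proj₂ (isYes-⇔ (Bt? i i)) (inj₁ refl)
    link-refl zero             (suc (suc zero)) i = proj₂ (isYes-⇔ (i ≤? i)) ≤-refl
    link-refl (suc zero)       zero             i = proj₂ (isYes-⇔ (Bt? i i)) (inj₁ refl)
    link-refl (suc zero)       (suc zero)       i = refl
    link-refl (suc zero)       (suc (suc zero)) i = proj₂ (isYes-⇔ (Sc? i i)) (inj₁ refl)
    link-refl (suc (suc zero)) zero             i = proj₂ (isYes-⇔ (i ≤? i)) ≤-refl
    link-refl (suc (suc zero)) (suc zero)       i = proj₂ (isYes-⇔ (Sc? i i)) (inj₁ refl)
    link-refl (suc (suc zero)) (suc (suc zero)) i = refl

    isElem : ∀ i → IsElem G (g ∘ par) (c i)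
    isElem i = (λ t l → trans (cong (adj G (c i t)) (≡-sym (par≡ st l))) (copy st (el i t) (par l))) ,
               λ t t′ → trans (copy st (el i t) (el i t′)) (link-refl t t′ (toℕ i))

    Le-c : ∀ i j → LeV G (c i) (c j) ⇔ (toℕ i ≤ toℕ j)
    Le-c i j rewrite copy st (el j zero) (el i (suc (suc zero))) = isYes-⇔ (toℕ i ≤? toℕ j)

    inRange-c : ∀ i → Holds G rangeᵠ (c i ◂ g)
    inRange-c i = isElem i ,
      subst (λ v → adj G (c i zero) v ≡ true) (first st (suc (suc zero))) (proj₂ (Le-c zero i) z≤n) ,
      subst (λ v → adj G v (c i (suc (suc zero))) ≡ true) (last st zero)
        (proj₂ (Le-c i (fromℕ N)) (subst (toℕ i ≤_) (≡-sym (toℕ-fromℕ N)) (toℕ≤ i)))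

    -- The direction `back` rests on `covers`: G may have elements elsewhere, but none between the
    -- bounds besides those of the copy.
    similarity : Similarity (𝔑 N) (elements G g)
    similarity = record
      { _~_ = λ i (v , _) → ∀ t → v t ≡ c i t
      ; forth = λ i → (c i , inRange-c i) , λ _ → refl
      ; back = λ (_ , ev , low≤ , ≤high) → back′ ev low≤ ≤high
      ; ~-Le = λ {i} {j} v≡ w≡ → at (w≡ zero) (v≡ (suc (suc zero))) {toℕ i ≤? toℕ j} (copy st (el j zero) (el i (suc (suc zero))))
      ; ~-Sc = λ {i} {j} v≡ w≡ → at (v≡ (suc zero)) (w≡ (suc (suc zero))) {Sc? (toℕ i) (toℕ j)} (copy st (el i (suc zero)) (el j (suc (suc zero))))
      ; ~-Bt = λ {i} {j} v≡ w≡ → at (v≡ zero) (w≡ (suc zero)) {Bt? (toℕ i) (toℕ j)} (copy st (el i zero) (el j (suc zero))) }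
      where
      at : ∀ {Q : Set} {v w v′ w′} → v ≡ v′ → w ≡ w′ → {Q? : Dec Q} → adj G v′ w′ ≡ isYes Q? → Q ⇔ (adj G v w ≡ true)
      at refl refl {Q?} eq = ⇔-sym (subst (λ b → (b ≡ true) ⇔ _) (≡-sym eq) (isYes-⇔ Q?))
      -- Chains are indexed by ℕ; indices beyond N are sent to N, where nothing is claimed about
      -- them.
      clamp : ℕ → Fin (suc N)
      clamp i = fin (m⊓n≤n i N)
      toℕ-clamp : ∀ {i} → i ≤ N → toℕ (clamp i) ≡ i
      toℕ-clamp {i} i≤N = trans (toℕ-fin (m⊓n≤n i N)) (m≤n⇒m⊓n≡m i≤N)
      sc : ∀ {i} → i < N → ScV G (c (clamp i)) (c (clamp (suc i)))
      sc {i} i<N = trans (copy st (el (clamp i) (suc zero)) (el (clamp (suc i)) (suc (suc zero))))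
        (proj₂ (isYes-⇔ (Sc? _ _)) (inj₂ (trans (toℕ-clamp i<N) (cong suc (≡-sym (toℕ-clamp (<⇒≤ i<N)))))))
      back′ : ∀ {v} → IsElem G (g ∘ par) v → LeV G low v → LeV G v high → Σ (Fin (suc N)) λ i → ∀ t → v t ≡ c i t
      back′ {v} ev low≤ ≤high =
        let i , _ , v≡ = covers ev
              (subst (λ x → adj G (v zero) x ≡ true) (≡-sym (trans (cong (λ i → c i (suc (suc zero))) clamp0) (first st (suc (suc zero))))) low≤)
              (subst (λ x → adj G x (v (suc (suc zero))) ≡ true) (≡-sym (trans (cong (λ i → c i zero) clampN) (last st zero))) ≤high)
        in clamp i , v≡
        where
        open Chain (λ i → c (clamp i)) N (λ {i} _ → isElem (clamp i)) sc
        clamp0 : clamp 0 ≡ zero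
        clamp0 = toℕ-injective (toℕ-clamp z≤n)
        clampN : clamp N ≡ fromℕ N
        clampN = toℕ-injective (trans (toℕ-clamp ≤-refl) (≡-sym (toℕ-fromℕ N)))

-- Iterated universal quantification over states, which are j-tuples of vertices. Each block
-- refers only to the previous one, so that the number of steps enters the code by iteration.

module Iterate (j : ℕ) (I : Formula (j + 0)) (T : Formula (j + j)) (F : Formula j) where

  weaken : ∀ n → Fin (j + j) → Fin (j + (j + n))
  weaken n i = cast (+-assoc j j n) (i ↑ˡ n)

  iterate : ℕ → ∀ n → Formula (j + n)
  iterate zero    n = ren (_↑ˡ n) F
  iterate (suc k) n = alls j (or (neg (ren (weaken n) T)) (iterate k (j + n)))

  iteration : ℕ → Sentence
  iteration k = alls j (or (neg I) (iterate k 0))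

  codeF-iterate : ∀ k n → codeF (iterate k n) ≡ codeSteps j (pair 2 (codeF T)) k (codeF F)
  codeF-iterate zero    n = codeF-ren F (λ i → toℕ-↑ˡ i n)
  codeF-iterate (suc k) n = trans (codeF-alls j _)
    (cong₂ (codeAllOr j) (cong (pair 2) (codeF-ren T λ i → trans (toℕ-cast _ (i ↑ˡ n)) (toℕ-↑ˡ i n))) (codeF-iterate k (j + n)))

  codeF-iteration : ∀ k → codeF (iteration k) ≡ codeAllOr j (pair 2 (codeF I)) (codeSteps j (pair 2 (codeF T)) k (codeF F))
  codeF-iteration k = trans (codeF-alls j _) (cong (codeAllOr j (pair 2 (codeF I))) (codeF-iterate k 0))

  module _ (G : Graph) where

    State : Set
    State = Vec (Vertex G) j

    Initial Final : State → Set
    Initial vs = Sat G I (extends vs noVar)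
    Final vs = Sat G F (lookup vs)

    Transition : State → State → Set
    Transition vs′ vs = Sat G T (extends vs′ (lookup vs))

    Reach : ℕ → State → Set
    Reach zero    vs = Initial vs
    Reach (suc k) vs = Σ State λ vs₀ → Reach k vs₀ × Transition vs vs₀

    After : ℕ → State → Set
    After zero    vs = Final vs
    After (suc k) vs = ∀ vs′ → Transition vs′ vs → After k vs′

    extends-weaken : ∀ {i n} (vs′ : Vec (Vertex G) i) (vs : State) (ρ : Fin n → Vertex G) .(eq : i + j + n ≡ i + (j + n)) a →
                     extends vs′ (extends vs ρ) (cast eq (a ↑ˡ n)) ≡ extends vs′ (lookup vs) a
    extends-weaken []        vs ρ eq a       = trans (cong (extends vs ρ) (cast-is-id eq _)) (extends-↑ˡ vs a)
    extends-weaken (v ∷ vs′) vs ρ eq zero    = refl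
    extends-weaken (v ∷ vs′) vs ρ eq (suc a) = extends-weaken vs′ vs ρ (suc-injective eq) a

    Sat-iterate : ∀ k {n} vs (ρ : Fin n → Vertex G) → Sat G (iterate k n) (extends vs ρ) ⇔ After k vs
    Sat-iterate zero    vs ρ = Sat-ren G F (extends-↑ˡ vs)
    Sat-iterate (suc k) {n} vs ρ = to , from
      where
      body = or (neg (ren (weaken n) T)) (iterate k (j + n))
      step⇔ = λ vs′ → Sat-ren G T {weaken n} {extends vs′ (extends vs ρ)} {extends vs′ (lookup vs)} (extends-weaken vs′ vs ρ _)
      to : Sat G (iterate (suc k) n) (extends vs ρ) → After (suc k) vs
      to h vs′ t = [ (λ ¬t → ⊥-elim (¬t (proj₂ (step⇔ vs′) t))) , proj₁ (Sat-iterate k vs′ (extends vs ρ)) ]′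
                   (proj₁ (Sat-alls G j body) h vs′)
      from : After (suc k) vs → Sat G (iterate (suc k) n) (extends vs ρ)
      from h = proj₂ (Sat-alls G j body) λ vs′ →
        proj₂ (¬⊎⇔→ (Sat? G (ren (weaken n) T) (extends vs′ (extends vs ρ))))
          λ t → proj₂ (Sat-iterate k vs′ (extends vs ρ)) (h vs′ (proj₁ (step⇔ vs′) t))

    -- Transitions are moved one at a time from the quantifiers still ahead to the path already
    -- walked.
    Reach-After : ∀ i k → (∀ vs → Reach i vs → After k vs) ⇔ (∀ vs → Reach (k + i) vs → Final vs)
    Reach-After i zero    = ⇔-refl
    Reach-After i (suc k) = let f , f⁻ = Reach-After (suc i) k in
      (λ h vs r → f (λ vs (vs₀ , r , t) → h vs₀ r vs t) vs (subst (λ l → Reach l vs) (≡-sym (+-suc k i)) r)) ,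
      λ h vs r vs′ t → f⁻ (λ vs r → h vs (subst (λ l → Reach l vs) (+-suc k i) r)) vs′ (vs , r , t)

    ⊨-iteration : ∀ k → (G ⊨ iteration k) ⇔ (∀ vs → Reach k vs → Final vs)
    ⊨-iteration k = to , from
      where
      body = or (neg I) (iterate k 0)
      to : G ⊨ iteration k → ∀ vs → Reach k vs → Final vs
      to h vs r = proj₁ (Reach-After 0 k) (λ vs i →
          [ (λ ¬i → ⊥-elim (¬i i)) , proj₁ (Sat-iterate k vs noVar) ]′ (proj₁ (Sat-alls G j body) h vs))
        vs (subst (λ l → Reach l vs) (≡-sym (+-identityʳ k)) r)
      from : (∀ vs → Reach k vs → Final vs) → G ⊨ iteration k
      from h = proj₂ (Sat-alls G j body) λ vs → proj₂ (¬⊎⇔→ (Sat? G I (extends vs noVar))) λ i →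
        proj₂ (Sat-iterate k vs noVar)
          (proj₂ (Reach-After 0 k) (λ vs r → h vs (subst (λ l → Reach l vs) (+-identityʳ k) r)) vs i)

-- The sentence as a statement about copies of `ℋ N`

guarded : Sentence → Formula (j + 0) → Formula (j + j) → (Rec 1 → Formula j) → Rec 1 → ℕ → Sentence
guarded {j} U I T F f k = and U (Iterate.iteration j I T (F f) k)

mapᵠ : (A → B) → QF A → QF B
mapᵠ f (edgeᵠ b x y) = edgeᵠ b (f x) (f y)
mapᵠ f (eqᵠ x y)     = eqᵠ (f x) (f y)
mapᵠ f (¬ᵠ q)        = ¬ᵠ mapᵠ f q
mapᵠ f (q ∧ᵠ r)      = mapᵠ f q ∧ᵠ mapᵠ f r
mapᵠ f (q ∨ᵠ r)      = mapᵠ f q ∨ᵠ mapᵠ f r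
mapᵠ f (q ⇒ᵠ r)      = mapᵠ f q ⇒ᵠ mapᵠ f r
mapᵠ f (⋀ᵠ q)        = ⋀ᵠ λ i → mapᵠ f (q i)

rest : Name k → Name (suc k)
rest (par i)  = par i
rest (el j t) = el (suc j) t

baseᵠ : QF (Name 2)
baseᵠ = paramsᵠ ∧ᵠ elemᵠ zero ∧ᵠ elemᵠ (suc zero) ∧ᵠ leᵠ (el zero) (el (suc zero))

-- A state consists of a counter el 0, the bounds el 1 and el 2, and the parameters.
initᵠ : QF (Name 3)
initᵠ = mapᵠ rest baseᵠ ∧ᵠ ⋀ᵠ λ t → eqᵠ (el zero t) (el (suc zero) t)

-- `inj₁` names the new state and `inj₂` the old one. Parameters and bounds are kept, and the
-- counter moves to its strict successor within the range.
stepᵠ : QF (Name 3 ⊎ Name 3)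
stepᵠ = (⋀ᵠ λ i → eqᵠ (inj₁ (par i)) (inj₂ (par i))) ∧ᵠ
        (⋀ᵠ {m = 1} λ j → ⋀ᵠ λ t → eqᵠ (inj₁ (el (suc j) t)) (inj₂ (el (suc j) t))) ∧ᵠ
        mapᵠ inj₁ rangeᵠ ∧ᵠ
        scᵠ (λ t → inj₂ (el zero t)) (λ t → inj₁ (el zero t)) ∧ᵠ
        ¬ᵠ leᵠ (λ t → inj₁ (el zero t)) (λ t → inj₂ (el zero t))

stepVar : Name 3 ⊎ Name 3 → Fin (#Names 3 + #Names 3)
stepVar = [ (λ a → code a ↑ˡ #Names 3) , (λ a → #Names 3 ↑ʳ code a) ]′

initial : Formula (#Names 3 + 0)
initial = nnf (localᵛ 0) true initᵠ

transition : Formula (#Names 3 + #Names 3)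
transition = nnf stepVar true stepᵠ

valueᵗ : Rec 1 → TF 1
valueᵗ f = ∃ᵗ χ f (λ _ → suc zero) zero

-- Used under a negation, at the end of all blocks. It is what certifies that the range is a
-- standard copy, so universal sentences need not do so.
computes : Rec 1 → Formula (#Names 3)
computes f = and (nnf code true rangeᵠ)
                 (tr (code ∘ rest) (λ _ t → code {3} (el zero t)) (arithmeticᵗ ∧ᵗ valueᵗ f))

module Sentences (f : Rec 1) = Iterate (#Names 3) initial transition (neg (computes f))

sentence : Rec 1 → ℕ → Sentence
sentence = guarded theory initial transition (neg ∘ computes)

-- 𝔑 N is large enough to see that f has a value at k.
Sees : Rec 1 → ℕ → ℕ → Set
Sees f k N = Σ (Fin (suc N)) λ i → toℕ i ≡ k × TSat (𝔑 N) (valueᵗ f) (λ _ → i)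

module _ (G : Graph) (th : Theory G) (f : Rec 1) where
  open Sentences f using (State; Reach; Initial; Transition)

  private
    state : State G → Name 3 → Vertex G
    state = assign 3

    both : State G → State G → Name 3 ⊎ Name 3 → Vertex G
    both vs′ vs = [ state vs′ , state vs ]′

    Initial-⇔ : ∀ vs → Initial G vs ⇔ Holds G initᵠ (state vs)
    Initial-⇔ vs = ⇔-trans (Sat-nnf (localᵛ 0) G initᵠ (extends vs noVar))
      (Holds-cong G initᵠ (ρ ∘ localᵛ 0) (state vs) (extends-localᵛ 3 vs) ,
       Holds-cong G initᵠ (state vs) (ρ ∘ localᵛ 0) (≡-sym ∘ extends-localᵛ 3 vs))
      where
      ρ : Fin (#Names 3 + 0) → Vertex G
      ρ = extends vs noVar

    stepVar≡ : ∀ (vs′ vs : State G) a → extends vs′ (lookup vs) (stepVar a) ≡ both vs′ vs a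
    stepVar≡ vs′ vs (inj₁ a) = extends-↑ˡ vs′ (code a)
    stepVar≡ vs′ vs (inj₂ a) = extends-↑ʳ vs′ (code a)

    Transition-⇔ : ∀ vs′ vs → Transition G vs′ vs ⇔ Holds G stepᵠ (both vs′ vs)
    Transition-⇔ vs′ vs = ⇔-trans (Sat-nnf stepVar G stepᵠ (extends vs′ (lookup vs)))
      (Holds-cong G stepᵠ (extends vs′ (lookup vs) ∘ stepVar) (both vs′ vs) (stepVar≡ vs′ vs) ,
       Holds-cong G stepᵠ (both vs′ vs) (extends vs′ (lookup vs) ∘ stepVar) (≡-sym ∘ stepVar≡ vs′ vs))

    rest≡ : ∀ vs′ vs → Holds G stepᵠ (both vs′ vs) → ∀ a → state vs′ (rest a) ≡ state vs (rest a)
    rest≡ vs′ vs (p≡ , _)      (par i)  = p≡ i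
    rest≡ vs′ vs (_ , e≡ , _) (el j t) = e≡ j t

    Reach-base : ∀ k vs → Reach G k vs → Holds G baseᵠ (state vs ∘ rest)
    Reach-base zero    vs r = proj₁ (proj₁ (Initial-⇔ vs) r)
    Reach-base (suc k) vs (vs₀ , r , t) =
      Holds-cong G baseᵠ (state vs₀ ∘ rest) (state vs ∘ rest)
        (≡-sym ∘ rest≡ vs vs₀ (proj₁ (Transition-⇔ vs vs₀) t)) (Reach-base k vs₀ r)

  module _ (k : ℕ) (vs : State G) (r : Reach G k vs) (sat : Sat G (computes f) (lookup vs)) where

    private
      g : Name 2 → Vertex G
      g = state vs ∘ rest
      base : Holds G baseᵠ g
      base = Reach-base k vs r
      α : IsParams G (g ∘ par)
      α = proj₁ base
      u : Carrier (elements G g)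
      u = (λ t → state vs (el zero t)) , proj₁ (Sat-nnf code G rangeᵠ (lookup vs)) (proj₁ sat)
      u-sat : TSat (elements G g) (arithmeticᵗ ∧ᵗ valueᵗ f) (λ _ → u)
      u-sat = proj₁
        (Sat-tr G g (arithmeticᵗ ∧ᵗ valueᵗ f) {base = code ∘ rest} {ρ = lookup vs} {σ = λ _ → u} (λ _ → refl) (λ _ _ → refl)) (proj₂ sat)

    bounded-standard : Σ ℕ (Standard G g)
    bounded-standard =
      standard G th g α {n = 1} (low-elem , reflexive low-elem , low≤high) (high-elem , low≤high , reflexive high-elem)
               {σ = λ _ → u} (proj₁ u-sat)
      where
      open Ordered G th (g ∘ par) α
      low high : Fin 3 → Vertex G
      low t = g (el zero t)
      high t = g (el (suc zero) t)
      low-elem : IsElem G (g ∘ par) low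
      low-elem = proj₁ (proj₂ base)
      high-elem : IsElem G (g ∘ par) high
      high-elem = proj₁ (proj₂ (proj₂ base))
      low≤high : LeV G low high
      low≤high = proj₂ (proj₂ (proj₂ base))

    module _ {N : ℕ} (st : Standard G g N) where
      private
        sim : Similarity (𝔑 N) (elements G g)
        sim = similarity G th g α st
        open Similarity sim using (back; ~-Sc; ~-Le)

      -- The counter starts at the lower bound, which is the number 0, and a strict step of `Sc`
      -- inside the range adds exactly one.
      position : ∀ k vs′ → Reach G k vs′ → (∀ a → state vs′ (rest a) ≡ g a) →
                 Σ (Fin (suc N)) λ i → toℕ i ≡ k × (∀ t → state vs′ (el zero t) ≡ names st (el i t))
      position zero vs′ r eq = zero , refl , λ t →
        trans (proj₂ (proj₁ (Initial-⇔ vs′) r) t) (trans (eq (el zero t)) (≡-sym (first st t)))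
      position (suc k) vs′ (vs₀ , r , t) eq with proj₁ (Transition-⇔ vs′ vs₀) t
      ... | step@(_ , _ , rng′ , sc , ≰) with position k vs₀ r (λ a → trans (≡-sym (rest≡ vs′ vs₀ step a)) (eq a))
      ...   | i₀ , i₀≡k , u₀≡ = i′ , trans i′≡ (cong suc i₀≡k) , u′~i′
        where
        u′ u₀ : Carrier (elements G g)
        u′ = (λ t → state vs′ (el zero t)) ,
             Holds-cong G rangeᵠ (state vs′) ((λ t → state vs′ (el zero t)) ◂ g)
               (λ { (par i) → eq (par i) ; (el zero t) → refl ; (el (suc j) t) → eq (el j t) }) rng′
        u₀ = (λ t → state vs₀ (el zero t)) ,
             Holds-cong G rangeᵠ ((λ t → names st (el i₀ t)) ◂ g) ((λ t → state vs₀ (el zero t)) ◂ g)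
               (◂-cong (≡-sym ∘ u₀≡) (λ _ → refl)) (inRange-c G th g α st i₀)
        i′ = proj₁ (back u′)
        u′~i′ = proj₂ (back u′)
        i′≡ : toℕ i′ ≡ suc (toℕ i₀)
        i′≡ = [ (λ e → ⊥-elim (≰ (proj₁ (~-Le {i′} {i₀} {u′} {u₀} u′~i′ u₀≡) (≤-reflexive e)))) , id ]′
                (proj₂ (~-Sc {i₀} {i′} {u₀} {u′} u₀≡ u′~i′) sc)

      standard⇒copy : Sees f k N × FullHom (ℋ N) G
      standard⇒copy with position k vs r (λ _ → refl)
      ... | i , i≡k , u~i = (i , i≡k , proj₂ (TSat-similar sim (valueᵗ f) {λ _ → i} {λ _ → u} (λ _ → u~i)) (proj₂ u-sat)) ,
                            proj₁ (Copy⇔FullHom G N) (names st , copy st)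

  bad⇒copy : ∀ k vs → Reach G k vs → Sat G (computes f) (lookup vs) → Σ ℕ λ N → Sees f k N × FullHom (ℋ N) G
  bad⇒copy k vs r sat = map₂ (standard⇒copy k vs r sat) (bounded-standard k vs r sat)

  copy⇒bad : ∀ k N → Sees f k N → FullHom (ℋ N) G → Σ (State G) λ vs → Reach G k vs × Sat G (computes f) (lookup vs)
  copy⇒bad k N (i , i≡k , sat) hom = vs k , reaches k k≤N , rng ,
    proj₂ (Sat-tr G g (arithmeticᵗ ∧ᵗ valueᵗ f) {base = code ∘ rest} {ρ = lookup (vs k)} {σ = λ _ → u}
      (λ { (par i) → state≡ k (par i) ; (el j t) → state≡ k (el (suc j) t) }) (λ _ t → state≡ k (el zero t)))
      (proj₁ (TSat-similar sim (arithmeticᵗ ∧ᵗ valueᵗ f) {λ _ → i} (λ _ → u~i)) (𝔑-arithmetic {1} N {λ _ → i} , sat))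
    where
    c : Name (suc N) → Vertex G
    c = proj₁ (proj₂ (Copy⇔FullHom G N) hom)
    g : Name 2 → Vertex G
    g = (λ t → c (el zero t)) ◂ (λ t → c (el (fromℕ N) t)) ◂ paramsOnly (c ∘ par)
    st : Standard G g N
    st = record
      { names = c ; copy = proj₂ (proj₂ (Copy⇔FullHom G N) hom)
      ; par≡ = λ _ → refl ; first = λ _ → refl ; last = λ _ → refl }
    α : IsParams G (g ∘ par)
    α i j = copy st (par i) (par j)
    sim : Similarity (𝔑 N) (elements G g)
    sim = similarity G th g α st
    open Similarity sim using (~-Sc; ~-Le)
    k≤N : k ≤ N
    k≤N = subst (_≤ N) i≡k (toℕ≤ i)
    cℕ : ℕ → Fin 3 → Vertex G
    cℕ l t = c (el (fin (m⊓n≤n l N)) t)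
    h : ℕ → Name 3 → Vertex G
    h l = cℕ l ◂ g
    vs : ℕ → State G
    vs l = pack 3 (h l)
    state≡ : ∀ l a → state (vs l) a ≡ h l a
    state≡ l a = assign-pack 3 (h l) a
    carrier : ℕ → Carrier (elements G g)
    carrier l = cℕ l , inRange-c G th g α st (fin (m⊓n≤n l N))
    toℕ-clamp : ∀ {l} → l ≤ N → toℕ (fin (m⊓n≤n l N)) ≡ l
    toℕ-clamp {l} l≤N = trans (toℕ-fin (m⊓n≤n l N)) (m≤n⇒m⊓n≡m l≤N)
    u : Carrier (elements G g)
    u = carrier k
    u~i : ∀ t → cℕ k t ≡ c (el i t)
    u~i t = cong (λ i → c (el i t)) (toℕ-injective (trans (toℕ-clamp k≤N) (≡-sym i≡k)))
    rng : Sat G (nnf code true rangeᵠ) (lookup (vs k))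
    rng = proj₂ (Sat-nnf code G rangeᵠ (lookup (vs k)))
            (Holds-cong G rangeᵠ (h k) (state (vs k)) (≡-sym ∘ state≡ k) (proj₂ u))
    zero≡ : fin (m⊓n≤n 0 N) ≡ zero
    zero≡ = toℕ-injective (toℕ-fin (m⊓n≤n 0 N))
    reaches : ∀ l → l ≤ N → Reach G l (vs l)
    reaches zero _ = proj₂ (Initial-⇔ (vs 0)) (Holds-cong G initᵠ (h 0) (state (vs 0)) (≡-sym ∘ state≡ 0)
      ((α , isElem G th g α st zero , isElem G th g α st (fromℕ N) ,
        proj₂ (Le-c G th g α st zero (fromℕ N)) z≤n) , λ t → cong (λ i → c (el i t)) zero≡))
    reaches (suc l) l<N = vs l , reaches l (<⇒≤ l<N) , proj₂ (Transition-⇔ (vs (suc l)) (vs l))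
      (Holds-cong G stepᵠ [ h (suc l) , h l ]′ (both (vs (suc l)) (vs l))
        (λ { (inj₁ a) → ≡-sym (state≡ (suc l) a) ; (inj₂ a) → ≡-sym (state≡ l a) })
        ((λ _ → refl) , (λ _ _ → refl) , proj₂ (carrier (suc l)) ,
         proj₁ (~-Sc {b = carrier l} {carrier (suc l)} (λ _ → refl) (λ _ → refl)) (inj₂ suc≡) ,
         λ l≤ → <-irrefl refl (≤-trans (≤-reflexive (≡-sym suc≡))
           (proj₂ (~-Le {b = carrier (suc l)} {carrier l} (λ _ → refl) (λ _ → refl)) l≤))))
      where
      suc≡ : toℕ (fin (m⊓n≤n (suc l) N)) ≡ suc (toℕ (fin (m⊓n≤n l N)))
      suc≡ = trans (toℕ-clamp l<N) (cong suc (≡-sym (toℕ-clamp (<⇒≤ l<N))))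

-- The graphs `ℋ N` satisfy the theory

typed : ∀ (a : Name k) t → (∀ i → nameAdj a (par i) ≡ role t i) → Σ (Fin k) λ i → a ≡ el i t
typed (par i)   t h = ⊥-elim (from-yes (all? λ i → all? λ t → ¬? (all? λ l → paramAdj i l ≟ᵇ role t l)) i t h)
typed (el i t′) t h with from-yes (all? λ t → all? λ t′ → all? (λ l → role t l ≟ᵇ role t′ l) →-dec (t ≟ᶠ t′)) t′ t h
... | refl = i , refl

-- The three adjacencies give i₀ ≤ i₁ ≤ i₂ ≤ i₀.
located : ∀ (x : Fin 3 → Name k) → (∀ t i → nameAdj (x t) (par i) ≡ role t i) →
          (∀ t t′ → nameAdj (x t) (x t′) ≡ distinct t t′) → Σ (Fin k) λ i → ∀ t → x t ≡ el i t
located x roles dist = i₀ , λ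
  { zero → e₀
  ; (suc zero) → trans e₁ (cong (λ i → el i _) i₁≡i₀)
  ; (suc (suc zero)) → trans e₂ (cong (λ i → el i _) i₂≡i₀) }
  where
  typed₀ = typed (x zero) zero (roles zero)
  typed₁ = typed (x (suc zero)) (suc zero) (roles (suc zero))
  typed₂ = typed (x (suc (suc zero))) (suc (suc zero)) (roles (suc (suc zero)))
  i₀ = proj₁ typed₀
  i₁ = proj₁ typed₁
  i₂ = proj₁ typed₂
  e₀ = proj₂ typed₀
  e₁ = proj₂ typed₁
  e₂ = proj₂ typed₂
  i₀≤i₁ : toℕ i₀ ≤ toℕ i₁
  i₀≤i₁ = [ ≤-reflexive , (λ i∈ → <⇒≤ (∈ᵇ⇒< (toℕ i₁) i∈)) ]′
    (proj₁ (isYes-⇔ (Bt? (toℕ i₀) (toℕ i₁))) (trans (≡-sym (cong₂ nameAdj e₀ e₁)) (dist zero (suc zero))))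
  i₁≤i₂ : toℕ i₁ ≤ toℕ i₂
  i₁≤i₂ = [ (λ e → ≤-reflexive (≡-sym e)) , (λ e → ≤-trans (n≤1+n _) (≤-reflexive (≡-sym e))) ]′
    (proj₁ (isYes-⇔ (Sc? (toℕ i₁) (toℕ i₂))) (trans (≡-sym (cong₂ nameAdj e₁ e₂)) (dist (suc zero) (suc (suc zero)))))
  i₂≤i₀ : toℕ i₂ ≤ toℕ i₀
  i₂≤i₀ = proj₁ (isYes-⇔ (toℕ i₂ ≤? toℕ i₀)) (trans (≡-sym (cong₂ nameAdj e₀ e₂)) (dist zero (suc (suc zero))))
  i₁≡i₀ : i₁ ≡ i₀
  i₁≡i₀ = toℕ-injective (≤-antisym (≤-trans i₁≤i₂ i₂≤i₀) i₀≤i₁)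
  i₂≡i₀ : i₂ ≡ i₀
  i₂≡i₀ = toℕ-injective (≤-antisym i₂≤i₀ (≤-trans i₀≤i₁ i₁≤i₂))

-- By `rigid` and `located`, anything that looks like parameters or an element is one, and the
-- axioms become facts about ≤ on ℕ. As the theory is universal, all induced subgraphs of `ℋ N`
-- inherit it, so φ can fail in them only by a copy.
ℋ-theory : ∀ N → Theory (ℋ N)
ℋ-theory N h (α , el₀ , el₁ , el₂) =
  (λ t → trans (adj≡ zero (suc zero) t t) (link-self t _ _)) ,
  [ (λ l → inj₁ (proj₂ (Le-⇔ x y) l)) , (λ l → inj₂ (proj₂ (Le-⇔ y x) l)) ]′ (≤-total (index x) (index y)) ,
  (λ (l , l′) t → coincide t (toℕ-injective (≤-antisym (proj₁ (Le-⇔ x y) l) (proj₁ (Le-⇔ y x) l′)))) ,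
  (λ (l , l′) → proj₂ (Le-⇔ x w) (≤-trans (proj₁ (Le-⇔ x y) l) (proj₁ (Le-⇔ y w) l′))) ,
  (λ s → proj₂ (Le-⇔ x y) ([ (λ e → ≤-reflexive (≡-sym e)) , (λ e → ≤-trans (n≤1+n _) (≤-reflexive (≡-sym e))) ]′ (Sc⇒ s))) ,
  (λ (s , l , l′) → [ inj₁ ∘ proj₂ (Le-⇔ w x) , inj₂ ∘ proj₂ (Le-⇔ y w) ]′
                      (squeeze (Sc⇒ s) (proj₁ (Le-⇔ x w) l) (proj₁ (Le-⇔ w y) l′))) ,
  λ b → proj₂ (Le-⇔ x y) ([ ≤-reflexive , (λ i∈ → <⇒≤ (∈ᵇ⇒< (index y) i∈)) ]′ (Bt⇒ b))
  where
  nm : Name 3 → Name (suc N)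
  nm = decode (suc N) ∘ h
  fixed : ∀ i → nm (par i) ≡ par i
  fixed = rigid (nm ∘ par) α
  locate : ∀ j → IsElem (ℋ N) (h ∘ par) (λ t → h (el j t)) → Σ (Fin (suc N)) λ i → ∀ t → nm (el j t) ≡ el i t
  locate j (roles , dist) =
    located (λ t → nm (el j t)) (λ t i → trans (cong (nameAdj (nm (el j t))) (≡-sym (fixed i))) (roles t i)) dist
  place : ∀ j → Σ (Fin (suc N)) λ i → ∀ t → nm (el j t) ≡ el i t
  place zero             = locate zero el₀
  place (suc zero)       = locate (suc zero) el₁
  place (suc (suc zero)) = locate (suc (suc zero)) el₂
  index : Fin 3 → ℕ
  index j = toℕ (proj₁ (place j))
  x y w : Fin 3
  x = zero
  y = suc zero
  w = suc (suc zero)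
  adj≡ : ∀ j j′ t t′ → adj (ℋ N) (h (el j t)) (h (el j′ t′)) ≡ link t t′ (index j) (index j′)
  adj≡ j j′ t t′ = cong₂ nameAdj (proj₂ (place j) t) (proj₂ (place j′) t′)
  Le-⇔ : ∀ j j′ → LeV (ℋ N) (λ t → h (el j t)) (λ t → h (el j′ t)) ⇔ (index j ≤ index j′)
  Le-⇔ j j′ = subst (λ b → (b ≡ true) ⇔ (index j ≤ index j′)) (≡-sym (adj≡ j′ j zero (suc (suc zero)))) (isYes-⇔ (index j ≤? index j′))
  Sc⇒ : ScV (ℋ N) (λ t → h (el x t)) (λ t → h (el y t)) → index y ≡ index x ⊎ index y ≡ suc (index x)
  Sc⇒ s = proj₁ (isYes-⇔ (Sc? (index x) (index y))) (trans (≡-sym (adj≡ x y (suc zero) (suc (suc zero)))) s)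
  Bt⇒ : BtV (ℋ N) (λ t → h (el x t)) (λ t → h (el y t)) → index x ≡ index y ⊎ index x ∈ᵇ index y
  Bt⇒ b = proj₁ (isYes-⇔ (Bt? (index x) (index y))) (trans (≡-sym (adj≡ x y zero (suc zero))) b)
  coincide : ∀ t → proj₁ (place x) ≡ proj₁ (place y) → h (el x t) ≡ h (el y t)
  coincide t e = trans (≡-sym (code-decode (suc N) (h (el x t)))) (trans
    (cong code (trans (proj₂ (place x) t) (trans (cong (λ i → el i t) e) (≡-sym (proj₂ (place y) t)))))
    (code-decode (suc N) (h (el y t))))
  squeeze : ∀ {a b c} → b ≡ a ⊎ b ≡ suc a → a ≤ c → c ≤ b → c ≤ a ⊎ b ≤ c
  squeeze (inj₁ refl) a≤c c≤b = inj₁ c≤b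
  squeeze {a} {c = c} (inj₂ refl) a≤c c≤b with m≤n⇒m<n∨m≡n c≤b
  ... | inj₁ c<b = inj₁ (s≤s⁻¹ c<b)
  ... | inj₂ refl = inj₂ ≤-refl

-- Large minimal counterexamples

least : ∀ {Q : ℕ → Set} n → Q n → ¬ ¬ Σ ℕ λ m → Q m × (∀ {l} → Q l → m ≤ l)
least {Q} n q none = <-rec (λ n → ¬ Q n) (λ n rec q → none (n , q , λ {l} ql → ≮⇒≥ λ l<n → rec l<n ql)) n q

⊨-sentence : ∀ G f k → (G ⊨ sentence f k) ⇔ (Theory G × ¬ Σ ℕ λ N → Sees f k N × FullHom (ℋ N) G)
⊨-sentence G f k = to , from
  where
  open Sentences f
  to : G ⊨ sentence f k → _
  to (t , it) = let th = proj₁ (⊨-theory G) t in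
    th , λ (N , sees , hom) → let vs , r , bad = copy⇒bad G th f k N sees hom in proj₁ (⊨-iteration G k) it vs r bad
  from : _ → G ⊨ sentence f k
  from (th , none) = proj₂ (⊨-theory G) th , proj₂ (⊨-iteration G k) λ vs r bad → none (bad⇒copy G th f k vs r bad)

-- Nothing with at most m vertices explains why H is not a model.
Large : Sentence → ℕ → Graph → Set
Large φ m H = ¬ H ⊨ φ × (∀ B → InducedEmb B H → size B ≤ m → B ⊨ φ)

module _ (f : Rec 1) (k : ℕ) where

  private
    φ = sentence f k

  -- If no N sees a value, φ is equivalent to `theory`. Otherwise, for the least such K, every
  -- forbidden `ℋ N` contains a copy of `ℋ K`, so excluding this one graph suffices. The two cases
  -- are combined by refuting the second with `none`.
  universal-equivalent : ¬ ¬ Σ Sentence λ μ → Universal μ × SameFinGraphs φ μ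
  universal-equivalent none = none (theory , Universal-theory , λ G →
    let to , from = ⊨-sentence G f k ; th , th⁻ = ⊨-theory G in
    (λ h → th⁻ (proj₁ (to h))) ,
    λ t → from (th t , λ (N , sees , _) → least N sees λ (K , sees′ , min) → none (finite K sees′ min)))
    where
    finite : ∀ K → Sees f k K → (∀ {N} → Sees f k N → K ≤ N) → Σ Sentence λ μ → Universal μ × SameFinGraphs φ μ
    finite K sees min = and theory (noMatrix (adj (ℋ K))) ,
      u-and Universal-theory (Universal-noMatrix (adj (ℋ K))) , λ G →
        let to , from = ⊨-sentence G f k ; th , th⁻ = ⊨-theory G ; ∄ , ∄⁻ = ⊨-noMatrix G (adj (ℋ K)) in
        (λ h → let t , ¬bad = to h in th⁻ t , ∄⁻ λ hom → ¬bad (K , sees , hom)) ,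
        λ (t , h) → from (th t , λ (N , sees′ , hom) → ∄ h (FullHom-trans {ℋ K} {ℋ N} {G} (ℋ-mono (min sees′)) hom))

  -- The value m is itself a number of every `𝔑 N` that sees it. Such an `ℋ N` has more than m
  -- vertices, and since its copies are injective, none fits into a graph with at most m vertices.
  large-minimal : ∀ {m} → f [ k ∷ [] ]⇓ m → ¬ ¬ Σ Graph (Large φ m)
  large-minimal {m} d none = least N sees λ (K , sees′ , min) → none (ℋ K , minimal K sees′ min)
    where
    eventually : Σ ℕ (Valid f (k ∷ []) m)
    eventually = χ-complete d
    N₀ = proj₁ eventually
    N = N₀ + (k + m)
    k≤N : k ≤ N
    k≤N = ≤-trans (m≤m+n k m) (m≤n+m (k + m) N₀)
    m≤N : m ≤ N
    m≤N = ≤-trans (m≤n+m m k) (m≤n+m (k + m) N₀)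
    sees : Sees f k N
    sees = fin k≤N , toℕ-fin k≤N , fin m≤N ,
      Valid.use (proj₂ eventually) (m≤m+n N₀ (k + m)) {λ _ → suc zero} {zero} {fin m≤N ▹ (λ _ → fin k≤N)}
        (λ { zero → toℕ-fin k≤N }) (toℕ-fin m≤N)
    m≤ : ∀ K → Sees f k K → m ≤ K
    m≤ K (i , i≡k , y , t) = subst (_≤ K) (⇓-deterministic (χ-sound f {ρ = y ▹ (λ _ → i)} (λ { zero → i≡k }) t) d) (toℕ≤ y)
    minimal : ∀ K → Sees f k K → (∀ {N} → Sees f k N → K ≤ N) → Large φ m (ℋ K)
    minimal K sees min =
      (λ h → proj₂ (proj₁ (⊨-sentence (ℋ K) f k) h) (K , sees , id , λ _ _ → refl)) ,
      λ B e B≤m → proj₂ (⊨-sentence B f k)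
        (proj₁ (⊨-theory B) (⊨-hereditary {B} {ℋ K} Universal-theory e (proj₂ (⊨-theory (ℋ K)) (ℋ-theory K))) ,
         λ (N , sees′ , hom) → <⇒≱ (begin-strict
           size B              ≤⟨ B≤m ⟩
           m                   ≤⟨ m≤ N sees′ ⟩
           N                   <⟨ n<1+n N ⟩
           suc N               ≤⟨ m≤m*n (suc N) 3 ⟩
           suc N * 3           ≤⟨ m≤n+m (suc N * 3) 7 ⟩
           #Names (suc N)      ∎)
           (injective⇒≤ (λ {x} {y} → FullHom-injective {N} {B} hom x y)))
      where open ≤-Reasoning

-- The fixed point: κ is the code of the innermost formula of φ, and the program f in that
-- formula computes the code of φ from κ and applies c to it.
module FixedPoint {j : ℕ} (U : Sentence) (I : Formula (j + 0)) (T : Formula (j + j)) (F : Rec 1 → Formula j) (c : Rec 1)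
  (equivalent : ∀ f k → ¬ ¬ Σ Sentence λ μ → Universal μ × SameFinGraphs (guarded U I T F f k) μ)
  (large : ∀ f k {m} → f [ k ∷ [] ]⇓ m → ¬ ¬ Σ Graph (Large (guarded U I T F f k) m))
  where

  private
    f : Rec 1
    f = C c (diagonalᴿ j (codeF U) (pair 2 (codeF I)) (pair 2 (codeF T)) ∷ [])

    κ : ℕ
    κ = codeF (F f)

    φ : Sentence
    φ = guarded U I T F f κ

    codeF-φ : codeF φ ≡ diagonal j (codeF U) (pair 2 (codeF I)) (pair 2 (codeF T)) κ
    codeF-φ = cong (λ x → pair 3 (pair (codeF U) x)) (Iterate.codeF-iteration j I T (F f) κ)

    large-φ : ∀ {m} → c [ codeF φ ∷ [] ]⇓ m → ¬ ¬ Σ Graph (Large φ m)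
    large-φ {m} d = large f κ (ev-C₁ (diagonalᴿ-⇓ j (codeF U) (pair 2 (codeF I)) (pair 2 (codeF T)) κ)
                                     (subst (λ x → c [ x ∷ [] ]⇓ m) codeF-φ d))

  -- The returned μ fails in H, hence in an induced subgraph with at most `codeF μ` vertices; but
  -- this number is the value m, and φ holds in all such subgraphs.
  no-universal : ¬ (∀ (φ : Sentence) →
    (Σ Sentence λ μ → Universal μ × SameFinGraphs φ μ) →
    Σ Sentence λ μ → Universal μ × (c [ codeF φ ∷ [] ]⇓ codeF μ) × SameFinGraphs φ μ)
  no-universal alg = equivalent f κ λ eq → contradict (alg φ eq)
    where
    contradict : ¬ Σ Sentence λ μ → Universal μ × (c [ codeF φ ∷ [] ]⇓ codeF μ) × SameFinGraphs φ μ
    contradict (μ , u , d , same) = large-φ d λ (H , ¬H , small) →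
      let B , B≤ , e , ¬B = smallRefutation H u (¬H ∘ proj₂ (same H)) in
      ¬B (proj₁ (same B) (small B e (≤-trans B≤ (#∀≤codeF u))))

  -- A member of F inside H has fewer than `codeGs F` vertices, so it satisfies φ, although it
  -- contains itself as a forbidden graph.
  no-obstructions : ¬ (∀ (φ : Sentence) →
    (Σ (List Graph) λ F → DefinesForb φ F) →
    Σ (List Graph) λ F → (c [ codeF φ ∷ [] ]⇓ codeGs F) × DefinesForb φ F)
  no-obstructions alg = equivalent f κ λ (μ , u , same) →
    contradict (alg φ (obstructions u , λ G → ⇔-trans (same G) (obstructions-define u G)))
    where
    contradict : ¬ Σ (List Graph) λ F → (c [ codeF φ ∷ [] ]⇓ codeGs F) × DefinesForb φ F
    contradict (F , d , def) = large-φ d λ (H , ¬H , small) →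
      ¬H (proj₂ (def H) λ B B∈ e →
        proj₁ (def B) (small B e (<⇒≤ (size<codeGs B∈))) B B∈ (id , (λ _ _ → id) , λ _ _ → refl))

theorem1p3 : (¬ Σ (Rec 1) λ c →
    ∀ (φ : Sentence) →
    (Σ Sentence λ μ → Universal μ × SameFinGraphs φ μ) →
    Σ Sentence λ μ → Universal μ × (c [ codeF φ ∷ [] ]⇓ codeF μ) × SameFinGraphs φ μ)
    ×
    (¬ Σ (Rec 1) λ c →
    ∀ (φ : Sentence) →
    (Σ (List Graph) λ F → DefinesForb φ F) →
    Σ (List Graph) λ F → (c [ codeF φ ∷ [] ]⇓ codeGs F) × DefinesForb φ F)
theorem1p3 =
  (λ (c , alg) → Fixed.no-universal c alg) , λ (c , alg) → Fixed.no-obstructions c alg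
  where
  module Fixed (c : Rec 1) =
    FixedPoint theory initial transition (neg ∘ computes) c universal-equivalent large-minimal
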